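{- Let $(G,c)$ be an instance of \textsc{Bucket Integrity} and let $n=|V(G)|$. An optimal solution of $(G,c)$ can be computed in $O(5.6569^n)$ time and $O(2.8285^n)$ space.
   Context: Graphs are finite, simple and undirected. A bucket arrangement of a graph $G$ is a partition of $V(G)$ into an ordered sequence of $k$ buckets $B_1,\dots,B_k$ (for some $k$). Its width is $\max_i |B_i|$. An edge $\{u,v\}$ with $u\in B_i$ and $v\in B_j$ is short if $|i-j|<2$, and long otherwise. \textsc{Bucket Integrity}: given a graph $G$ and a capacity $c\in\mathbb{N}$, find a bucket arrangement of $G$ with width at most $c$ and the minimum number of long edges (among all bucket arrangements of $G$ of width at most $c$). Such an arrangement is called an optimal solution of $(G,c)$. -}

module Defs where

open import Data.Bool using (Bool; false; if_then_else_)
open import Data.Bool.Properties using (T?)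
open import Data.Fin as Fin using (Fin; toℕ)
open import Data.Fin.Subset using (Subset) renaming (∣_∣ to card)
open import Data.List using (List; length; filter; allFin; cartesianProduct)
open import Data.Nat
open import Data.Product using (∃-syntax; _×_; _,_)
open import Data.Vec using (tabulate)
open import Data.Vec.Functional using (foldr; updateAt)
open import Function using (const)
open import Function.Definitions using (Surjective)
open import Relation.Binary.PropositionalEquality using (_≡_; _≢_)
open import Relation.Nullary using (Dec; ¬_; ¬?; ⌊_⌋)
open import Relation.Nullary.Decidable using (_×-dec_)

record Graph (n : ℕ) : Set where
  field
    adj    : Fin n → Fin n → Bool
    sym    : ∀ u v → adj u v ≡ adj v u
    irrefl : ∀ v → adj v v ≡ false

open Graph public

-- Each edge occurs exactly once, with its smaller endpoint first.
edges : ∀ {n} → Graph n → List (Fin n × Fin n)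
edges {n} G =
  filter (λ (u , v) → (u Fin.<? v) ×-dec T? (adj G u v))
         (cartesianProduct (allFin n) (allFin n))

-- An ordered partition, given by the position of the bucket containing
-- each vertex (counted from 0). Surjectivity says that the blocks of the
-- partition are nonempty.
record BucketArrangement (n : ℕ) : Set where
  field
    k     : ℕ
    index : Fin n → Fin k
    onto  : Surjective _≡_ _≡_ index

  bucket : Fin k → Subset n
  bucket i = tabulate λ v → ⌊ index v Fin.≟ i ⌋

  width : ℕ
  width = foldr _⊔_ 0 λ i → card (bucket i)

  Short : Fin n × Fin n → Set
  Short (u , v) = ∣ toℕ (index u) - toℕ (index v) ∣ < 2

  Long : Fin n × Fin n → Set
  Long e = ¬ Short e

  long? : ∀ e → Dec (Long e)
  long? (u , v) = ¬? (∣ toℕ (index u) - toℕ (index v) ∣ <? 2)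

open BucketArrangement public

longEdges : ∀ {n} → Graph n → BucketArrangement n → ℕ
longEdges G A = length (filter (long? A) (edges G))

Optimal : ∀ {n} → Graph n → ℕ → BucketArrangement n → Set
Optimal G c A =
  width A ≤ c × (∀ A′ → width A′ ≤ c → longEdges G A ≤ longEdges G A′)

-- The model of computation is a word RAM with r registers, programmed in
-- a structured language.
data Op : Set where
  add sub mul quot rem less equal : Op

infixl 6 _⟨_⟩_
infix  4 _≔_ ⟦_⟧≔_
infixr 3 _⨾_

data Expr (r : ℕ) : Set where
  lit   : ℕ → Expr r
  reg   : Fin r → Expr r
  ⟦_⟧   : Expr r → Expr r                   -- indirect memory read
  _⟨_⟩_ : Expr r → Op → Expr r → Expr r

data Cmd (r : ℕ) : Set where
  skip  : Cmd r
  _≔_   : Fin r → Expr r → Cmd r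
  ⟦_⟧≔_ : Expr r → Expr r → Cmd r           -- indirect memory write
  _⨾_   : Cmd r → Cmd r → Cmd r
  cond  : Expr r → Cmd r → Cmd r → Cmd r
  while : Expr r → Cmd r → Cmd r

-- Subtraction is truncated, division by zero yields 0, and the
-- comparisons yield 1 or 0.
apply : Op → ℕ → ℕ → ℕ
apply add   a b       = a + b
apply sub   a b       = a ∸ b
apply mul   a b       = a * b
apply quot  a zero    = 0
apply quot  a (suc b) = a / suc b
apply rem   a zero    = 0
apply rem   a (suc b) = a % suc b
apply less  a b       = if a <ᵇ b then 1 else 0
apply equal a b       = if a ≡ᵇ b then 1 else 0

-- The number of elementary operations performed in evaluating an expression.
cost : ∀ {r} → Expr r → ℕ
cost (lit _)       = 1
cost (reg _)       = 1
cost ⟦ e ⟧         = suc (cost e)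
cost (e ⟨ _ ⟩ e′)  = suc (cost e + cost e′)

Memory : Set
Memory = ℕ → ℕ

infixl 8 _[_↦_]
_[_↦_] : Memory → ℕ → ℕ → Memory
(μ [ a ↦ x ]) i = if i ≡ᵇ a then x else μ i

record State (r : ℕ) : Set where
  constructor ⟨_,_⟩
  field
    regs : Fin r → ℕ
    mem  : Memory

open State public

-- Evaluation on a machine with w-bit words and m memory cells. A
-- computation that produces a value not fitting in a word, or that
-- accesses a cell outside 0, …, m ∸ 1, is stuck and has no derivation.
module Machine (w m : ℕ) where

  infix 2 _⊢_⇓_ _⊢_⇓[_]_

  data _⊢_⇓_ {r} (σ : State r) : Expr r → ℕ → Set where
    lit  : ∀ {x} → x < 2 ^ w → σ ⊢ lit x ⇓ x
    reg  : ∀ {i} → σ ⊢ reg i ⇓ regs σ i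
    read : ∀ {e a} → σ ⊢ e ⇓ a → a < m → σ ⊢ ⟦ e ⟧ ⇓ mem σ a
    op   : ∀ {e e′ a b} o → σ ⊢ e ⇓ a → σ ⊢ e′ ⇓ b →
           apply o a b < 2 ^ w → σ ⊢ e ⟨ o ⟩ e′ ⇓ apply o a b

  -- σ ⊢ p ⇓[ t ] σ′ : started in σ, the program p halts in σ′ after time t.
  data _⊢_⇓[_]_ {r} (σ : State r) : Cmd r → ℕ → State r → Set where
    skip   : σ ⊢ skip ⇓[ 1 ] σ
    assign : ∀ {i e x} → σ ⊢ e ⇓ x →
             σ ⊢ (i ≔ e) ⇓[ suc (cost e) ]
                 ⟨ updateAt (regs σ) i (const x) , mem σ ⟩
    write  : ∀ {e e′ a x} → σ ⊢ e ⇓ a → a < m → σ ⊢ e′ ⇓ x →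
             σ ⊢ (⟦ e ⟧≔ e′) ⇓[ suc (cost e + cost e′) ]
                 ⟨ regs σ , mem σ [ a ↦ x ] ⟩
    seq    : ∀ {p q t t′ σ′ σ″} → σ ⊢ p ⇓[ t ] σ′ → σ′ ⊢ q ⇓[ t′ ] σ″ →
             σ ⊢ (p ⨾ q) ⇓[ t + t′ ] σ″
    cond-true   : ∀ {e p q x t σ′} → σ ⊢ e ⇓ x → x ≢ 0 → σ ⊢ p ⇓[ t ] σ′ →
                  σ ⊢ cond e p q ⇓[ suc (cost e + t) ] σ′
    cond-false  : ∀ {e p q t σ′} → σ ⊢ e ⇓ 0 → σ ⊢ q ⇓[ t ] σ′ →
                  σ ⊢ cond e p q ⇓[ suc (cost e + t) ] σ′
    while-true  : ∀ {e p x t t′ σ′ σ″} → σ ⊢ e ⇓ x → x ≢ 0 →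
                  σ ⊢ p ⇓[ t ] σ′ → σ′ ⊢ while e p ⇓[ t′ ] σ″ →
                  σ ⊢ while e p ⇓[ suc (cost e + t + t′) ] σ″
    while-false : ∀ {e p} → σ ⊢ e ⇓ 0 →
                  σ ⊢ while e p ⇓[ suc (cost e) ] σ

-- The input is n, c and the adjacency matrix by rows, from cell 0 on.
-- The other cells hold arbitrary words.
record Input (w : ℕ) {n} (G : Graph n) (c : ℕ) (μ : Memory) : Set where
  field
    words    : ∀ i → μ i < 2 ^ w
    order    : μ 0 ≡ n
    capacity : μ 1 ≡ c
    matrix   : ∀ u v → μ (2 + (toℕ u * n + toℕ v)) ≡
                       (if adj G u v then 1 else 0)

inputSize : ℕ → ℕ
inputSize n = 2 + n * n

record Output {n} (A : BucketArrangement n) (μ : Memory) : Set where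
  field
    buckets : μ 0 ≡ k A
    indices : ∀ v → μ (suc (toℕ v)) ≡ toℕ (index A v)

-- The program p solves every n-vertex instance in time T n on a machine
-- with S n memory cells (the fixed number r of registers is not counted).
-- The word length w may be any number that is at least a * suc n and
-- large enough for the input to be stored: exponentially many cells can
-- only be addressed by words of length linear in n. The program halts
-- within the bounds even if no arrangement has width at most c, which
-- happens for c = 0 and n > 0.
Solves : ∀ {r} → Cmd r → (a : ℕ) (T S : ℕ → ℕ) → Set
Solves p a T S =
  ∀ n (G : Graph n) c w μ → a * suc n ≤ w → Input w G c μ →
  let open Machine w (S n) in
  inputSize n ≤ S n ×
  ∃[ t ] ∃[ σ ]
    (⟨ const 0 , μ ⟩ ⊢ p ⇓[ t ] σ) × t ≤ T n ×
    ((∃[ A ] width {n} A ≤ c) → ∃[ A ] Optimal G c A × Output A (mem σ))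

-- f ∈O[ b / d ] means f(n) = O((b/d)ⁿ), with denominators cleared.
infix 4 _∈O[_/_]
_∈O[_/_] : (ℕ → ℕ) → (b d : ℕ) → Set
f ∈O[ b / d ] = ∃[ C ] ∃[ n₀ ] ∀ n → n₀ ≤ n → f n * d ^ n ≤ C * b ^ n

{-# OPTIONS --safe #-}

-- Describe the arrangements that extend a partial one by levels φ: a vertex
-- has level 0 in the closed buckets, 1 in the last bucket, 2 in the next
-- bucket, 3 in the one after it, and so on. Filling the next bucket is
-- φ ↦ φ ∸ 1, and the edges that it makes long are those between the levels
-- 0 and 2. Hence the least cost of a completion depends only on min(φ, 2),
-- and min(φ, 3) tells which bucket is filled: there are 3ⁿ states and 4ⁿ steps
-- of a dynamic program. To save space, guess for each pair of vertices 2i,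
-- 2i + 1 which of the two comes first. Each of the 2^(n/2) guesses leaves only
-- 6 of the 9 states of a pair, which get addresses below 8. So the time is
-- 2^(n/2) 4ⁿ = 32^(n/2) and the space 8^(n/2), up to polynomial factors, which
-- are absorbed because 32 < 5.6569² and 8 < 2.8285².
module Submission where

open import Defs hiding (sym)
open import Data.Bool using (Bool; true; false; if_then_else_; T)
open import Data.Bool.Properties using (T?)
open import Data.Empty using (⊥-elim)
open import Data.Fin as Fin using (Fin; zero; suc; toℕ; fromℕ<; #_)
open import Data.Fin.Properties using (toℕ<n; toℕ-fromℕ<; fromℕ<-toℕ; toℕ-injective)
open import Data.Fin.Subset using () renaming (∣_∣ to card)
open import Data.List as List using (List; []; _∷_; length; filter; allFin; cartesianProduct)
import Data.List.Properties as List
open import Data.Nat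
open import Data.Nat.DivMod
open import Data.Nat.Divisibility using (divides-refl)
import Data.Nat.ListAction as ListAction
open import Data.Nat.Properties
open import Data.Nat.Solver using (module +-*-Solver)
open import Data.Product using (∃-syntax; Σ-syntax; _×_; _,_; proj₁; proj₂)
open import Data.Sum using (_⊎_; inj₁; inj₂; [_,_]′)
open import Data.Unit using (tt)
open import Data.Vec using (tabulate)
open import Data.Vec.Functional using (foldr; updateAt)
open import Function using (_∘_; const; id)
open import Level using (0ℓ)
open import Relation.Binary.Definitions using (tri<; tri≈; tri>)
open import Relation.Binary.PropositionalEquality
open import Relation.Nullary
open import Relation.Nullary.Decidable using (_×-dec_)
open import Relation.Unary using (Pred; Decidable)

open +-*-Solver using (solve; _:=_; _:+_; _:*_) renaming (con to κ)

-- Finite sums and positional notation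

-- A state has many outgoing steps, so its entry is improved several times during a pass, and the
-- invariant never calls an entry final. It has two independent halves: every nonzero entry is
-- realised by an arrangement stored in full beside it (`entries`), and every good arrangement that
-- obeys the guess and whose code has been passed costs at least as much as the entry at its address
-- (`done`). Since each entry has its own copy of the bucket indices, overwriting an entry on which
-- others were built does no harm.
--
-- The compressed addresses are injective only on states that obey the guess. So a step is used only
-- if its digits obey it, and the table is cleared for each guess. Address 0 alone survives: it is
-- the initial state under every guess, and no valid step with vertices left over leads back to it,
-- so nothing is built on an entry from another guess.
--
-- A run that overflows a word or leaves the memory has no derivation. Hence time, word sizes and
-- memory contents are proved together.

eq lt : ℕ → ℕ → ℕ
eq = apply equal
lt = apply less

eq-yes : ∀ {a b} → a ≡ b → eq a b ≡ 1
eq-yes {a} refl with a ≡ᵇ a | ≡⇒≡ᵇ a a refl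
... | true | _ = refl

eq-no : ∀ {a b} → a ≢ b → eq a b ≡ 0
eq-no {a} {b} a≢b with a ≡ᵇ b | ≡ᵇ⇒≡ a b
... | true  | p = ⊥-elim (a≢b (p tt))
... | false | _ = refl

lt-yes : ∀ {a b} → a < b → lt a b ≡ 1
lt-yes {a} {b} a<b with a <ᵇ b | <⇒<ᵇ a<b
... | true | _ = refl

lt-no : ∀ {a b} → ¬ a < b → lt a b ≡ 0
lt-no {a} {b} a≮b with a <ᵇ b | <ᵇ⇒< a b
... | true  | p = ⊥-elim (a≮b (p tt))
... | false | _ = refl

eq⇒≡ : ∀ {a b} → eq a b ≢ 0 → a ≡ b
eq⇒≡ {a} {b} ne with a ≟ b
... | yes p = p
... | no  p = ⊥-elim (ne (eq-no p))

lt⇒< : ∀ {a b} → lt a b ≢ 0 → a < b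
lt⇒< {a} {b} ne with a <? b
... | yes p = p
... | no  p = ⊥-elim (ne (lt-no p))

eq≤1 : ∀ a b → eq a b ≤ 1
eq≤1 a b with a ≡ᵇ b
... | true  = ≤-refl
... | false = z≤n

lt≤1 : ∀ a b → lt a b ≤ 1
lt≤1 a b with a <ᵇ b
... | true  = ≤-refl
... | false = z≤n

≢0⇒>0 : ∀ {a} → a ≢ 0 → 0 < a
≢0⇒>0 {zero}  p = ⊥-elim (p refl)
≢0⇒>0 {suc a} p = z<s

*≢0 : ∀ {a b} → a * b ≢ 0 → a ≢ 0 × b ≢ 0
*≢0 {a} {b} ne = (λ { refl → ne refl }) , λ { refl → ne (*-zeroʳ a) }

>0⇒≢0 : ∀ {a} → 0 < a → a ≢ 0
>0⇒≢0 p refl = <-irrefl refl p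

sum : ℕ → (ℕ → ℕ) → ℕ
sum zero    f = 0
sum (suc n) f = sum n f + f n

sum-cong : ∀ n {f g} → (∀ {i} → i < n → f i ≡ g i) → sum n f ≡ sum n g
sum-cong zero    eqs = refl
sum-cong (suc n) eqs = cong₂ _+_ (sum-cong n (eqs ∘ m<n⇒m<1+n)) (eqs ≤-refl)

sum-zero : ∀ n {f} → (∀ {i} → i < n → f i ≡ 0) → sum n f ≡ 0
sum-zero zero    eqs = refl
sum-zero (suc n) eqs =
  cong₂ _+_ (sum-zero n (eqs ∘ m<n⇒m<1+n)) (eqs ≤-refl)

sum-≡0 : ∀ n {f} → sum n f ≡ 0 → ∀ {i} → i < n → f i ≡ 0
sum-≡0 (suc n) {f} p i<1+n with m≤n⇒m<n∨m≡n (s≤s⁻¹ i<1+n)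
... | inj₁ i<n  = sum-≡0 n (m+n≡0⇒m≡0 _ p) i<n
... | inj₂ refl = m+n≡0⇒n≡0 (sum n f) p

sum-≢0 : ∀ n {f} → sum n f ≢ 0 → ∃[ i ] i < n × f i ≢ 0
sum-≢0 zero    ne = ⊥-elim (ne refl)
sum-≢0 (suc n) {f} ne with f n ≟ 0
... | no  p = n , ≤-refl , p
... | yes p with sum-≢0 n {f} (λ q → ne (cong₂ _+_ q p))
...   | i , i<n , q = i , m<n⇒m<1+n i<n , q

sum-pos : ∀ n {f i} → i < n → f i ≢ 0 → sum n f ≢ 0
sum-pos n i<n ne p = ne (sum-≡0 n p i<n)

sum-+ : ∀ n {f g} → sum n (λ i → f i + g i) ≡ sum n f + sum n g
sum-+ zero    = refl
sum-+ (suc n) {f} {g} rewrite sum-+ n {f} {g} = lemma (sum n f) (sum n g) (f n) (g n)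
  where
  lemma : ∀ a b c d → a + b + (c + d) ≡ a + c + (b + d)
  lemma a b c d = trans (+-assoc a b _) (trans (cong (a +_) (trans (sym (+-assoc b c d))
    (trans (cong (_+ d) (+-comm b c)) (+-assoc c b d)))) (sym (+-assoc a c _)))

sum-mono : ∀ n {f g} → (∀ {i} → i < n → f i ≤ g i) → sum n f ≤ sum n g
sum-mono zero    _  = z≤n
sum-mono (suc n) le = +-mono-≤ (sum-mono n (le ∘ m<n⇒m<1+n)) (le ≤-refl)

sum-mono-< : ∀ n {f g} → (∀ {i} → i < n → f i ≤ g i) →
             ∀ {i} → i < n → f i < g i → sum n f < sum n g
sum-mono-< (suc n) le i<1+n f<g with m≤n⇒m<n∨m≡n (s≤s⁻¹ i<1+n)
... | inj₁ i<n  = +-mono-<-≤ (sum-mono-< n (le ∘ m<n⇒m<1+n) i<n f<g) (le ≤-refl)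
... | inj₂ refl = +-mono-≤-< (sum-mono n (le ∘ m<n⇒m<1+n)) f<g

sum-≤ : ∀ n {f} b → (∀ {i} → i < n → f i ≤ b) → sum n f ≤ n * b
sum-≤ zero    b le = z≤n
sum-≤ (suc n) {f} b le =
  ≤-trans (+-mono-≤ (sum-≤ n b (le ∘ m<n⇒m<1+n)) (le ≤-refl))
          (≤-reflexive (+-comm (n * b) b))

sum-prefix : ∀ {m n} f → m ≤ n → sum m f ≤ sum n f
sum-prefix {n = zero}  f z≤n = ≤-refl
sum-prefix {n = suc n} f m≤1+n with m≤n⇒m<n∨m≡n m≤1+n
... | inj₁ m<1+n = ≤-trans (sum-prefix f (s≤s⁻¹ m<1+n)) (m≤m+n _ _)
... | inj₂ refl  = ≤-refl

sum-suc : ∀ n f → sum (suc n) f ≡ f 0 + sum n (f ∘ suc)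
sum-suc zero    f = sym (+-identityʳ (f 0))
sum-suc (suc n) f = trans (cong (_+ f (suc n)) (sum-suc n f)) (+-assoc (f 0) _ _)

sum-split : ∀ m n f → sum (m + n) f ≡ sum m f + sum n (λ i → f (m + i))
sum-split m zero    f rewrite +-identityʳ m = sym (+-identityʳ _)
sum-split m (suc n) f rewrite +-suc m n | sum-split m n f = +-assoc (sum m f) _ _

*-sum : ∀ b n f → b * sum n f ≡ sum n (λ i → b * f i)
*-sum b zero    f = *-zeroʳ b
*-sum b (suc n) f rewrite *-distribˡ-+ b (sum n f) (f n) = cong (_+ b * f n) (*-sum b n f)

-- The maximum of `f i + 1` over `i < j`, expressed by truncated subtraction because the machine has
-- no maximum operation. For bucket indices it is the number of buckets.
top : ℕ → (ℕ → ℕ) → ℕ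
top zero    f = 0
top (suc j) f = top j f + (f j + 1 ∸ top j f)

top-⊔ : ∀ j f → top (suc j) f ≡ top j f ⊔ (f j + 1)
top-⊔ j f with ≤-total (top j f) (f j + 1)
... | inj₁ p = trans (m+[n∸m]≡n p) (sym (m≤n⇒m⊔n≡n p))
... | inj₂ p = trans (cong (top j f +_) (m≤n⇒m∸n≡0 p)) (trans (+-identityʳ _) (sym (m≥n⇒m⊔n≡m p)))

top-≤ : ∀ N {f} b → (∀ {j} → j < N → f j < b) → top N f ≤ b
top-≤ zero    b lt = z≤n
top-≤ (suc N) {f} b f<b = subst (_≤ b) (sym (top-⊔ N f))
  (⊔-lub (top-≤ N b (f<b ∘ m<n⇒m<1+n)) (subst (_≤ b) (+-comm 1 (f N)) (f<b ≤-refl)))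

top-> : ∀ N f {j} → j < N → f j < top N f
top-> (suc N) f {j} j<1+N with m≤n⇒m<n∨m≡n (s≤s⁻¹ j<1+N)
... | inj₁ j<N  = ≤-trans (top-> N f j<N) (m≤m+n (top N f) _)
... | inj₂ refl = subst (f N <_) (sym (top-⊔ N f)) (≤-trans (≤-reflexive (+-comm 1 (f N)))
    (m≤n⊔m (top N f) (f N + 1)))

top-attained : ∀ N f → 0 < top N f → ∃[ j ] j < N × suc (f j) ≡ top N f
top-attained (suc N) f 0<top with ⊔-sel (top N f) (f N + 1)
... | inj₂ p = N , ≤-refl , trans (+-comm 1 (f N)) (sym (trans (top-⊔ N f) p))
... | inj₁ p with top-attained N f (subst (0 <_) (trans (top-⊔ N f) p) 0<top)
...   | j , j<N , q = j , m<n⇒m<1+n j<N , trans q (sym (trans (top-⊔ N f) p))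

top-cong : ∀ N {f f′} → (∀ {j} → j < N → f j ≡ f′ j) → top N f ≡ top N f′
top-cong zero    eqs = refl
top-cong (suc N) eqs = cong₂ (λ x y → x + (y + 1 ∸ x)) (top-cong N (eqs ∘ m<n⇒m<1+n)) (eqs ≤-refl)

quot≡/ : ∀ a b .{{_ : NonZero b}} → apply quot a b ≡ a / b
quot≡/ a (suc b) = refl

rem≡% : ∀ a b .{{_ : NonZero b}} → apply rem a b ≡ a % b
rem≡% a (suc b) = refl

^-distribʳ-* : ∀ n a b → (a * b) ^ n ≡ a ^ n * b ^ n
^-distribʳ-* zero    a b = refl
^-distribʳ-* (suc n) a b =
  trans (cong (a * b *_) (^-distribʳ-* n a b)) ([m*n]*[o*p]≡[m*o]*[n*p] a b (a ^ n) (b ^ n))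

-- Reading a table by rows, cell `j` has row `j / n` and column `j % n`. This lets the program visit
-- all pairs of vertices with a single counter.
sum-rows : ∀ m n (f : ℕ → ℕ → ℕ) →
           sum (m * n) (λ j → f (apply quot j n) (apply rem j n)) ≡ sum m (λ u → sum n (f u))
sum-rows zero    n f = refl
sum-rows (suc m) zero f = trans (sum-rows m zero f) (sym (+-identityʳ _))
sum-rows (suc m) n@(suc n′) f =
  trans (cong (λ k → sum k (λ j → f (apply quot j n) (apply rem j n))) (+-comm n (m * n)))
      (trans (sum-split (m * n) n _) (cong₂ _+_ (sum-rows m n f) (sum-cong n λ {i} i<n →
    cong₂ f (trans (+-distrib-/-∣ˡ i (divides-refl m))
              (trans (cong₂ _+_ (m*n/n≡m m n) (m<n⇒m/n≡0 i<n)) (+-identityʳ m)))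
            (trans (cong (_% n) (+-comm (m * n) i))
              (trans ([m+kn]%n≡m%n i m n) (m<n⇒m%n≡m i<n))))))

module Base (b : ℕ) .{{_ : NonZero b}} where

  value : ℕ → (ℕ → ℕ) → ℕ
  value n d = sum n (λ i → b ^ i * d i)

  digit : ℕ → ℕ → ℕ
  digit x i = apply rem (apply quot x (b ^ i)) b

  value< : ∀ n {d} → (∀ {i} → i < n → d i < b) → value n d < b ^ n
  value< zero    _ = z<s
  value< (suc n) {d} d<b = begin-strict
    value n d + b ^ n * d n  <⟨ +-monoˡ-< _ (value< n (d<b ∘ m<n⇒m<1+n)) ⟩
    b ^ n + b ^ n * d n      ≡⟨ *-suc (b ^ n) (d n) ⟨
    b ^ n * suc (d n)        ≤⟨ *-monoʳ-≤ (b ^ n) (d<b ≤-refl) ⟩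
    b ^ n * b                ≡⟨ *-comm (b ^ n) b ⟩
    b ^ suc n                ∎
    where open ≤-Reasoning

  digit< : ∀ x i → digit x i < b
  digit< x i = subst (_< b) (sym (rem≡% _ b)) (m%n<n _ b)

  digit-beyond : ∀ {n x} → x < b ^ n → ∀ {i} → n ≤ i → digit x i ≡ 0
  digit-beyond {n} {x} x<bⁿ {i} n≤i = begin
    apply rem (apply quot x (b ^ i)) b  ≡⟨ cong (λ y → apply rem y b)
        (quot≡/ x (b ^ i) {{m^n≢0 b i}}) ⟩
    apply rem (_/_ x (b ^ i) {{_}}) b   ≡⟨ cong (λ y → apply rem y b)
        (m<n⇒m/n≡0 {{m^n≢0 b i}} (<-≤-trans x<bⁿ (^-monoʳ-≤ b n≤i))) ⟩
    apply rem 0 b                       ≡⟨ rem≡% 0 b ⟩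
    0 % b                               ≡⟨ m<n⇒m%n≡m (>-nonZero⁻¹ b) ⟩
    0                                   ∎
    where open ≡-Reasoning

  -- Division by `b ^ suc i` is division by `b`, which drops the lowest digit, followed by division
  -- by `b ^ i`.
  digit-value : ∀ n {d} → (∀ {i} → i < n → d i < b) → ∀ {i} → i < n → digit (value n d) i ≡ d i
  digit-value n d<b {i} i<n =
    trans (rem≡% _ b) (trans (cong (_% b) (quot≡/ _ (b ^ i) {{m^n≢0 b i}})) (aux n d<b i<n))
    where
    shift : ∀ n d → value (suc n) d ≡ d 0 + value n (d ∘ suc) * b
    shift n d = trans (sum-suc n _) (cong₂ _+_ (+-identityʳ (d 0))
      (trans (sum-cong n λ {i} _ → *-assoc b (b ^ i) (d (suc i)))
             (trans (sym (*-sum b n _)) (*-comm b _))))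

    aux : ∀ n {d} → (∀ {i} → i < n → d i < b) → ∀ {i} → i < n →
          (_/_ (value n d) (b ^ i) {{m^n≢0 b i}}) % b ≡ d i
    aux (suc n) {d} d<b {zero} _ rewrite shift n d =
      trans (cong (_% b) (n/1≡n _))
        (trans ([m+kn]%n≡m%n (d 0) (value n (d ∘ suc)) b) (m<n⇒m%n≡m (d<b z<s)))
    aux (suc n) {d} d<b {suc i} i<n = begin
      (_/_ (value (suc n) d) (b ^ suc i) {{_}}) % b ≡⟨ cong (_% b) (m/n/o≡m/[n*o] (value (suc n) d)
          b (b ^ i) {{_}} {{m^n≢0 b i}} {{m^n≢0 b (suc i)}}) ⟨
      (_/_ (value (suc n) d / b) (b ^ i) {{_}}) % b
        ≡⟨ cong (λ x → (_/_ x (b ^ i) {{m^n≢0 b i}}) % b) tail ⟩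
      (_/_ (value n (d ∘ suc)) (b ^ i) {{_}}) % b ≡⟨ aux n (d<b ∘ s≤s) (s≤s⁻¹ i<n) ⟩
      d (suc i) ∎
      where
      open ≡-Reasoning
      tail : value (suc n) d / b ≡ value n (d ∘ suc)
      tail = begin
        value (suc n) d / b                  ≡⟨ cong (_/ b) (shift n d) ⟩
        (d 0 + value n (d ∘ suc) * b) / b    ≡⟨ +-distrib-/-∣ʳ (d 0)
            (divides-refl (value n (d ∘ suc))) ⟩
        d 0 / b + value n (d ∘ suc) * b / b  ≡⟨ cong₂ _+_ (m<n⇒m/n≡0 (d<b z<s)) (m*n/n≡m _ b) ⟩
        value n (d ∘ suc)                    ∎

  value-injective : ∀ n {d e} → (∀ {i} → i < n → d i < b) → (∀ {i} → i < n → e i < b) →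
                    value n d ≡ value n e → ∀ {i} → i < n → d i ≡ e i
  value-injective n d<b e<b p {i} i<n =
    trans (sym (digit-value n d<b i<n)) (trans (cong (λ x → digit x i) p) (digit-value n e<b i<n))

-- Levels and their addresses

module Levels (n c : ℕ) (mat : ℕ → ℕ) where

  row col : ℕ → ℕ
  row j = apply quot j n
  col j = apply rem j n

  row< : ∀ {j} → j < n * n → row j < n
  row< {j} j<nn = aux n j j<nn
    where
    aux : ∀ m j → j < m * m → apply quot j m < m
    aux m@(suc _) j lt = m<n*o⇒m/o<n lt

  col< : ∀ {j} → j < n * n → col j < n
  col< {j} j<nn = aux n j j<nn
    where
    aux : ∀ m j → j < m * m → apply rem j m < m
    aux m@(suc _) j lt = m%n<n j m

  count : (ℕ → ℕ) → ℕ → ℕ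
  count f x = sum n (λ v → eq (f v) x)

  long : ℕ → ℕ → ℕ
  long x y = lt 1 ∣ x - y ∣

  -- All closed buckets share level 0, so two placed vertices differ by at most 1 here. What is
  -- counted are the long edges with an endpoint still to be placed, that is, the cost of the
  -- completion.
  longs : (ℕ → ℕ) → ℕ
  longs φ = sum (n * n) λ j → lt (row j) (col j) * mat j * long (φ (row j)) (φ (col j))

  -- A product of two digits up to 3 is 3 only for 1 and 3, which stand for the
  -- levels 2 and 0.
  newLongs : (ℕ → ℕ) → ℕ
  newLongs d = sum (n * n) λ j → lt (row j) (col j) * mat j * eq (d (row j) * d (col j)) 3

  -- Levels 0 and 1 are settled, so only the levels from 2 on are constrained. `down` excludes gaps,
  -- that is, empty buckets among those to come.
  record Good (φ : ℕ → ℕ) : Set where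
    field
      cap  : ∀ j → count φ (2 + j) ≤ c
      down : ∀ {v j} → v < n → φ v ≡ 3 + j → ∃[ u ] u < n × φ u ≡ 2 + j
  open Good public

  -- The digit of a vertex is 3 in a closed bucket, 2 in the last one, 1 in the one now being filled
  -- and 0 later.
  record Step (d φ φ′ : ℕ → ℕ) : Set where
    field
      levels : ∀ {v} → v < n → φ′ v ≡ φ v ∸ 1
      digits : ∀ {v} → v < n → d v ≡ 3 ∸ φ v
  open Step public

  -- The distance changes only if exactly one level is 0, since 0 stays in place. Against 0 a level
  -- is far from 2 on, so lowering it matters only at 2, where the digits are 3 and 1.
  long-step : ∀ x y → long x y ≡ long (x ∸ 1) (y ∸ 1) + eq ((3 ∸ x) * (3 ∸ y)) 3
  long-step 0 0 = refl
  long-step 0 1 = refl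
  long-step 0 2 = refl
  long-step 0 3 = refl
  long-step 0 (suc (suc (suc (suc y)))) = refl
  long-step 1 0 = refl
  long-step 2 0 = refl
  long-step 3 0 = refl
  long-step (suc (suc (suc (suc x)))) 0 = refl
  long-step (suc x) (suc y) =
    sym (trans (cong (long x y +_) (eq-no (no3 x y))) (+-identityʳ _))
    where
    -- Nonzero levels have digits at most 2, whose products are 0, 1, 2 and 4.
    no3 : ∀ x y → (2 ∸ x) * (2 ∸ y) ≢ 3
    no3 0 0 ()
    no3 0 1 ()
    no3 0 2 ()
    no3 0 (suc (suc (suc y))) ()
    no3 1 0 ()
    no3 1 1 ()
    no3 1 2 ()
    no3 1 (suc (suc (suc y))) ()
    no3 2 y ()
    no3 (suc (suc (suc x))) y ()

  longs-step : ∀ {d φ φ′} → Step d φ φ′ → longs φ ≡ longs φ′ + newLongs d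
  longs-step {d} {φ} {φ′} st =
    trans (sum-cong (n * n) λ {j} j<nn →
      trans (cong (lt (row j) (col j) * mat j *_) (pointwise (row< j<nn) (col< j<nn)))
            (*-distribˡ-+ (lt (row j) (col j) * mat j) _ _))
      (sum-+ (n * n))
    where
    pointwise : ∀ {u v} → u < n → v < n →
                long (φ u) (φ v) ≡ long (φ′ u) (φ′ v) + eq (d u * d v) 3
    pointwise {u} {v} u<n v<n
      rewrite levels st u<n | levels st v<n | digits st u<n | digits st v<n = long-step (φ u) (φ v)

  longs-low : ∀ {φ} → (∀ {v} → v < n → φ v ≤ 1) → longs φ ≡ 0
  longs-low {φ} low = sum-zero (n * n) λ {j} j<nn →
    trans (cong (lt (row j) (col j) * mat j *_)
            (lt-no (≤⇒≯ (≤-trans (∣m-n∣≤m⊔n (φ (row j)) (φ (col j)))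
                (⊔-lub (low (row< j<nn)) (low (col< j<nn)))))))
          (*-zeroʳ (lt (row j) (col j) * mat j))

  module _ {d φ φ′ : ℕ → ℕ} (st : Step d φ φ′) where

    count-next : count φ 2 ≡ count d 1
    count-next = sum-cong n λ {v} v<n → trans (aux (φ v))
        (cong (λ x → eq x 1) (sym (digits st v<n)))
      where
      aux : ∀ x → eq x 2 ≡ eq (3 ∸ x) 1
      aux 0 = refl
      aux 1 = refl
      aux 2 = refl
      aux 3 = refl
      aux (suc (suc (suc (suc x)))) = refl

    count-later : ∀ j → count φ (3 + j) ≡ count φ′ (2 + j)
    count-later j = sum-cong n λ {v} v<n → trans (aux (φ v)) (cong (λ x → eq x (2 + j))
        (sym (levels st v<n)))
      where
      aux : ∀ x → eq x (3 + j) ≡ eq (x ∸ 1) (2 + j)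
      aux zero    = refl
      aux (suc x) = refl

    -- Only the conditions at level 2 are new; the others are those of `φ′`, shifted. The next
    -- bucket may be empty if nothing comes after it, as then level 3 is empty too.
    Good-prepend : Good φ′ → count d 1 ≤ c → 0 < count d 1 ⊎ count d 0 ≡ 0 → Good φ
    Good-prepend good d₁≤c nonempty = record { cap = cap′ ; down = down′ }
      where
      cap′ : ∀ j → count φ (2 + j) ≤ c
      cap′ zero    = subst (_≤ c) (sym count-next) d₁≤c
      cap′ (suc j) = subst (_≤ c) (sym (count-later j)) (cap good j)

      down′ : ∀ {v j} → v < n → φ v ≡ 3 + j → ∃[ u ] u < n × φ u ≡ 2 + j
      down′ {v} {zero} v<n φv = [ some , none ]′ nonempty
        where
        some : 0 < count d 1 → ∃[ u ] u < n × φ u ≡ 2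
        some p with sum-≢0 n (>0⇒≢0 (subst (0 <_) (sym count-next) p))
        ... | u , u<n , ne = u , u<n , eq⇒≡ ne

        none : count d 0 ≡ 0 → ∃[ u ] u < n × φ u ≡ 2
        none p = ⊥-elim (0≢1+n (trans (sym (sum-≡0 n p v<n))
                   (eq-yes (trans (digits st v<n) (cong (3 ∸_) φv)))))
      down′ {v} {suc j} v<n φv with down good v<n (trans (levels st v<n) (cong (_∸ 1) φv))
      ... | u , u<n , φ′u = u , u<n , up (φ u) (trans (sym (levels st u<n)) φ′u)
        where
        up : ∀ x → x ∸ 1 ≡ 2 + j → x ≡ 3 + j
        up (suc x) = cong suc

    Good-rest : Good φ → Good φ′
    Good-rest good = record
      { cap  = λ j → subst (_≤ c) (count-later j) (cap good (suc j))
      ; down = down′ }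
      where
      down′ : ∀ {v j} → v < n → φ′ v ≡ 3 + j → ∃[ u ] u < n × φ′ u ≡ 2 + j
      down′ {v} {j} v<n φ′v with down good v<n (up (φ v) (trans (sym (levels st v<n)) φ′v))
        where
        up : ∀ x → x ∸ 1 ≡ 3 + j → x ≡ 4 + j
        up (suc x) = cong suc
      ... | u , u<n , φu = u , u<n , trans (levels st u<n) (cong (_∸ 1) φu)

  lowest : ∀ {φ} → Good φ → ∀ j {v} → v < n → φ v ≡ 2 + j → ∀ {i} → i ≤ j → ∃[ u ] u < n × φ u ≡ 2 +
      i
  lowest good zero    v<n φv z≤n = _ , v<n , φv
  lowest good (suc j) v<n φv i≤1+j with m≤n⇒m<n∨m≡n i≤1+j
  ... | inj₂ refl = _ , v<n , φv
  ... | inj₁ i<1+j with down good v<n φv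
  ...   | u , u<n , φu = lowest good j u<n φu (s≤s⁻¹ i<1+j)

  -- The level of `v` is at least 3, and descending from it without gaps ends at level 2.
  next-exists : ∀ {φ} → Good φ → ∀ {v} → v < n → 3 ∸ φ v ≡ 0 → ∃[ u ] u < n × φ u ≡ 2
  next-exists {φ} good {v} v<n p = lowest good (φ v ∸ 2) v<n
      (sym (m+[n∸m]≡n (≤-trans (n≤1+n 2) (m∸n≡0⇒m≤n p)))) z≤n

  count-valid : ∀ {d φ φ′} → Step d φ φ′ → Good φ → count d 1 ≤ c × (0 < count d 1 ⊎ count d 0 ≡ 0)
  count-valid {d} {φ} st good = subst (_≤ c) (count-next st) (cap good 0) , aux
    where
    aux : 0 < count d 1 ⊎ count d 0 ≡ 0
    aux with count d 0 ≟ 0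
    ... | yes p = inj₂ p
    ... | no  p with sum-≢0 n p
    ...   | v , v<n , ne with next-exists good v<n (trans (sym (digits st v<n)) (eq⇒≡ ne))
    ...     | u , u<n , φu = inj₁ (≢0⇒>0 (sum-pos n u<n λ q →
                1+n≢0 (trans (sym (eq-yes (trans (digits st u<n) (cong (3 ∸_) φu)))) q)))

  -- Codes of steps, guesses and addresses of states

  module B₂ = Base 2
  module B₄ = Base 4
  module B₈ = Base 8

  -- The remaining arrangement φ ∸ 1 has a larger code than φ, so a pass through
  -- the codes in decreasing order meets it first.
  code : (ℕ → ℕ) → ℕ
  code φ = B₄.value n (λ v → 3 ∸ φ v)

  3∸<4 : ∀ x → 3 ∸ x < 4
  3∸<4 x = s≤s (m∸n≤m 3 x)

  code<4ⁿ : ∀ φ → code φ < 4 ^ n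
  code<4ⁿ φ = B₄.value< n λ {v} _ → 3∸<4 (φ v)

  -- No digit drops, and a vertex that waits for a later bucket guarantees some `u` at level 2,
  -- whose digit rises from 1 to 2. With none waiting the code may stay the same; `val` settles that
  -- case without a table value.
  code-step : ∀ {d φ φ′} → Step d φ φ′ → Good φ → count d 0 ≢ 0 → code φ < code φ′
  code-step {φ = φ} {φ′} st good ne with sum-≢0 n ne
  ... | v , v<n , ne′ with next-exists good v<n (trans (sym (digits st v<n)) (eq⇒≡ ne′))
  ...   | u , u<n , φu = sum-mono-< n
          (λ {i} i<n → *-monoʳ-≤ (4 ^ i) (∸-monoʳ-≤ 3 (≤-trans (≤-reflexive (levels st i<n))
              (m∸n≤m (φ i) 1))))
          u<n (*-monoʳ-< (4 ^ u) {{m^n≢0 4 u}} (subst₂ (λ x y → 3 ∸ x < 3 ∸ y) (sym φu)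
            (sym (trans (levels st u<n) (cong (_∸ 1) φu))) ≤-refl))

  -- `4 ^ v` appears as `2 ^ v * 2 ^ v` because only powers of 2 are kept in memory; likewise `M`
  -- below is `8 ^ h`.
  dig : ℕ → ℕ → ℕ
  dig τ v = apply rem (apply quot τ (2 ^ v * 2 ^ v)) 4

  dig≡digit : ∀ τ v → dig τ v ≡ B₄.digit τ v
  dig≡digit τ v = cong (λ x → apply rem (apply quot τ x) 4) (sym (^-distribʳ-* v 2 2))

  dig<4 : ∀ τ v → dig τ v < 4
  dig<4 τ v = subst (_< 4) (sym (dig≡digit τ v)) (B₄.digit< τ v)

  dig-beyond : ∀ {τ} → τ < 4 ^ n → ∀ {v} → n ≤ v → dig τ v ≡ 0
  dig-beyond τ< {v} n≤v = trans (dig≡digit _ v) (B₄.digit-beyond τ< n≤v)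

  dig-code : ∀ φ {v} → v < n → dig (code φ) v ≡ 3 ∸ φ v
  dig-code φ {v} v<n = trans (dig≡digit _ v) (B₄.digit-value n (λ {i} _ → 3∸<4 (φ i)) v<n)

  -- Rounded up: for odd `n` the last vertex is paired with the padding position `n`.
  h : ℕ
  h = apply quot (n + 1) 2

  M : ℕ
  M = 2 ^ h * 2 ^ h * 2 ^ h

  cube : ∀ i → 2 ^ i * 2 ^ i * 2 ^ i ≡ 8 ^ i
  cube i = trans (cong (_* 2 ^ i) (sym (^-distribʳ-* i 2 2))) (sym (^-distribʳ-* i 4 2))

  bit : ℕ → ℕ → ℕ
  bit g i = apply rem (apply quot g (2 ^ i)) 2

  -- The guess g puts the vertex hi g i of the i-th pair not after lo g i.
  hi lo : ℕ → ℕ → ℕ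
  hi g i = 2 * i + bit g i
  lo g i = 2 * i + (1 ∸ bit g i)

  -- Digits fall as levels rise, so the vertex that comes first has the larger digit.
  Consistent : ℕ → (ℕ → ℕ) → Set
  Consistent g d = ∀ {i} → i < h → d (lo g i) ≤ d (hi g i)

  pair : ℕ → (ℕ → ℕ) → ℕ → ℕ
  pair g f i = 2 * f (hi g i) + f (lo g i)

  addr : ℕ → (ℕ → ℕ) → ℕ
  addr g f = sum h λ i → 2 ^ i * 2 ^ i * 2 ^ i * pair g f i

  addr≡value : ∀ g f → addr g f ≡ B₈.value h (pair g f)
  addr≡value g f = sum-cong h λ {i} _ → cong (_* pair g f i) (cube i)

  addr-cong : ∀ g {f f′} → (∀ v → f v ≡ f′ v) → addr g f ≡ addr g f′
  addr-cong g {f} {f′} eqs = sum-cong h λ {i} _ → cong (2 ^ i * 2 ^ i * 2 ^ i *_)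
    (cong₂ (λ x y → 2 * x + y) (eqs (hi g i)) (eqs (lo g i)))

  pair<8 : ∀ g {f} → (∀ v → f v ≤ 2) → ∀ i → pair g f i < 8
  pair<8 g f≤2 i = s≤s (≤-trans (+-mono-≤ (*-monoʳ-≤ 2 (f≤2 (hi g i))) (f≤2 (lo g i))) (n≤1+n 6))

  addr<M : ∀ g {f} → (∀ v → f v ≤ 2) → addr g f < M
  addr<M g {f} f≤2 = subst₂ _<_ (sym (addr≡value g f)) (sym (cube h)) (B₈.value< h λ {i} _ → pair<8
      g f≤2 i)

  -- The six pairs with `y ≤ x ≤ 2` give 0, 2, 3, 4, 5 and 6, from which `first` recovers `x`.
  -- Without the order there are collisions: `x = 0`, `y = 2` and `x = 1`, `y = 0` both give 2.
  pair-injective : ∀ {x y x′ y′} → y ≤ x → x ≤ 2 → y′ ≤ x′ → x′ ≤ 2 →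
                   2 * x + y ≡ 2 * x′ + y′ → x ≡ x′ × y ≡ y′
  pair-injective {x} {y} {x′} {y′} y≤x x≤2 y′≤x′ x′≤2 p = x≡x′ , +-cancelˡ-≡ (2 * x) y y′
      (trans p (cong (λ z → 2 * z + y′) (sym x≡x′)))
    where
    first : ℕ → ℕ
    first 0 = 0
    first 1 = 0
    first 2 = 1
    first 3 = 1
    first _ = 2

    first-pair : ∀ {x y} → y ≤ x → x ≤ 2 → first (2 * x + y) ≡ x
    first-pair {0} {0} _ _ = refl
    first-pair {1} {0} _ _ = refl
    first-pair {1} {1} _ _ = refl
    first-pair {2} {0} _ _ = refl
    first-pair {2} {1} _ _ = refl
    first-pair {2} {2} _ _ = refl
    first-pair {1} {suc (suc y)} (s≤s ()) _
    first-pair {2} {suc (suc (suc y))} (s≤s (s≤s ())) _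
    first-pair {suc (suc (suc x))} _ (s≤s (s≤s ()))

    x≡x′ : x ≡ x′
    x≡x′ = trans (sym (first-pair y≤x x≤2)) (trans (cong first p) (first-pair y′≤x′ x′≤2))

  bit-01 : ∀ g i → bit g i ≡ 0 ⊎ bit g i ≡ 1
  bit-01 g i with bit g i | B₂.digit< g i
  ... | 0 | _ = inj₁ refl
  ... | 1 | _ = inj₂ refl
  ... | suc (suc _) | s≤s (s≤s ())

  covered : ∀ g {v} → v < n → ∃[ i ] i < h × (v ≡ hi g i ⊎ v ≡ lo g i)
  covered g {v} v<n = v / 2 , i<h , place (v % 2) (m%n<n v 2) (m≡m%n+[m/n]*n v 2)
    where
    i<h : v / 2 < h
    i<h = subst (_≤ h) (trans (cong (_/ 2) (+-comm v 2)) (+-distrib-/-∣ˡ v {2} (divides-refl 1)))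
            (/-monoˡ-≤ 2 (subst (v + 2 ≤_) refl (subst (_≤ n + 1) (sym (+-suc v 1))
                (+-monoˡ-≤ 1 v<n))))

    place : ∀ r → r < 2 → v ≡ r + v / 2 * 2 → v ≡ hi g (v / 2) ⊎ v ≡ lo g (v / 2)
    place r r<2 p with bit g (v / 2) | bit-01 g (v / 2) | r | r<2
    ... | .0 | inj₁ refl | 0 | _ = inj₁ (trans p (trans (*-comm (v / 2) 2) (sym (+-identityʳ _))))
    ... | .0 | inj₁ refl | 1 | _ = inj₂
        (trans p (trans (+-comm 1 _) (cong (_+ 1) (*-comm (v / 2) 2))))
    ... | .1 | inj₂ refl | 0 | _ = inj₂ (trans p (trans (*-comm (v / 2) 2) (sym (+-identityʳ _))))
    ... | .1 | inj₂ refl | 1 | _ = inj₁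
        (trans p (trans (+-comm 1 _) (cong (_+ 1) (*-comm (v / 2) 2))))
    ... | _ | _ | suc (suc _) | s≤s (s≤s ())

  addr-injective : ∀ g {f f′} → (∀ v → f v ≤ 2) → (∀ v → f′ v ≤ 2) → Consistent g f → Consistent g
      f′ →
                   addr g f ≡ addr g f′ → ∀ {v} → v < n → f v ≡ f′ v
  addr-injective g {f} {f′} f≤2 f′≤2 con con′ p {v} v<n with covered g v<n
  ... | i , i<h , place = aux place
    where
    both : f (hi g i) ≡ f′ (hi g i) × f (lo g i) ≡ f′ (lo g i)
    both = pair-injective (con i<h) (f≤2 _) (con′ i<h) (f′≤2 _)
      (B₈.value-injective h (λ {j} _ → pair<8 g f≤2 j) (λ {j} _ → pair<8 g f′≤2 j)
        (trans (sym (addr≡value g f)) (trans p (addr≡value g f′))) i<h)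

    aux : v ≡ hi g i ⊎ v ≡ lo g i → f v ≡ f′ v
    aux (inj₁ refl) = proj₁ both
    aux (inj₂ refl) = proj₂ both

  addr-zero : ∀ g {f} → (∀ v → f v ≡ 0) → addr g f ≡ 0
  addr-zero g {f} zeros = sum-zero h λ {i} _ →
    trans (cong₂ (λ x y → 2 ^ i * 2 ^ i * 2 ^ i * (2 * x + y)) (zeros (hi g i)) (zeros (lo g i)))
          (*-zeroʳ (2 ^ i * 2 ^ i * 2 ^ i))

  -- `hi<n` concerns the last pair for odd `n`: the padding must be its `lo`, since padded digits
  -- are 0 and `lo` has the smaller digit.
  record Ordered (g : ℕ) (φ : ℕ → ℕ) : Set where
    field
      hi<n : ∀ {i} → i < h → lo g i < n → hi g i < n
      φ≤   : ∀ {i} → i < h → lo g i < n → φ (hi g i) ≤ φ (lo g i)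
  open Ordered public
  -- Positions n, n + 1, … pad the last pair.
  δ : (ℕ → ℕ) → ℕ → ℕ
  δ φ v = lt v n * (3 ∸ φ v)

  δ-in : ∀ φ {v} → v < n → δ φ v ≡ 3 ∸ φ v
  δ-in φ v<n rewrite lt-yes v<n = +-identityʳ _

  δ-out : ∀ φ {v} → n ≤ v → δ φ v ≡ 0
  δ-out φ n≤v rewrite lt-no (≤⇒≯ n≤v) = refl

  -- The states before and after the step with digits d, in the digits 2 ∸ φ v.
  past next : (ℕ → ℕ) → ℕ → ℕ
  past d v = d v ∸ 1
  next d v = d v ∸ apply quot (d v) 3

  slot : ℕ → (ℕ → ℕ) → ℕ
  slot g φ = addr g (past (δ φ))

  dig-δ : ∀ φ v → dig (code φ) v ≡ δ φ v
  dig-δ φ v with v <? n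
  ... | yes v<n = trans (dig-code φ v<n) (sym (δ-in φ v<n))
  ... | no  v≮n = trans (dig-beyond (code<4ⁿ φ) (≮⇒≥ v≮n)) (sym (δ-out φ (≮⇒≥ v≮n)))

  -- Bit `i` is set exactly if the second vertex of the pair exists and comes strictly before the
  -- first.
  Ordered-guess : ∀ φ → ∃[ g ] g < 2 ^ h × Ordered g φ
  Ordered-guess φ = g , B₂.value< h (λ {i} _ → b<2 i) , record
      { hi<n = λ i<h → proj₁ ∘ order i<h ; φ≤ = λ i<h → proj₂ ∘ order i<h }
    where
    b : ℕ → ℕ
    b i = lt (2 * i + 1) n * lt (φ (2 * i + 1)) (φ (2 * i))

    b<2 : ∀ i → b i < 2
    b<2 i = s≤s (*-mono-≤ (lt≤1 (2 * i + 1) n) (lt≤1 (φ (2 * i + 1)) (φ (2 * i))))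

    g : ℕ
    g = B₂.value h b

    order : ∀ {i} → i < h → lo g i < n → hi g i < n × φ (hi g i) ≤ φ (lo g i)
    order {i} i<h lo<n with bit g i | B₂.digit-value h {b} (λ {j} _ → b<2 j) i<h
    ... | _ | refl with 2 * i + 1 <? n
    ...   | no p rewrite lt-no p = ⊥-elim (p lo<n)
    ...   | yes p with φ (2 * i + 1) <? φ (2 * i)
    ...     | yes q rewrite lt-yes p | lt-yes q | +-identityʳ (2 * i) = p , <⇒≤ q
    ...     | no  q rewrite lt-yes p | lt-no q | +-identityʳ (2 * i) =
                <-trans (subst (2 * i <_) (+-comm 1 (2 * i)) ≤-refl) p , ≮⇒≥ q

  Ordered⇒Consistent : ∀ {g φ} → Ordered g φ → Consistent g (δ φ)
  Ordered⇒Consistent {g} {φ} ord {i} i<h with lo g i <? n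
  ... | no  p = subst (_≤ δ φ (hi g i)) (sym (δ-out φ (≮⇒≥ p))) z≤n
  ... | yes p = subst₂ _≤_ (sym (δ-in φ p)) (sym (δ-in φ (hi<n ord i<h p)))
      (∸-monoʳ-≤ 3 (φ≤ ord i<h p))

  -- Truncated subtraction is monotone, so a single guess serves all steps of an arrangement.
  Ordered-rest : ∀ {g d φ φ′} → Step d φ φ′ → Ordered g φ → Ordered g φ′
  Ordered-rest st ord = record
    { hi<n = hi<n ord
    ; φ≤   = λ i<h p → subst₂ _≤_ (sym (levels st (hi<n ord i<h p))) (sym (levels st p))
                         (∸-monoˡ-≤ 1 (φ≤ ord i<h p)) }

  next≡⊓2 : ∀ {x} → x < 4 → x ∸ apply quot x 3 ≡ x ⊓ 2
  next≡⊓2 {0} _ = refl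
  next≡⊓2 {1} _ = refl
  next≡⊓2 {2} _ = refl
  next≡⊓2 {3} _ = refl
  next≡⊓2 {suc (suc (suc (suc _)))} (s≤s (s≤s (s≤s (s≤s ()))))

  next-≤2 : ∀ {d} → (∀ v → d v < 4) → ∀ v → next d v ≤ 2
  next-≤2 {d} d<4 v = subst (_≤ 2) (sym (next≡⊓2 (d<4 v))) (m⊓n≤n (d v) 2)

  past-≤2 : ∀ {d} → (∀ v → d v < 4) → ∀ v → past d v ≤ 2
  past-≤2 d<4 v = ∸-monoˡ-≤ 1 (s≤s⁻¹ (d<4 v))

  δ<4 : ∀ φ v → δ φ v < 4
  δ<4 φ v = s≤s (≤-trans (*-mono-≤ (lt≤1 v n) (m∸n≤m 3 (φ v))) ≤-refl)

  next-consistent : ∀ {g d} → (∀ v → d v < 4) → Consistent g d → Consistent g (next d)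
  next-consistent {g} {d} d<4 con {i} i<h = subst₂ _≤_ (sym (next≡⊓2 (d<4 (lo g i))))
      (sym (next≡⊓2 (d<4 (hi g i))))
    (⊓-monoˡ-≤ 2 (con i<h))

  past-consistent : ∀ {g d} → Consistent g d → Consistent g (past d)
  past-consistent con i<h = ∸-monoˡ-≤ 1 (con i<h)

  3∸x∸1 : ∀ x → 3 ∸ x ∸ 1 ≡ 2 ∸ x
  3∸x∸1 0 = refl
  3∸x∸1 1 = refl
  3∸x∸1 2 = refl
  3∸x∸1 (suc (suc (suc x))) = cong (_∸ 1) (0∸n≡0 x)

  past-δ : ∀ φ {v} → v < n → past (δ φ) v ≡ 2 ∸ φ v
  past-δ φ {v} v<n = trans (cong (_∸ 1) (δ-in φ v<n)) (3∸x∸1 (φ v))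

  Step-code : ∀ φ → Step (dig (code φ)) φ (λ v → φ v ∸ 1)
  Step-code φ = record { levels = λ _ → refl ; digits = dig-code φ }

  slot-past : ∀ g φ → addr g (past (dig (code φ))) ≡ slot g φ
  slot-past g φ = addr-cong g λ v → cong (_∸ 1) (dig-δ φ v)

  -- A step sends the levels 0 and 1 to 0; correspondingly its digits 3 and 2 both become the state
  -- digit 2.
  slot-next : ∀ g φ → addr g (next (dig (code φ))) ≡ slot g (λ v → φ v ∸ 1)
  slot-next g φ = addr-cong g λ v → trans (cong (λ x → x ∸ apply quot x 3) (dig-δ φ v)) (aux v)
    where
    shift : ∀ x → (3 ∸ x) ∸ apply quot (3 ∸ x) 3 ≡ 2 ∸ (x ∸ 1)
    shift 0 = refl
    shift 1 = refl
    shift 2 = refl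
    shift (suc (suc (suc x))) rewrite 0∸n≡0 x = refl

    aux : ∀ v → next (δ φ) v ≡ past (δ (λ v → φ v ∸ 1)) v
    aux v with v <? n
    ... | yes p = trans (cong (λ x → x ∸ apply quot x 3) (δ-in φ p))
                    (trans (shift (φ v)) (sym (past-δ (λ v → φ v ∸ 1) p)))
    ... | no  p = trans (cong (λ x → x ∸ apply quot x 3) (δ-out φ (≮⇒≥ p)))
                    (sym (cong (_∸ 1) (δ-out (λ v → φ v ∸ 1) (≮⇒≥ p))))

  Start : (ℕ → ℕ) → Set
  Start φ = ∀ {v} → v < n → 2 ≤ φ v

  slot-start : ∀ g {φ} → Start φ → slot g φ ≡ 0
  slot-start g {φ} start = addr-zero g aux
    where
    aux : ∀ v → past (δ φ) v ≡ 0
    aux v with v <? n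
    ... | yes p = trans (past-δ φ p) (m≤n⇒m∸n≡0 (start p))
    ... | no  p = cong (_∸ 1) (δ-out φ (≮⇒≥ p))

  slot≡0⇒Start : ∀ g {φ} → Consistent g (δ φ) → slot g φ ≡ 0 → Start φ
  slot≡0⇒Start g {φ} con p {v} v<n = m∸n≡0⇒m≤n (trans (sym (past-δ φ v<n))
    (addr-injective g (past-≤2 (δ<4 φ)) (λ _ → z≤n {2}) (past-consistent {g} {δ φ} con) (λ _ → z≤n)
      (trans p (sym (addr-zero g λ _ → refl))) v<n))

  -- Undoes a step. Level 0 of `φ′` can come from 0 or from 1, and the digit 3 tells which.
  lift : (ℕ → ℕ) → (ℕ → ℕ) → ℕ → ℕ
  lift d φ′ v with d v
  ... | 3 = 0
  ... | _ = suc (φ′ v)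

  module _ {d φ′ : ℕ → ℕ} (d<4 : ∀ v → d v < 4) (match : ∀ {v} → v < n → 2 ∸ φ′ v ≡ next d v) where

    Step-lift : Step d (lift d φ′) φ′
    Step-lift = record { levels = lev ; digits = dgt }
      where
      2∸x≡2 : ∀ x → 2 ∸ x ≡ 2 → x ≡ 0
      2∸x≡2 zero p = refl
      2∸x≡2 (suc zero) ()
      2∸x≡2 (suc (suc x)) p = ⊥-elim (0≢1+n (trans (sym (0∸n≡0 x)) p))

      lev : ∀ {v} → v < n → φ′ v ≡ lift d φ′ v ∸ 1
      lev {v} v<n with d v | match v<n
      ... | 0 | _ = refl
      ... | 1 | _ = refl
      ... | 2 | _ = refl
      ... | 3 | p = 2∸x≡2 (φ′ v) p
      ... | suc (suc (suc (suc _))) | _ = refl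

      dgt : ∀ {v} → v < n → d v ≡ 3 ∸ lift d φ′ v
      dgt {v} v<n with d v | match v<n | d<4 v
      ... | 0 | p | _ = sym p
      ... | 1 | p | _ = sym p
      ... | 2 | p | _ = sym p
      ... | 3 | p | _ = refl
      ... | suc (suc (suc (suc _))) | _ | s≤s (s≤s (s≤s (s≤s ())))

    -- Putting a bucket in front raises the index of the later vertices by 1; those in this bucket
    -- and the placed ones have index 0. The left side is what `blockE` computes.
    lift-index : ∀ {x v} → v < n → (d v ≡ 0 → x ≡ φ′ v ∸ 2) →
                 eq (d v) 0 * x + eq (d v) 0 ≡ lift d φ′ v ∸ 2
    lift-index {x} {v} v<n p with d v | match v<n | d<4 v
    ... | 0 | q | _ rewrite p refl = trans (cong (_+ 1) (+-identityʳ _)) (aux (φ′ v) q)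
      where
      aux : ∀ y → 2 ∸ y ≡ 0 → y ∸ 2 + 1 ≡ y ∸ 1
      aux (suc (suc y)) _ = +-comm y 1
      aux 0 ()
      aux 1 ()
    ... | 1 | q | _ = sym (trans (cong (_∸ 1) (aux (φ′ v) q)) refl)
      where
      aux : ∀ y → 2 ∸ y ≡ 1 → y ≡ 1
      aux 1 _ = refl
      aux 0 ()
      aux (suc (suc y)) r = ⊥-elim (0≢1+n (trans (sym (0∸n≡0 y)) r))
    ... | 2 | q | _ = sym (aux (φ′ v) q)
      where
      aux : ∀ y → 2 ∸ y ≡ 2 → y ∸ 1 ≡ 0
      aux 0 _ = refl
      aux 1 _ = refl
      aux (suc (suc y)) r = ⊥-elim (0≢1+n (trans (sym (0∸n≡0 y)) r))
    ... | 3 | _ | _ = refl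
    ... | suc (suc (suc (suc _))) | _ | s≤s (s≤s (s≤s (s≤s ())))

    lift-≤ : ∀ v → lift d φ′ v ≤ suc (φ′ v)
    lift-≤ v with d v
    ... | 0 = ≤-refl
    ... | 1 = ≤-refl
    ... | 2 = ≤-refl
    ... | 3 = z≤n
    ... | suc (suc (suc (suc _))) = ≤-refl

    δ-lift : (∀ {v} → n ≤ v → d v ≡ 0) → ∀ v → δ (lift d φ′) v ≡ d v
    δ-lift beyond v with v <? n
    ... | yes p = trans (δ-in (lift d φ′) p) (sym (digits Step-lift p))
    ... | no  p = trans (δ-out (lift d φ′) (≮⇒≥ p)) (sym (beyond (≮⇒≥ p)))

-- The dynamic program

module Table (n c : ℕ) (mat : ℕ → ℕ) where

  open Levels n c mat public

  Q : ℕ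
  Q = 2 ^ n * 2 ^ n

  4ⁿ≡Q : 4 ^ n ≡ Q
  4ⁿ≡Q = ^-distribʳ-* n 2 2

  -- For a table value, which is a cost plus 1 or else 0: the cost is known and at most `k`.
  Within : ℕ → ℕ → Set
  Within x k = 0 < x × x ≤ suc k

  -- V a is 0 if no arrangement is known for the address a, and its cost plus 1
  -- otherwise. B a v is the index of the bucket of v, counted from the next one,
  -- and 0 if v has been placed already.
  record Entry (b : ℕ) (V : ℕ → ℕ) (B : ℕ → ℕ → ℕ) (a : ℕ) (φ : ℕ → ℕ) : Set where
    field
      good   : Good φ
      value  : V a ≡ suc (longs φ)
      index  : ∀ {v} → v < n → B a v ≡ φ v ∸ 2
      -- Keeps the stored bucket indices small enough for a word.
      bound  : ∀ {v} → v < n → φ v ≤ 2 + b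
  open Entry public

  -- The initial state has address 0 under every guess, so its entry can be kept
  -- from one guess to the next.
  StartEntry : (V : ℕ → ℕ) (B : ℕ → ℕ → ℕ) → Set
  StartEntry V B = V 0 ≡ 0 ⊎ ∃[ φ ] Entry Q V B 0 φ × Start φ

  Searched : ℕ → (V : ℕ → ℕ) → Set
  Searched g V = ∀ {g′} → g′ < g → ∀ φ → Good φ → Start φ → Ordered g′ φ → Within (V 0) (longs φ)

  -- The situation after the `s` largest codes under the guess `g`. `entries` asks for `Consistent`,
  -- which makes addresses injective; `done` asks for `Ordered`, which is inherited by the rest of
  -- an arrangement.
  record Inv (g s : ℕ) (V : ℕ → ℕ) (B : ℕ → ℕ → ℕ) : Set where
    field
      start    : StartEntry V B
      entries  : ∀ {a} → 0 < a → a ≤ M →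
                 V a ≡ 0 ⊎ ∃[ φ ] Entry s V B a φ × Consistent g (δ φ) × slot g φ ≡ a
      done     : ∀ φ → Good φ → Ordered g φ → Q ≤ code φ + s → Within (V (slot g φ)) (longs φ)
      searched : Searched g V
  open Inv public

  V-bound : ∀ {g s V B} → Inv g s V B → (∀ φ → longs φ ≤ n * n) → ∀ {a} → a ≤ M → V a ≤ suc (n * n)
  V-bound {V = V} inv longs≤ {zero} _ with start inv
  ... | inj₁ p = subst (_≤ suc (n * n)) (sym p) z≤n
  ... | inj₂ (φ , e , _) = subst (_≤ suc (n * n)) (sym (value e)) (s≤s (longs≤ φ))
  V-bound {V = V} inv longs≤ {suc a} a≤M with entries inv z<s a≤M
  ... | inj₁ p = subst (_≤ suc (n * n)) (sym p) z≤n
  ... | inj₂ (φ , e , _) = subst (_≤ suc (n * n)) (sym (value e)) (s≤s (longs≤ φ))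

  Inv-init : ∀ {g V B} → StartEntry V B → Searched g V → (∀ {a} → 0 < a → a ≤ M → V a ≡ 0) → Inv g 0
      V B
  Inv-init st se clear = record
    { start = st ; entries = λ p q → inj₁ (clear p q)
    -- All codes are below `Q`, so nothing is claimed at the start.
    ; done = λ φ _ _ p → ⊥-elim (<⇒≱ (subst (code φ <_) 4ⁿ≡Q (code<4ⁿ φ))
        (subst (Q ≤_) (+-identityʳ _) p))
    ; searched = se }

  Inv-final : ∀ {g V B} → Inv g Q V B → Searched (suc g) V
  Inv-final {g} {V} inv {g′} g′<1+g φ good st ord with m≤n⇒m<n∨m≡n (s≤s⁻¹ g′<1+g)
  ... | inj₁ g′<g = searched inv g′<g φ good st ord
  ... | inj₂ refl = subst (λ a → Within (V a) (longs φ)) (slot-start g st)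
      (done inv φ good ord (m≤n+m Q (code φ)))

  module Relax {g s V B} (inv : Inv g s V B) (s<Q : s < Q) where

    τ : ℕ
    τ = Q ∸ (1 + s)

    d : ℕ → ℕ
    d = dig τ

    -- If no vertex is left after the next bucket, the rest costs 0 and has value 1; otherwise its
    -- value is looked up. The case distinction is arithmetic, as in `valE`.
    old new val : ℕ
    old = addr g (past d)
    new = addr g (next d)
    val = eq (count d 0) 0 + lt 0 (count d 0) * V new

    τ<4ⁿ : τ < 4 ^ n
    τ<4ⁿ = subst (τ <_) (sym 4ⁿ≡Q) (∸-monoʳ-< z<s s<Q)

    old<M : old < M
    old<M = addr<M g (past-≤2 (dig<4 τ))

    new<M : new < M
    new<M = addr<M g (next-≤2 (dig<4 τ))

    record Valid : Set where
      field
        consistent : Consistent g d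
        capacious       : count d 1 ≤ c
        nonempty   : 0 < count d 1 ⊎ count d 0 ≡ 0
        reachable  : 0 < val
        better     : V old ≡ 0 ⊎ val + newLongs d < V old

    val-end : count d 0 ≡ 0 → val ≡ 1
    val-end p = trans (cong₂ (λ x y → x + y * V new) (eq-yes p) (lt-no (λ q → >0⇒≢0 q p))) refl

    val-more : count d 0 ≢ 0 → val ≡ V new
    val-more p = trans (cong₂ (λ x y → x + y * V new) (eq-no p) (lt-yes (≢0⇒>0 p)))
        (+-identityʳ (V new))

    Pending : (ℕ → ℕ) → Set
    Pending φ = Q ≤ code φ + s ⊎ code φ ≡ τ

    pending : ∀ φ → Q ≤ code φ + suc s → Pending φ
    pending φ p with m≤n⇒m<n∨m≡n p
    ... | inj₁ q = inj₁ (s≤s⁻¹ (subst (suc Q ≤_) (+-suc (code φ) s) q))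
    ... | inj₂ q = inj₂ (sym (trans (cong (_∸ suc s) q) (m+n∸n≡m (code φ) (suc s))))

    module _ {φ} (good : Good φ) (ord : Ordered g φ) (codeφ : code φ ≡ τ) where

      private
        φ′ : ℕ → ℕ
        φ′ v = φ v ∸ 1

        st : Step d φ φ′
        st = subst (λ x → Step (dig x) φ φ′) codeφ (Step-code φ)

        old≡ : old ≡ slot g φ
        old≡ = trans (cong (λ x → addr g (past (dig x))) (sym codeφ)) (slot-past g φ)

        new≡ : new ≡ slot g φ′
        new≡ = trans (cong (λ x → addr g (next (dig x))) (sym codeφ)) (slot-next g φ)

      within-val : Within val (longs φ′)
      within-val with count d 0 ≟ 0
      ... | yes p = subst (λ x → Within x (longs φ′)) (sym (val-end p)) (z<s , s≤s z≤n)
      ... | no  p = subst (λ x → Within x (longs φ′)) (sym (trans (val-more p) (cong V new≡)))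
              -- This is where the order of the pass matters: `φ′` has a code above `τ`.
              (done inv φ′ (Good-rest st good) (Ordered-rest st ord)
                (≤-trans (≤-reflexive Q≡) (+-monoˡ-≤ s (subst (_< code φ′) codeφ
                    (code-step st good p)))))
        where
        Q≡ : Q ≡ suc τ + s
        Q≡ = sym (trans (sym (+-suc τ s)) (m∸n+n≡m s<Q))

      candidate : Within (val + newLongs d) (longs φ)
      candidate = ≤-trans (proj₁ within-val) (m≤m+n val _) ,
        ≤-trans (+-monoˡ-≤ (newLongs d) (proj₂ within-val))
            (s≤s (≤-reflexive (sym (longs-step st))))

      valid-but-better : (V old ≡ 0 ⊎ val + newLongs d < V old) → Valid
      valid-but-better b = record
        { consistent = λ {i} i<h → subst (λ x → dig x (lo g i) ≤ dig x (hi g i)) codeφ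
            (subst₂ _≤_ (sym (dig-δ φ (lo g i))) (sym (dig-δ φ (hi g i)))
                (Ordered⇒Consistent ord i<h))
        ; capacious = proj₁ (count-valid st good)
        ; nonempty = proj₂ (count-valid st good)
        ; reachable = proj₁ within-val
        ; better = b }

      slot≡old : slot g φ ≡ old
      slot≡old = sym old≡

    weaken : ∀ {V′ B′ a φ} → V′ a ≡ V a → (∀ {v} → v < n → B′ a v ≡ B a v) →
             Entry s V B a φ → Entry (suc s) V′ B′ a φ
    weaken p q e = record
      { good = good e ; value = trans p (value e)
      ; index = λ v<n → trans (q v<n) (index e v<n)
      ; bound = λ v<n → m≤n⇒m≤1+n (bound e v<n) }

    -- A good and ordered `φ` with code `τ` meets every condition of `Valid` except perhaps
    -- `better`, so for it the entry is already nonzero and no larger than the candidate.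
    reject : ¬ Valid → Inv g (suc s) V B
    reject invalid = record
      { start = start inv
      ; entries = λ {a} p q → [ inj₁ , (λ (φ , e , r) → inj₂ (φ , weaken refl (λ _ → refl) e , r))
          ]′ (entries inv p q)
      ; done = done′
      ; searched = searched inv }
      where
      done′ : ∀ φ → Good φ → Ordered g φ → Q ≤ code φ + suc s → Within (V (slot g φ)) (longs φ)
      done′ φ good ord p with pending φ p
      ... | inj₁ q = done inv φ good ord q
      ... | inj₂ q = subst (λ a → Within (V a) (longs φ)) (sym (slot≡old good ord q))
              (≢0⇒>0 (λ r → invalid (valid-but-better good ord q (inj₁ r))) ,
               ≤-trans (≮⇒≥ (λ r → invalid (valid-but-better good ord q (inj₂ r))))
                   (proj₂ (candidate good ord q)))

    module Accept (valid : Valid) where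

      open Valid valid

      -- Covers both origins of the rest: an entry of the table, and the finished arrangement, which
      -- has no entry.
      record Tail (φ′ : ℕ → ℕ) : Set where
        field
          good′  : Good φ′
          val≡   : val ≡ suc (longs φ′)
          match  : ∀ {v} → v < n → 2 ∸ φ′ v ≡ next d v
          index′ : ∀ {v} → v < n → d v ≡ 0 → B new v ≡ φ′ v ∸ 2
          bound′ : ∀ {v} → v < n → φ′ v ≤ 2 + s

      tail : Σ[ φ′ ∈ (ℕ → ℕ) ] Tail φ′
      tail with count d 0 ≟ 0
      ... | yes p = φ′ , record
          { good′ = record
              { cap = λ j → subst (_≤ c) (sym (sum-zero n λ v<n → eq-no λ q → <⇒≱ (s≤s (m≤m+n 1 j))
                  (subst (_≤ 1) q (≤1 v<n)))) z≤n
              ; down = λ {v} {j} v<n q → ⊥-elim (<⇒≱ (s≤s (s≤s (z≤n {1 + j})))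
                  (subst (_≤ 1) q (≤1 v<n))) }
          ; val≡ = trans (val-end p) (cong suc (sym (longs-low ≤1)))
          ; match = λ {v} v<n → aux (d v) (d≢0 v<n) (dig<4 τ v)
          ; index′ = λ v<n q → ⊥-elim (d≢0 v<n q)
          ; bound′ = λ {v} v<n → ≤-trans (m∸n≤m 2 (d v)) (m≤m+n 2 s) }
        where
        -- Everything is placed after this step, so levels 0 and 1 suffice to represent the
        -- resulting state.
        φ′ : ℕ → ℕ
        φ′ v = 2 ∸ d v

        d≢0 : ∀ {v} → v < n → d v ≢ 0
        d≢0 v<n q = 0≢1+n (trans (sym (sum-≡0 n p v<n)) (eq-yes q))

        ≤1 : ∀ {v} → v < n → φ′ v ≤ 1
        ≤1 v<n = ∸-monoʳ-≤ 2 (≢0⇒>0 (d≢0 v<n))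

        aux : ∀ x → x ≢ 0 → x < 4 → 2 ∸ (2 ∸ x) ≡ x ∸ apply quot x 3
        aux 0 ne _ = ⊥-elim (ne refl)
        aux 1 _ _ = refl
        aux 2 _ _ = refl
        aux 3 _ _ = refl
        aux (suc (suc (suc (suc _)))) _ (s≤s (s≤s (s≤s (s≤s ()))))
      ... | no p with entries inv (≢0⇒>0 new≢0) (<⇒≤ new<M)
        where
        -- The next bucket is nonempty and leaves a digit 1 behind. This excludes address 0, whose
        -- entry may stem from an earlier guess and is not covered by `entries`.
        new≢0 : new ≢ 0
        new≢0 q = [ (λ r → contra (sum-≢0 n (>0⇒≢0 r))) , p ]′ nonempty
          where
          contra : ¬ (∃[ u ] u < n × eq (d u) 1 ≢ 0)
          contra (u , u<n , ne) = 1+n≢0 (trans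
              (sym (cong (λ x → x ∸ apply quot x 3) (eq⇒≡ {d u} {1} ne)))
            (addr-injective g (next-≤2 (dig<4 τ)) (λ _ → z≤n {2}) (next-consistent (dig<4 τ)
                consistent) (λ _ → z≤n)
              (trans q (sym (addr-zero g λ _ → refl))) u<n))
      ...   | inj₁ q = ⊥-elim (>0⇒≢0 reachable (trans (val-more p) q))
      ...   | inj₂ (φ′ , e , con , slot≡) = φ′ , record
          { good′ = good e
          ; val≡ = trans (val-more p) (value e)
          ; match = λ v<n → trans (sym (past-δ φ′ v<n))
              (addr-injective g (past-≤2 (δ<4 φ′)) (next-≤2 (dig<4 τ)) (past-consistent {g} {δ φ′}
                  con)
                (next-consistent (dig<4 τ) consistent) slot≡ v<n)
          ; index′ = λ v<n _ → index e v<n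
          ; bound′ = bound e }

      open Tail (proj₂ tail)

      -- Where the digit is not 0, the row `new` may contain arbitrary words; the first factor
      -- suppresses them.
      block≤s : ∀ {v} → v < n → eq (d v) 0 * B new v ≤ s
      block≤s {v} v<n with d v ≟ 0
      ... | no  p = subst (λ x → x * B new v ≤ s) (sym (eq-no p)) z≤n
      ... | yes p = subst (λ x → x * B new v ≤ s) (sym (eq-yes p))
          (subst (_≤ s) (sym (+-identityʳ _))
              (subst (_≤ s) (sym (index′ v<n p)) (∸-monoˡ-≤ 2 (bound′ v<n))))

      φ : ℕ → ℕ
      φ = lift d (proj₁ tail)

      step : Step d φ (proj₁ tail)
      step = Step-lift (dig<4 τ) match

      δφ≡d : ∀ v → δ φ v ≡ d v
      δφ≡d = δ-lift (dig<4 τ) match (dig-beyond τ<4ⁿ)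

      slot≡ : slot g φ ≡ old
      slot≡ = addr-cong g λ v → cong (_∸ 1) (δφ≡d v)

      con : Consistent g (δ φ)
      con {i} i<h = subst₂ _≤_ (sym (δφ≡d (lo g i))) (sym (δφ≡d (hi g i))) (consistent i<h)

      module Update {V′ : ℕ → ℕ} {B′ : ℕ → ℕ → ℕ}
        (V-old : V′ old ≡ val + newLongs d)
        (V-other : ∀ {a} → a ≢ old → V′ a ≡ V a)
        (B-old : ∀ {v} → v < n → B′ old v ≡ eq (d v) 0 * B new v + eq (d v) 0)
        (B-other : ∀ {a v} → a ≢ old → v < n → B′ a v ≡ B a v) where

        entry : Entry (suc s) V′ B′ old φ
        entry = record
          { good  = Good-prepend step good′ capacious nonempty
          ; value = trans V-old (trans (cong (_+ newLongs d) val≡)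
              (cong suc (sym (longs-step step))))
          ; index = λ v<n → trans (B-old v<n) (lift-index (dig<4 τ) match v<n (index′ v<n))
          ; bound = λ {v} v<n → ≤-trans (lift-≤ (dig<4 τ) match v) (s≤s (bound′ v<n)) }

        -- A nonzero value is replaced only by a smaller one, so all that `done` and `searched`
        -- assert persists.
        V-decreases : ∀ {a k} → Within (V a) k → Within (V′ a) k
        V-decreases {a} {k} (pos , le) with a ≟ old
        ... | no  p = subst (λ x → Within x k) (sym (V-other p)) (pos , le)
        ... | yes refl = subst (λ x → Within x k) (sym V-old)
                (≤-trans reachable (m≤m+n val _) ,
                 [ (λ q → ⊥-elim (>0⇒≢0 pos q)) , (λ q → ≤-trans (<⇒≤ q) le) ]′ better)

        start′ : StartEntry V′ B′
        start′ with 0 ≟ old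
        ... | yes p = inj₂ (φ , subst (λ a → Entry Q V′ B′ a φ) (sym p)
                (record { good = good entry ; value = value entry ; index = index entry
                        -- `Q` bounds the number of steps in any pass, so the entry at address 0
                        -- stays valid for later guesses.
                        ; bound = λ v<n → ≤-trans (bound entry v<n) (+-monoʳ-≤ 2 s<Q) })
                , slot≡0⇒Start g {φ} con (trans slot≡ (sym p)))
        ... | no  p with start inv
        ...   | inj₁ q = inj₁ (trans (V-other p) q)
        ...   | inj₂ (ψ , e , st) = inj₂ (ψ , record
                  { good = good e ; value = trans (V-other p) (value e)
                  ; index = λ v<n → trans (B-other p v<n) (index e v<n) ; bound = bound e } , st)

        accept : Inv g (suc s) V′ B′
        accept = record
          { start = start′
          ; entries = entries′
          ; done = done′
          ; searched = λ p ψ good st ord → V-decreases (searched inv p ψ good st ord) }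
          where
          entries′ : ∀ {a} → 0 < a → a ≤ M →
                     V′ a ≡ 0 ⊎ ∃[ ψ ] Entry (suc s) V′ B′ a ψ × Consistent g (δ ψ) × slot g ψ ≡ a
          entries′ {a} p q with a ≟ old
          ... | yes refl = inj₂ (φ , entry , con , slot≡)
          ... | no  r with entries inv p q
          ...   | inj₁ t = inj₁ (trans (V-other r) t)
          ...   | inj₂ (ψ , e , t) = inj₂ (ψ , weaken (V-other r) (B-other r) e , t)

          done′ : ∀ ψ → Good ψ → Ordered g ψ → Q ≤ code ψ + suc s → Within (V′ (slot g ψ)) (longs ψ)
          done′ ψ good ord p with pending ψ p
          ... | inj₁ q = V-decreases (done inv ψ good ord q)
          ... | inj₂ q = subst (λ a → Within (V′ a) (longs ψ)) (sym (slot≡old good ord q))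
                  (subst (λ x → Within x (longs ψ)) (sym V-old) (candidate good ord q))

-- A calculus of running times

for : ∀ {r} → Fin r → Expr r → Cmd r → Cmd r
for i lim body = i ≔ lit 0 ⨾ while (reg i ⟨ less ⟩ lim) (body ⨾ (i ≔ reg i ⟨ add ⟩ lit 1))

accumulate : ∀ {r} → Fin r → Expr (suc r) → Expr (suc r) → Cmd (suc r)
accumulate x lim e = (suc x ≔ lit 0) ⨾ for zero lim (suc x ≔ e)

fill : ∀ {r} → Expr (suc r) → Expr (suc r) → Expr (suc r) → Cmd (suc r)
fill lim ae ve = for zero lim (⟦ ae ⟧≔ ve)

-- Setting the counter takes 2, each test of the guard `3 + cl` and each increment 4; there is one
-- test more than there are rounds.
forTime : ℕ → ℕ → ℕ → ℕ
forTime N tb cl = 2 + (N * (3 + cl + (tb + 4)) + (3 + cl))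

updateAt-cong : ∀ {r} {f g : Fin r → ℕ} {v} x → (∀ y → f y ≡ g y) →
                ∀ y → updateAt f x (const v) y ≡ updateAt g x (const v) y
updateAt-cong zero    eqs zero    = refl
updateAt-cong zero    eqs (suc y) = eqs (suc y)
updateAt-cong (suc x) eqs zero    = eqs zero
updateAt-cong (suc x) eqs (suc y) = updateAt-cong x (eqs ∘ suc) y

updateAt-twice : ∀ {r} (f : Fin r → ℕ) {u v} x →
                 ∀ y → updateAt (updateAt f x (const u)) x (const v) y ≡ updateAt f x (const v) y
updateAt-twice f zero    zero    = refl
updateAt-twice f zero    (suc y) = refl
updateAt-twice f (suc x) zero    = refl
updateAt-twice f (suc x) (suc y) = updateAt-twice (f ∘ suc) x y

updateAt-get : ∀ {r} (f : Fin r → ℕ) {v} x → updateAt f x (const v) x ≡ v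
updateAt-get f zero    = refl
updateAt-get f (suc x) = updateAt-get (f ∘ suc) x

↦-hit : ∀ μ {a x} → (μ [ a ↦ x ]) a ≡ x
↦-hit μ {a} with a ≡ᵇ a | ≡⇒≡ᵇ a a refl
... | true | _ = refl

↦-miss : ∀ μ {a x i} → i ≢ a → (μ [ a ↦ x ]) i ≡ μ i
↦-miss μ {a} {i = i} i≢a with i ≡ᵇ a | ≡ᵇ⇒≡ i a
... | true  | p = ⊥-elim (i≢a (p _))
... | false | _ = refl

module Logic (w m a L : ℕ) (aL≤w : a * suc L ≤ w) where

  open Machine w m public

  -- Sizes are measured in units of suc L bits, of which a word holds at least a.
  Small : ℕ → ℕ → Set
  Small k x = x < 2 ^ (k * suc L)

  record Val {r} (k : ℕ) (σ : State r) (e : Expr r) (x : ℕ) : Set where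
    constructor _,_
    field
      evals : σ ⊢ e ⇓ x
      small : Small k x
  open Val public

  ≤-2^ : ∀ {m n} → m ≤ n → 2 ^ m ≤ 2 ^ n
  ≤-2^ = ^-monoʳ-≤ 2

  Small-mono : ∀ {k l x} → k ≤ l → Small k x → Small l x
  Small-mono {k} {l} k≤l p = <-≤-trans p (≤-2^ (*-monoˡ-≤ (suc L) k≤l))

  Small-≤ : ∀ {k x y} → x ≤ y → Small k y → Small k x
  Small-≤ = ≤-<-trans

  Small-const : ∀ k {x} → x < 2 ^ k → Small k x
  Small-const k p = <-≤-trans p (≤-2^ (m≤m*n k (suc L)))

  -- A carry needs one bit; a whole unit is charged so that sizes stay natural numbers independent
  -- of `L`.
  Small-+ : ∀ {k l x y} → Small k x → Small l y → Small (suc (k ⊔ l)) (x + y)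
  Small-+ {k} {l} {x} {y} p q = begin-strict
    x + y            <⟨ +-mono-< (Small-mono (m≤m⊔n k l) p) (Small-mono (m≤n⊔m k l) q) ⟩
    X + X            ≡⟨ cong (X +_) (+-identityʳ X) ⟨
    2 * X            ≤⟨ *-monoˡ-≤ X (≤-2^ {1} {suc L} (s≤s z≤n)) ⟩
    2 ^ suc L * X    ≡⟨ ^-distribˡ-+-* 2 (suc L) ((k ⊔ l) * suc L) ⟨
    2 ^ (suc (k ⊔ l) * suc L) ∎
    where
    open ≤-Reasoning
    X = 2 ^ ((k ⊔ l) * suc L)

  Small-* : ∀ {k l x y} → Small k x → Small l y → Small (k + l) (x * y)
  Small-* {k} {l} {x} {y} p q = subst (x * y <_)
    (trans (sym (^-distribˡ-+-* 2 (k * suc L) (l * suc L)))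
        (cong (2 ^_) (sym (*-distribʳ-+ (suc L) k l))))
    (*-mono-< p q)

  word : ∀ {k x} → k ≤ a → Small k x → x < 2 ^ w
  word {k} k≤a p = <-≤-trans p (≤-2^ (≤-trans (*-monoˡ-≤ (suc L) k≤a) aL≤w))

  -- For numerals this computes to the unit type, so implicit arguments of this form are solved
  -- automatically.
  Fits : ℕ → Set
  Fits k = T (k ≤ᵇ a)

  fits : ∀ {k} → Fits k → k ≤ a
  fits {k} = ≤ᵇ⇒≤ k a

  module _ {r} {σ : State r} where

    number : ∀ k {x} {_ : T (x <ᵇ 2 ^ k)} {_ : Fits k} → Val k σ (lit x) x
    number k {x} {p} {q} = lit (word {k} (fits {k} q) sm) , sm
      where
      sm : Small k x
      sm = Small-const k (<ᵇ⇒< x (2 ^ k) p)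

    register : ∀ {k i x} → regs σ i ≡ x → Small k x → Val k σ (reg i) x
    register refl p = reg , p

    cell : ∀ {k l e b x} → Val k σ e b → b < m → mem σ b ≡ x → Small l x → Val l σ ⟦ e ⟧ x
    cell v b<m refl p = read (evals v) b<m , p

    infixl 6 _`+_ _`-_
    infixl 7 _`*_ _`/_ _`%_

    _`+_ : ∀ {k l e e′ x y} → Val k σ e x → Val l σ e′ y → {_ : Fits (suc (k ⊔ l))} →
           Val (suc (k ⊔ l)) σ (e ⟨ add ⟩ e′) (x + y)
    _`+_ {k} {l} v v′ {f} = op add (evals v) (evals v′) (word {suc (k ⊔ l)} (fits {suc (k ⊔ l)} f)
        sm) , sm
      where sm = Small-+ {k} {l} (small v) (small v′)

    _`*_ : ∀ {k l e e′ x y} → Val k σ e x → Val l σ e′ y → {_ : Fits (k + l)} →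
           Val (k + l) σ (e ⟨ mul ⟩ e′) (x * y)
    _`*_ {k} {l} v v′ {f} = op mul (evals v) (evals v′) (word {k + l} (fits {k + l} f) sm) , sm
      where sm = Small-* {k} {l} (small v) (small v′)

    _`-_ : ∀ {k l e e′ x y} → Val k σ e x → Val l σ e′ y → {_ : Fits k} →
           Val k σ (e ⟨ sub ⟩ e′) (x ∸ y)
    _`-_ {k} {x = x} {y} v v′ {f} = op sub (evals v) (evals v′) (word {k} (fits {k} f) sm) , sm
      where sm = Small-≤ {k} (m∸n≤m x y) (small v)

    quot-≤ : ∀ x y → apply quot x y ≤ x
    quot-≤ x zero    = z≤n
    quot-≤ x (suc y) = m/n≤m x (suc y)

    rem-≤ : ∀ x y → apply rem x y ≤ x
    rem-≤ x zero    = z≤n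
    rem-≤ x (suc y) = m%n≤m x (suc y)

    _`/_ : ∀ {k l e e′ x y} → Val k σ e x → Val l σ e′ y → {_ : Fits k} →
           Val k σ (e ⟨ quot ⟩ e′) (apply quot x y)
    _`/_ {k} {x = x} {y} v v′ {f} = op quot (evals v) (evals v′) (word {k} (fits {k} f) sm) , sm
      where sm = Small-≤ {k} (quot-≤ x y) (small v)

    _`%_ : ∀ {k l e e′ x y} → Val k σ e x → Val l σ e′ y → {_ : Fits k} →
           Val k σ (e ⟨ rem ⟩ e′) (apply rem x y)
    _`%_ {k} {x = x} {y} v v′ {f} = op rem (evals v) (evals v′) (word {k} (fits {k} f) sm) , sm
      where sm = Small-≤ {k} (rem-≤ x y) (small v)

    Small-bit : ∀ {x} → x ≤ 1 → Small 1 x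
    Small-bit p = Small-const 1 (s≤s p)

    `less : ∀ {e e′ x y} → σ ⊢ e ⇓ x → σ ⊢ e′ ⇓ y → {_ : Fits 1} → Val 1 σ (e ⟨ less ⟩ e′) (lt x y)
    `less {x = x} {y} v v′ {f} = op less v v′ (word {1} (fits {1} f) sm) , sm
      where sm = Small-bit (lt≤1 x y)

    `equal : ∀ {e e′ x y} → σ ⊢ e ⇓ x → σ ⊢ e′ ⇓ y → {_ : Fits 1} → Val 1 σ (e ⟨ equal ⟩ e′)
        (eq x y)
    `equal {x = x} {y} v v′ {f} = op equal v v′ (word {1} (fits {1} f) sm) , sm
      where sm = Small-bit (eq≤1 x y)

    -- Replaces the size found by the calculus with a better one known from the meaning of the
    -- value.
    exact : ∀ k {e x} → σ ⊢ e ⇓ x → Small k x → Val k σ e x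
    exact k v p = v , p

  -- Rules for commands

  Runs : ∀ {r} → State r → Cmd r → ℕ → (State r → Set) → Set
  Runs σ p t Q = ∃[ t′ ] ∃[ σ′ ] (σ ⊢ p ⇓[ t′ ] σ′) × t′ ≤ t × Q σ′

  setReg : ∀ {r} → State r → Fin r → ℕ → State r
  setReg σ i x = ⟨ updateAt (regs σ) i (const x) , mem σ ⟩

  module _ {r} {σ : State r} where

    run-assign : ∀ {i e x Q} → σ ⊢ e ⇓ x → Q (setReg σ i x) → Runs σ (i ≔ e) (suc (cost e)) Q
    run-assign v q = _ , _ , assign v , ≤-refl , q

    run-write : ∀ {e e′ b x Q} → σ ⊢ e ⇓ b → b < m → σ ⊢ e′ ⇓ x →
                Q ⟨ regs σ , mem σ [ b ↦ x ] ⟩ → Runs σ (⟦ e ⟧≔ e′) (suc (cost e + cost e′)) Q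
    run-write v b<m v′ q = _ , _ , write v b<m v′ , ≤-refl , q

    run-skip : ∀ {Q : State r → Set} → Q σ → Runs σ skip 1 Q
    run-skip q = _ , _ , skip , ≤-refl , q

    infixr 3 _>>_
    _>>_ : ∀ {p q t t′ Q R} → Runs σ p t Q → (∀ {σ′} → Q σ′ → Runs σ′ q t′ R) → Runs σ (p ⨾ q)
        (t + t′) R
    (_ , _ , d , le , q) >> f with f q
    ... | _ , _ , d′ , le′ , q′ = _ , _ , seq d d′ , +-mono-≤ le le′ , q′

    run-map : ∀ {p t Q R} → Runs σ p t Q → (∀ {σ′} → Q σ′ → R σ′) → Runs σ p t R
    run-map (_ , _ , d , le , q) f = _ , _ , d , le , f q

    run-≤ : ∀ {p t t′ Q} → t ≤ t′ → Runs σ p t Q → Runs σ p t′ Q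
    run-≤ t≤t′ (_ , _ , d , le , q) = _ , _ , d , ≤-trans le t≤t′ , q

    run-cond : ∀ {e p q x t Q} → σ ⊢ e ⇓ x → (x ≢ 0 → Runs σ p t Q) → (x ≡ 0 → Runs σ q t Q) →
               Runs σ (cond e p q) (suc (cost e + t)) Q
    run-cond {e} {x = x} v yes′ no′ with x ≟ 0
    ... | no  x≢0 with yes′ x≢0
    ...   | _ , _ , d , le , q = _ , _ , cond-true v x≢0 d , s≤s (+-monoʳ-≤ (cost e) le) , q
    run-cond {e} v yes′ no′ | yes refl with no′ refl
    ...   | _ , _ , d , le , q = _ , _ , cond-false v d , s≤s (+-monoʳ-≤ (cost e) le) , q

  module _ {r} (i : Fin r) (lim : Expr r) (body : Cmd r) (I : ℕ → State r → Set)
    {N tb k : ℕ} (1≤a : Fits 1) (k≤a : Fits k) (N-small : Small k N)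
    (limit : ∀ {σ j} → regs σ i ≡ j → I j σ → σ ⊢ lim ⇓ N)
    (iterate : ∀ {σ j} → j < N → regs σ i ≡ j → I j σ →
               Runs σ body tb (λ σ′ → regs σ′ i ≡ j × I (suc j) (setReg σ′ i (suc j))))
    where

    private
      guard : ∀ {σ j} → regs σ i ≡ j → I j σ → σ ⊢ reg i ⟨ less ⟩ lim ⇓ lt j N
      guard refl inv = evals (`less reg (limit refl inv) {1≤a})

      one<2ʷ : 1 < 2 ^ w
      one<2ʷ = word {1} (fits {1} 1≤a) (Small-const 1 ≤-refl)

      incr : ∀ {σ j} → j < N → regs σ i ≡ j → σ ⊢ reg i ⟨ add ⟩ lit 1 ⇓ suc j
      incr {σ} {j} j<N refl = subst (σ ⊢ reg i ⟨ add ⟩ lit 1 ⇓_) (+-comm j 1)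
        (op add reg (lit one<2ʷ)
          (subst (_< 2 ^ w) (+-comm 1 j) (≤-<-trans j<N (word {k} (fits {k} k≤a) N-small))))

      loop : ∀ j′ {j σ} → j′ + j ≡ N → regs σ i ≡ j → I j σ →
             Runs σ (while (reg i ⟨ less ⟩ lim) (body ⨾ (i ≔ reg i ⟨ add ⟩ lit 1)))
               (j′ * (3 + cost lim + (tb + 4)) + (3 + cost lim)) (λ σ′ → I N σ′)
      loop zero {σ = σ} refl ij inv =
        _ , _ , while-false (subst (σ ⊢ reg i ⟨ less ⟩ lim ⇓_) (lt-no {N} {N} (<-irrefl refl))
            (guard ij inv)) , ≤-refl , inv
      loop (suc j′) {j} {σ} p ij inv with iterate j<N ij inv
        where
        j<N : j < N
        j<N = subst (j <_) p (s≤s (m≤n+m j j′))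
      ... | t , σ₁ , d , le , i₁ , inv₁ with loop j′ {suc j} {setReg σ₁ i (suc j)}
          (trans (+-suc j′ j) p) (updateAt-get (regs σ₁) i) inv₁
      ...   | t′ , σ₂ , d′ , le′ , q = _ , σ₂ ,
              while-true (guard ij inv) (λ z → 1+n≢0 (trans (sym (lt-yes j<N)) z))
                (seq d (assign (incr j<N i₁))) d′ , bound , q
        where
        j<N : j < N
        j<N = subst (j <_) p (s≤s (m≤n+m j j′))

        bound : suc (suc (suc (cost lim)) + (t + 4) + t′) ≤ suc j′ * (3 + cost lim + (tb + 4)) +
            (3 + cost lim)
        bound = ≤-trans (+-mono-≤ (+-monoʳ-≤ (3 + cost lim) (+-monoˡ-≤ 4 le)) le′)
                  (≤-reflexive (sym (+-assoc (3 + cost lim + (tb + 4))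
                      (j′ * (3 + cost lim + (tb + 4))) (3 + cost lim))))

    -- Induction on the number of rounds left. The limit is evaluated anew in every round, so its
    -- value has to follow from the invariant.
    run-for : ∀ {σ} → I 0 (setReg σ i 0) → Runs σ (for i lim body) (forTime N tb (cost lim)) (I N)
    run-for {σ} inv = run-assign {Q = _≡ setReg σ i 0} (lit (≤-<-trans z≤n one<2ʷ)) refl >>
      λ { refl → loop N (+-identityʳ N) (updateAt-get (regs σ) i) inv }

  -- Register 0 is the loop counter; ρ describes the other registers.
  infix 4 _≈_
  _≈_ : ∀ {r} → State (suc r) → (Fin r → ℕ) → Set
  σ ≈ ρ = ∀ y → regs σ (suc y) ≡ ρ y

  infix 9 _⟪_≔_⟫
  _⟪_≔_⟫ : ∀ {r} → (Fin r → ℕ) → Fin r → ℕ → Fin r → ℕ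
  ρ ⟪ x ≔ v ⟫ = updateAt ρ x (const v)

  record At {r} (μ : Memory) (ρ : Fin r → ℕ) (σ : State (suc r)) : Set where
    constructor _,_
    field
      memory    : mem σ ≡ μ
      registers : σ ≈ ρ
  open At public

  run-set : ∀ {r} {σ : State (suc r)} {μ ρ x e v} → At μ ρ σ → σ ⊢ e ⇓ v →
            Runs σ (suc x ≔ e) (suc (cost e)) (At μ (ρ ⟪ x ≔ v ⟫))
  run-set {x = x} at v = run-assign v (memory at , updateAt-cong x (registers at))

  module _ {r} {μ} {ρ : Fin r → ℕ} (x : Fin r) (lim e : Expr (suc r)) (F : ℕ → ℕ) (F0 : F 0 ≡ 0)
    {N k : ℕ} (1≤a : Fits 1) (k≤a : Fits k) (N-small : Small k N)
    (limit : ∀ {σ v} → At μ (ρ ⟪ x ≔ v ⟫) σ → σ ⊢ lim ⇓ N)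
    (next : ∀ {σ j} → j < N → At μ (ρ ⟪ x ≔ F j ⟫) σ → regs σ zero ≡ j → σ ⊢ e ⇓ F (suc j))
    where

    -- Stated for an arbitrary recursion `F`, so that it covers both sums and the maximum `top`.
    run-accumulate : ∀ {σ} → At μ ρ σ → Runs σ (accumulate x lim e) (2 + forTime N (suc (cost e))
        (cost lim))
                                             (At μ (ρ ⟪ x ≔ F N ⟫))
    run-accumulate at =
      run-set at (lit (word {1} (fits {1} 1≤a) (Small-const 1 z<s))) >>
      λ at₀ → run-for zero lim (suc x ≔ e) (λ j → At μ (ρ ⟪ x ≔ F j ⟫)) {N} {suc (cost e)} {k} 1≤a
          k≤a N-small
        (λ _ → limit)
        (λ j<N ij at → run-assign (next j<N at ij)
          (ij , (memory at , λ y → trans (updateAt-cong x (registers at) y)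
              (updateAt-twice ρ x y))))
        (memory at₀ , λ y → trans (registers at₀ y) (F0-cong y))
      where
      F0-cong : ∀ y → updateAt ρ x (const 0) y ≡ updateAt ρ x (const (F 0)) y
      F0-cong y = cong (λ v → updateAt ρ x (const v) y) (sym F0)

  module _ {r} {μ} {ρ : Fin r → ℕ} (x : Fin r) (lim e : Expr (suc r)) (f : ℕ → ℕ)
    {N k l : ℕ} (1≤a : Fits 1) (k≤a : Fits k) (l≤a : Fits l) (N-small : Small k N)
        (sum-small : Small l (sum N f))
    (limit : ∀ {σ v} → At μ (ρ ⟪ x ≔ v ⟫) σ → σ ⊢ lim ⇓ N)
    (term : ∀ {σ j v} → j < N → At μ (ρ ⟪ x ≔ v ⟫) σ → regs σ zero ≡ j → σ ⊢ e ⇓ f j)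
    where

    run-sum : ∀ {σ} → At μ ρ σ →
              Runs σ (accumulate x lim (reg (suc x) ⟨ add ⟩ e)) (2 + forTime N (3 + cost e)
                  (cost lim))
                (At μ (ρ ⟪ x ≔ sum N f ⟫))
    run-sum = run-accumulate x lim (reg (suc x) ⟨ add ⟩ e) (λ j → sum j f) refl {N} {k} 1≤a k≤a
        N-small limit
      λ {σ} {j} j<N at ij → op add
        (subst (σ ⊢ reg (suc x) ⇓_) (trans (registers at x) (updateAt-get ρ x)) reg)
        (term j<N at ij)
        -- Partial sums are at most the total, so a bound on the total prevents overflow in every
        -- round.
        (word {l} (fits {l} l≤a) (Small-≤ {l} (sum-prefix f j<N) sum-small))

  -- `filled` lets a round read what earlier rounds wrote, as the powers of 2 require; `others` is
  -- the frame condition.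
  record Filled (A X : ℕ → ℕ) (j : ℕ) (μ μ′ : Memory) : Set where
    field
      filled : ∀ {i} → i < j → μ′ (A i) ≡ X i
      others : ∀ {b} → (∀ {i} → i < j → b ≢ A i) → μ′ b ≡ μ b
  open Filled public

  module _ {r} {ρ : Fin r → ℕ} (lim ae ve : Expr (suc r)) (A X : ℕ → ℕ)
    {N k : ℕ} (1≤a : Fits 1) (k≤a : Fits k) (N-small : Small k N) {σ : State (suc r)}
    (A-injective : ∀ {i j} → i < N → j < N → A i ≡ A j → i ≡ j)
    (limit : ∀ {σ′ j} → σ′ ≈ ρ → j ≤ N → Filled A X j (mem σ) (mem σ′) → σ′ ⊢ lim ⇓ N)
    (next : ∀ {σ′ j} → j < N → σ′ ≈ ρ → regs σ′ zero ≡ j → Filled A X j (mem σ) (mem σ′) →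
            (σ′ ⊢ ae ⇓ A j) × A j < m × (σ′ ⊢ ve ⇓ X j))
    where

    run-fill : σ ≈ ρ → Runs σ (fill lim ae ve) (forTime N (suc (cost ae + cost ve)) (cost lim))
                         (λ σ′ → σ′ ≈ ρ × Filled A X N (mem σ) (mem σ′))
    run-fill eqs = run-map
      (run-for zero lim (⟦ ae ⟧≔ ve) I {N} {suc (cost ae + cost ve)} {k} 1≤a k≤a N-small
        (λ _ (le , r , fl) → limit r le fl)
        (λ {σ′} j<N ij (le , r , fl) → let (va , a<m , vx) = next j<N r ij fl in
          run-write va a<m vx (ij , j<N , r , extend {σ′} j<N fl))
        (z≤n , eqs , record { filled = λ () ; others = λ _ → refl }))
      proj₂
      where
      I : ℕ → State (suc r) → Set
      I j σ′ = j ≤ N × σ′ ≈ ρ × Filled A X j (mem σ) (mem σ′)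

      extend : ∀ {σ′ j} → j < N → Filled A X j (mem σ) (mem σ′) →
               Filled A X (suc j) (mem σ) (mem σ′ [ A j ↦ X j ])
      extend {σ′} {j} j<N fl = record { filled = fl′ ; others = λ ne →
          trans (↦-miss (mem σ′) (ne ≤-refl)) (others fl (ne ∘ m<n⇒m<1+n)) }
        where
        fl′ : ∀ {i} → i < suc j → (mem σ′ [ A j ↦ X j ]) (A i) ≡ X i
        fl′ {i} i<1+j with m≤n⇒m<n∨m≡n (s≤s⁻¹ i<1+j)
        ... | inj₂ refl = ↦-hit (mem σ′)
        ... | inj₁ i<j  = trans (↦-miss (mem σ′)
            (λ p → <⇒≢ i<j (A-injective (<-trans i<j j<N) j<N p))) (filled fl i<j)

-- The program

-- The input stays in place until the output is written. It is followed by the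
-- powers 2⁰, …, 2ⁿ and by the table, whose entry a consists of its value and the
-- n bucket indices.
gᵣ sᵣ τᵣ onesᵣ restᵣ violᵣ oldᵣ newᵣ longᵣ valᵣ : Fin 10
gᵣ = # 0
sᵣ = # 1
τᵣ = # 2
onesᵣ = # 3
restᵣ = # 4
violᵣ = # 5
oldᵣ = # 6
newᵣ = # 7
longᵣ = # 8
valᵣ = # 9

E : Set
E = Expr 11

iE nE cE baseE tableE hE rowE colE : E
iE = reg zero
nE = ⟦ lit 0 ⟧
cE = ⟦ lit 1 ⟧
baseE = lit 2 ⟨ add ⟩ (nE ⟨ mul ⟩ nE)
tableE = baseE ⟨ add ⟩ (nE ⟨ add ⟩ lit 1)
hE = (nE ⟨ add ⟩ lit 1) ⟨ quot ⟩ lit 2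
rowE = iE ⟨ quot ⟩ nE
colE = iE ⟨ rem ⟩ nE

var : Fin 10 → E
var x = reg (suc x)

powE cubeE digE pastE nextE bitE valueE : E → E
powE e = ⟦ baseE ⟨ add ⟩ e ⟧
cubeE e = (powE e ⟨ mul ⟩ powE e) ⟨ mul ⟩ powE e
digE e = (var τᵣ ⟨ quot ⟩ (powE e ⟨ mul ⟩ powE e)) ⟨ rem ⟩ lit 4
pastE e = digE e ⟨ sub ⟩ lit 1
nextE e = digE e ⟨ sub ⟩ (digE e ⟨ quot ⟩ lit 3)
bitE e = (var gᵣ ⟨ quot ⟩ powE e) ⟨ rem ⟩ lit 2

placeE : E → E → E
placeE a o = (tableE ⟨ add ⟩ (a ⟨ mul ⟩ (nE ⟨ add ⟩ lit 1))) ⟨ add ⟩ o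

valueE a = ⟦ placeE a (lit 0) ⟧

hiE loE onesE restE violE oldE newE longE sucE : E
hiE = (lit 2 ⟨ mul ⟩ iE) ⟨ add ⟩ bitE iE
loE = (lit 2 ⟨ mul ⟩ iE) ⟨ add ⟩ (lit 1 ⟨ sub ⟩ bitE iE)
onesE = digE iE ⟨ equal ⟩ lit 1
restE = digE iE ⟨ equal ⟩ lit 0
violE = digE hiE ⟨ less ⟩ digE loE
oldE = cubeE iE ⟨ mul ⟩ ((lit 2 ⟨ mul ⟩ pastE hiE) ⟨ add ⟩ pastE loE)
newE = cubeE iE ⟨ mul ⟩ ((lit 2 ⟨ mul ⟩ nextE hiE) ⟨ add ⟩ nextE loE)
longE = ((rowE ⟨ less ⟩ colE) ⟨ mul ⟩ ⟦ lit 2 ⟨ add ⟩ iE ⟧) ⟨ mul ⟩ ((digE rowE ⟨ mul ⟩ digE colE) ⟨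
    equal ⟩ lit 3)
sucE = lit 1 ⟨ add ⟩ iE

addUp : Fin 10 → E → E → Cmd 11
addUp x lim e = accumulate x lim (var x ⟨ add ⟩ e)

-- `testE` is the conjunction of the fields of `Valid`, with products as conjunctions and sums as
-- disjunctions.
τE valE testE blockE topE : E
τE = (powE nE ⟨ mul ⟩ powE nE) ⟨ sub ⟩ (lit 1 ⟨ add ⟩ var sᵣ)
valE = (var restᵣ ⟨ equal ⟩ lit 0) ⟨ add ⟩ ((lit 0 ⟨ less ⟩ var restᵣ) ⟨ mul ⟩ valueE (var newᵣ))
testE = ((((var violᵣ ⟨ equal ⟩ lit 0) ⟨ mul ⟩ (lit 1 ⟨ sub ⟩ (cE ⟨ less ⟩ var onesᵣ)))
      ⟨ mul ⟩ (lit 0 ⟨ less ⟩ (var onesᵣ ⟨ add ⟩ (var restᵣ ⟨ equal ⟩ lit 0))))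
      ⟨ mul ⟩ (lit 0 ⟨ less ⟩ var valᵣ))
      ⟨ mul ⟩ (lit 0 ⟨ less ⟩ ((valueE (var oldᵣ) ⟨ equal ⟩ lit 0)
                           ⟨ add ⟩ ((var valᵣ ⟨ add ⟩ var longᵣ) ⟨ less ⟩ valueE (var oldᵣ))))
blockE = ((digE iE ⟨ equal ⟩ lit 0) ⟨ mul ⟩ ⟦ placeE (var newᵣ) sucE ⟧) ⟨ add ⟩
    (digE iE ⟨ equal ⟩ lit 0)
topE = var valᵣ ⟨ add ⟩ ((⟦ placeE (lit 0) sucE ⟧ ⟨ add ⟩ lit 1) ⟨ sub ⟩ var valᵣ)

relax update guess initialise output program : Cmd 11

update =
  (⟦ placeE (var oldᵣ) (lit 0) ⟧≔ (var valᵣ ⟨ add ⟩ var longᵣ)) ⨾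
  fill nE (placeE (var oldᵣ) sucE) blockE

relax =
  (suc τᵣ ≔ τE) ⨾
  addUp onesᵣ nE onesE ⨾
  addUp restᵣ nE restE ⨾
  addUp violᵣ hE violE ⨾
  addUp oldᵣ hE oldE ⨾
  addUp newᵣ hE newE ⨾
  addUp longᵣ (nE ⟨ mul ⟩ nE) longE ⨾
  (suc valᵣ ≔ valE) ⨾
  cond testE update skip

guess =
  -- Clears the addresses from 1 to `M`; the best arrangement found so far remains at address 0.
  fill (cubeE hE) (placeE sucE (lit 0)) (lit 0) ⨾
  for (suc sᵣ) (powE nE ⟨ mul ⟩ powE nE) relax

initialise =
  (⟦ baseE ⟧≔ lit 1) ⨾
  fill nE (baseE ⟨ add ⟩ sucE) (lit 2 ⟨ mul ⟩ powE iE) ⨾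
  (⟦ placeE (lit 0) (lit 0) ⟧≔ lit 0)

output =
  -- The number of buckets waits in a register and is written last, because the loops read `n` from
  -- cell 0.
  accumulate valᵣ nE topE ⨾
  fill nE sucE ⟦ placeE (lit 0) sucE ⟧ ⨾
  (⟦ lit 0 ⟧≔ var valᵣ)

program =
  initialise ⨾
  for (suc gᵣ) (powE hE) guess ⨾
  cond (valueE (lit 0)) output skip

-- Time and space as functions of the number of vertices

sumTime : ℕ → E → E → ℕ
sumTime N e lim = 2 + forTime N (3 + cost e) (cost lim)

fillTime : ℕ → E → E → E → ℕ
fillTime N ae ve lim = forTime N (suc (cost ae + cost ve)) (cost lim)

module Times (n : ℕ) where

  -- These unfold to `h`, `M` and `Q`, whose module also takes the capacity and the matrix as
  -- parameters, whereas the bounds may depend on `n` only.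
  half eightʰ fourⁿ : ℕ
  half   = apply quot (n + 1) 2
  eightʰ = 2 ^ half * 2 ^ half * 2 ^ half
  fourⁿ  = 2 ^ n * 2 ^ n

  updateTime relaxTime guessTime initTime outputTime time : ℕ
  updateTime = suc (cost (placeE (var oldᵣ) (lit 0)) + cost (var valᵣ ⟨ add ⟩ var longᵣ)) +
               fillTime n (placeE (var oldᵣ) sucE) blockE nE
  relaxTime  = suc (cost τE) + (sumTime n onesE nE + (sumTime n restE nE + (sumTime half violE hE +
               (sumTime half oldE hE + (sumTime half newE hE +
                   (sumTime (n * n) longE (nE ⟨ mul ⟩ nE) +
               (suc (cost valE) + suc (cost testE + updateTime))))))))
  guessTime  = fillTime eightʰ (placeE sucE (lit 0)) (lit 0) (cubeE hE) +
               forTime fourⁿ relaxTime (cost (powE nE ⟨ mul ⟩ powE nE))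
  initTime   = suc (cost baseE + 1) + (fillTime n (baseE ⟨ add ⟩ sucE) (lit 2 ⟨ mul ⟩ powE iE) nE +
               suc (cost (placeE (lit 0) (lit 0)) + 1))
  outputTime = (2 + forTime n (suc (cost topE)) (cost nE)) + (fillTime n sucE ⟦ placeE (lit 0) sucE
      ⟧ nE + 3)
  time       = initTime + (forTime (2 ^ half) guessTime (cost (powE hE)) +
               suc (cost (valueE (lit 0)) + outputTime))

space : ℕ → ℕ
space n = 2 + n * n + (n + 1) + (suc (Times.eightʰ n)) * (n + 1)

-- Correctness of the program

module Run (n c w : ℕ) (mat : ℕ → ℕ) (aL≤w : 20 * suc n ≤ w)
  (mat≤1 : ∀ {j} → j < n * n → mat j ≤ 1) where

  open Table n c mat
  -- A unit is `suc n` bits. The largest sizes derived below are the 8 units of `oldV` and `newV`.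
  open Logic w (space n) 20 n aL≤w
  open Times n

  powerBase tableBase : ℕ
  powerBase = 2 + n * n
  tableBase = powerBase + (n + 1)

  place : ℕ → ℕ → ℕ
  place a o = tableBase + a * (n + 1) + o

  place< : ∀ {a o} → a ≤ M → o ≤ n → place a o < space n
  place< {a} {o} a≤M o≤n = begin-strict
    tableBase + a * (n + 1) + o        ≡⟨ +-assoc tableBase _ o ⟩
    tableBase + (a * (n + 1) + o)      <⟨ +-monoʳ-< tableBase (+-mono-≤-< (*-monoˡ-≤ (n + 1) a≤M)
        (subst (o <_) (+-comm 1 n) (s≤s o≤n))) ⟩
    tableBase + (M * (n + 1) + (n + 1)) ≡⟨ cong (tableBase +_) (+-comm (M * (n + 1)) (n + 1)) ⟩
    tableBase + suc M * (n + 1)        ∎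
    where open ≤-Reasoning

  place≥tableBase : ∀ a o → tableBase ≤ place a o
  place≥tableBase a o = ≤-trans (m≤m+n tableBase _) (m≤m+n _ o)

  place-< : ∀ {a o a′ o′} → o ≤ n → a < a′ → place a o < place a′ o′
  place-< {a} {o} {a′} {o′} o≤n a<a′ = begin-strict
    tableBase + a * (n + 1) + o        ≡⟨ +-assoc tableBase _ o ⟩
    tableBase + (a * (n + 1) + o)      <⟨ +-monoʳ-< tableBase
        (+-monoʳ-< (a * (n + 1)) (subst (o <_) (+-comm 1 n) (s≤s o≤n))) ⟩
    tableBase + (a * (n + 1) + (n + 1)) ≡⟨ cong (tableBase +_) (+-comm (a * (n + 1)) (n + 1)) ⟩
    tableBase + suc a * (n + 1)        ≤⟨ +-monoʳ-≤ tableBase (*-monoˡ-≤ (n + 1) a<a′) ⟩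
    tableBase + a′ * (n + 1)           ≤⟨ m≤m+n _ o′ ⟩
    place a′ o′                ∎
    where open ≤-Reasoning

  place-injective : ∀ {a o a′ o′} → o ≤ n → o′ ≤ n → place a o ≡ place a′ o′ → a ≡ a′ × o ≡ o′
  place-injective {a} {o} {a′} {o′} o≤n o′≤n p with <-cmp a a′
  ... | tri< q _ _ = ⊥-elim (<⇒≢ (place-< o≤n q) p)
  ... | tri> _ _ q = ⊥-elim (<⇒≢ (place-< o′≤n q) (sym p))
  ... | tri≈ _ refl _ = refl , +-cancelˡ-≡ (tableBase + a * (n + 1)) o o′ p

  -- The memory below the table, which the main loops read but never change.
  record Low (μ : Memory) : Set where
    field
      size     : μ 0 ≡ n
      limit    : μ 1 ≡ c
      matrix   : ∀ {j} → j < n * n → μ (2 + j) ≡ mat j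
      powers   : ∀ {v} → v ≤ n → μ (powerBase + v) ≡ 2 ^ v
  open Low

  V : Memory → ℕ → ℕ
  V μ a = μ (place a 0)

  blocks : Memory → ℕ → ℕ → ℕ
  blocks μ a v = μ (place a (suc v))

  power<tableBase : ∀ {v} → v ≤ n → powerBase + v < tableBase
  power<tableBase {v} v≤n = +-monoʳ-< powerBase (subst (v <_) (+-comm 1 n) (s≤s v≤n))

  tableBase<space : tableBase < space n
  tableBase<space = subst (_< space n) (trans (+-identityʳ _) (+-identityʳ _))
      (place< {0} {0} z≤n z≤n)

  Low-resp : ∀ {μ μ′} → (∀ {b} → b < tableBase → μ′ b ≡ μ b) → Low μ → Low μ′
  Low-resp same low = record
    { size   = trans (same (s≤s z≤n)) (size low)
    ; limit  = trans (same (s≤s (s≤s z≤n))) (limit low)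
    ; matrix = λ j<nn → trans (same (≤-trans (s≤s (s≤s j<nn)) (m≤m+n powerBase _)))
        (matrix low j<nn)
    ; powers = λ v≤n → trans (same (power<tableBase v≤n)) (powers low v≤n) }

  module Bounds where

    n-small : Small 1 n
    n-small = Small-≤ {1} {y = 2 ^ n} (<⇒≤ (m<2^m n))
        (^-monoʳ-< 2 ≤-refl (≤-reflexive (sym (+-identityʳ (suc n)))))
      where
      m<2^m : ∀ m → m < 2 ^ m
      m<2^m zero    = z<s
      m<2^m (suc m) = ≤-trans (s≤s (m<2^m m)) (≤-trans (≤-reflexive (+-comm 1 (2 ^ m)))
        (+-monoʳ-≤ (2 ^ m) (≤-trans (m^n>0 2 m) (m≤m+n _ 0))))

    n-≤-small : ∀ {v} → v ≤ n → Small 1 v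
    n-≤-small le = Small-≤ {1} le n-small

    pow-small : ∀ {v} → v ≤ n → Small 1 (2 ^ v)
    pow-small {v} v≤n = Small-≤ {1} (≤-2^ v≤n)
        (^-monoʳ-< 2 ≤-refl (≤-reflexive (sym (+-identityʳ (suc n)))))

    h≤n : h ≤ n
    h≤n = subst (h ≤_) (m*n/n≡m n 2) (aux n)
      where
      aux : ∀ n → (n + 1) / 2 ≤ n * 2 / 2
      aux zero    = z≤n
      aux (suc n) = /-monoˡ-≤ 2 (subst (_≤ suc n * 2) (+-comm 1 (suc n)) (s≤s (s≤s (m≤m*n n 2))))

    -- Equality occurs at the padding position, whose digit is computed with the stored power
    -- `2 ^ n`.
    2i<n : ∀ {i} → i < h → 2 * i + 1 ≤ n
    2i<n {i} i<h = s≤s⁻¹ (begin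
      suc (2 * i + 1)  ≡⟨ cong suc (+-comm (2 * i) 1) ⟩
      2 + 2 * i        ≡⟨ *-suc 2 i ⟨
      2 * suc i        ≤⟨ *-monoʳ-≤ 2 i<h ⟩
      2 * h            ≡⟨ *-comm 2 h ⟩
      h * 2            ≤⟨ m/n*n≤m (n + 1) 2 ⟩
      n + 1            ≡⟨ +-comm n 1 ⟩
      suc n            ∎)
      where
      open ≤-Reasoning

    hi≤n : ∀ g {i} → i < h → hi g i ≤ n
    hi≤n g {i} i<h = ≤-trans (+-monoʳ-≤ (2 * i) (s≤s⁻¹ (B₂.digit< g i))) (2i<n i<h)

    lo≤n : ∀ g {i} → i < h → lo g i ≤ n
    lo≤n g {i} i<h = ≤-trans (+-monoʳ-≤ (2 * i) (m∸n≤m 1 (bit g i))) (2i<n i<h)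

    h-small : Small 1 h
    h-small = n-≤-small h≤n

    M-small : Small 3 M
    M-small = Small-* {2} {1} (Small-* {1} {1} (pow-small h≤n) (pow-small h≤n)) (pow-small h≤n)

    Q-small : Small 2 Q
    Q-small = Small-* {1} {1} (pow-small ≤-refl) (pow-small ≤-refl)

    nn-small : Small 2 (n * n)
    nn-small = Small-* {1} {1} n-small n-small

    1-small : Small 1 1
    1-small = Small-const 1 ≤-refl

    longs≤ : ∀ φ → longs φ ≤ n * n
    longs≤ φ = subst (longs φ ≤_) (*-identityʳ (n * n)) (sum-≤ (n * n) 1 λ {j} j<nn →
      *-mono-≤ (*-mono-≤ (lt≤1 (row j) (col j)) (mat≤1 j<nn)) (lt≤1 1 ∣ φ (row j) - φ (col j) ∣))

    newLongs≤ : ∀ d → newLongs d ≤ n * n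
    newLongs≤ d = subst (newLongs d ≤_) (*-identityʳ (n * n)) (sum-≤ (n * n) 1 λ {j} j<nn →
      *-mono-≤ (*-mono-≤ (lt≤1 (row j) (col j)) (mat≤1 j<nn)) (eq≤1 (d (row j) * d (col j)) 3))

    sum01≤ : ∀ N {f} → (∀ i → f i ≤ 1) → sum N f ≤ N
    sum01≤ N {f} le = subst (sum N f ≤_) (*-identityʳ N) (sum-≤ N 1 λ {i} _ → le i)

  open Bounds

  module _ {σ : State 11} where

    nV : mem σ 0 ≡ n → Val 1 σ nE n
    nV p = cell (number 1) (≤-trans z<s (<⇒≤ tableBase<space)) p n-small

    baseV : mem σ 0 ≡ n → Val 3 σ baseE powerBase
    baseV p = number 2 `+ nV p `* nV p

    tableV : mem σ 0 ≡ n → Val 4 σ tableE tableBase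
    tableV p = baseV p `+ (nV p `+ number 1)

    hV : mem σ 0 ≡ n → Val 1 σ hE h
    hV p = exact 1 (evals ((nV p `+ number 1) `/ number 2)) h-small

    placeV : ∀ {a o e e′} → mem σ 0 ≡ n → a ≤ M → o ≤ n → σ ⊢ e ⇓ a → σ ⊢ e′ ⇓ o →
             Val 7 σ (placeE e e′) (place a o)
    placeV p a≤M o≤n va vo =
      tableV p `+ a `* (nV p `+ number 1) `+ o
      where
      a : Val 3 σ _ _
      a = va , Small-≤ {3} a≤M M-small
      o : Val 1 σ _ _
      o = vo , n-≤-small o≤n

    readV : ∀ {a o e e′ x} → mem σ 0 ≡ n → a ≤ M → o ≤ n → σ ⊢ e ⇓ a → σ ⊢ e′ ⇓ o →
            mem σ (place a o) ≡ x → σ ⊢ ⟦ placeE e e′ ⟧ ⇓ x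
    readV p a≤M o≤n va vo refl = read (evals (placeV p a≤M o≤n va vo)) (place< a≤M o≤n)

    sucV : ∀ {j} → j < n → regs σ zero ≡ j → Val 2 σ sucE (suc j)
    sucV j<n p = number 1 `+ register p (n-≤-small (<⇒≤ j<n))

    powV : ∀ {e v} → Low (mem σ) → σ ⊢ e ⇓ v → v ≤ n → Val 1 σ (powE e) (2 ^ v)
    powV {e} {v} low ve v≤n =
      cell {l = 1} (baseV (size low) `+ v′) (<-trans (power<tableBase v≤n) tableBase<space)
          (powers low v≤n) (pow-small v≤n)
      where
      v′ : Val 1 σ e v
      v′ = ve , n-≤-small v≤n

    QV : Low (mem σ) → Val 2 σ (powE nE ⟨ mul ⟩ powE nE) Q
    QV low = pw `* pw
      where pw = powV low (evals (nV (size low))) ≤-refl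

    cubeV : ∀ {e v} → Low (mem σ) → σ ⊢ e ⇓ v → v ≤ n → Val 3 σ (cubeE e) (2 ^ v * 2 ^ v * 2 ^ v)
    cubeV low ve v≤n = pw `* pw `* pw
      where pw = powV low ve v≤n

  module Relaxing {g s μ} {ρ : Fin 10 → ℕ} (low : Low μ) (inv : Inv g s (V μ) (blocks μ))
    (g< : g < 2 ^ h) (s<Q : s < Q) (ρg : ρ gᵣ ≡ g) (ρs : ρ sᵣ ≡ s) where

    open Relax inv s<Q

    viol ones rest cst test : ℕ
    viol = sum h (λ i → lt (d (hi g i)) (d (lo g i)))
    ones = count d 1
    rest = count d 0
    cst  = newLongs d
    test = eq viol 0 * (1 ∸ lt c ones) * lt 0 (ones + eq rest 0) * lt 0 val
           * lt 0 (eq (V μ old) 0 + lt (val + cst) (V μ old))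

    test⇒Valid : test ≢ 0 → Valid
    test⇒Valid ne₀ with *≢0 {b = lt 0 (eq (V μ old) 0 + lt (val + cst) (V μ old))} ne₀
    ... | ne₁ , better′ with *≢0 {b = lt 0 val} ne₁
    ... | ne₂ , reach with *≢0 {b = lt 0 (ones + eq rest 0)} ne₂
    ... | ne₃ , non with *≢0 {a = eq viol 0} {b = 1 ∸ lt c ones} ne₃
    ... | vi , fi = record
      { consistent = λ {i} i<h → ≮⇒≥ λ q → 1+n≢0
          (trans (sym (lt-yes q)) (sum-≡0 h (eq⇒≡ {viol} {0} vi) i<h))
      ; capacious = ≮⇒≥ λ q → fi (cong (1 ∸_) (lt-yes q))
      ; nonempty = nonempty′ (ones ≟ 0)
      ; reachable = lt⇒< reach
      ; better = better″ (V μ old ≟ 0) }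
      where
      nonempty′ : Dec (ones ≡ 0) → 0 < ones ⊎ rest ≡ 0
      nonempty′ (no p)  = inj₁ (≢0⇒>0 p)
      nonempty′ (yes p) with rest ≟ 0
      ... | yes q = inj₂ q
      ... | no  q = ⊥-elim (<-irrefl (sym (cong₂ _+_ p (eq-no {rest} {0} q)))
          (lt⇒< {0} {ones + eq rest 0} non))

      better″ : Dec (V μ old ≡ 0) → V μ old ≡ 0 ⊎ val + cst < V μ old
      better″ (yes p) = inj₁ p
      better″ (no p) with val + cst <? V μ old
      ... | yes q = inj₂ q
      ... | no  q = ⊥-elim (<-irrefl (sym (cong₂ _+_ (eq-no {V μ old} {0} p)
          (lt-no {val + cst} {V μ old} q))) (lt⇒< {0} {eq (V μ old) 0 + lt (val + cst) (V μ old)}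
          better′))

    Valid⇒test : Valid → test ≡ 1
    Valid⇒test valid = cong₂ _*_ (cong₂ _*_
        (cong₂ _*_ (cong₂ _*_ viol≡ (cong (1 ∸_) (lt-no (≤⇒≯ capacious)))) (lt-yes (some nonempty)))
        (lt-yes reachable)) (lt-yes (gain better))
      where
      open Valid valid
      viol≡ : eq viol 0 ≡ 1
      viol≡ = eq-yes (sum-zero h λ i<h → lt-no (≤⇒≯ (consistent i<h)))

      some : 0 < ones ⊎ rest ≡ 0 → 0 < ones + eq rest 0
      some (inj₁ p) = ≤-trans p (m≤m+n ones _)
      some (inj₂ p) = subst (λ x → 0 < ones + x) (sym (eq-yes p)) (m≤n+m 1 ones)

      gain : V μ old ≡ 0 ⊎ val + cst < V μ old → 0 < eq (V μ old) 0 + lt (val + cst) (V μ old)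
      gain (inj₁ p) = subst (λ x → 0 < x + lt (val + cst) (V μ old)) (sym (eq-yes p)) z<s
      gain (inj₂ p) = subst (λ x → 0 < eq (V μ old) 0 + x) (sym (lt-yes p)) (m≤n+m 1 _)

    ρ₁ ρ₂ ρ₃ ρ₄ ρ₅ ρ₆ ρ₇ ρ₈ : Fin 10 → ℕ
    ρ₁ = ρ ⟪ τᵣ ≔ τ ⟫
    ρ₂ = ρ₁ ⟪ onesᵣ ≔ ones ⟫
    ρ₃ = ρ₂ ⟪ restᵣ ≔ rest ⟫
    ρ₄ = ρ₃ ⟪ violᵣ ≔ viol ⟫
    ρ₅ = ρ₄ ⟪ oldᵣ ≔ old ⟫
    ρ₆ = ρ₅ ⟪ newᵣ ≔ new ⟫
    ρ₇ = ρ₆ ⟪ longᵣ ≔ cst ⟫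
    ρ₈ = ρ₇ ⟪ valᵣ ≔ val ⟫

    ones-small : Small 1 ones
    ones-small = n-≤-small (sum01≤ n λ i → eq≤1 (d i) 1)

    rest-small : Small 1 rest
    rest-small = n-≤-small (sum01≤ n λ i → eq≤1 (d i) 0)

    viol-small : Small 1 viol
    viol-small = n-≤-small (≤-trans (sum01≤ h λ i → lt≤1 (d (hi g i)) (d (lo g i))) h≤n)

    old-small : Small 3 old
    old-small = Small-≤ {3} (<⇒≤ old<M) M-small

    new-small : Small 3 new
    new-small = Small-≤ {3} (<⇒≤ new<M) M-small

    cst-small : Small 2 cst
    cst-small = Small-≤ {2} (newLongs≤ d) nn-small

    -- Values are read before the step is known to be valid, so the bound has to hold at every
    -- address.
    V-small : ∀ {a} → a ≤ M → Small 3 (V μ a)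
    V-small a≤M = Small-≤ {3} (V-bound inv longs≤ a≤M) (Small-+ {1} {2} 1-small nn-small)

    val-small : Small 5 val
    val-small = Small-+ {1} {4} (Small-bit {σ = ⟨ (λ (_ : Fin 11) → 0) , μ ⟩} (eq≤1 rest 0))
      (Small-* {1} {3} (Small-bit {σ = ⟨ (λ (_ : Fin 11) → 0) , μ ⟩} (lt≤1 0 rest))
          (V-small (<⇒≤ new<M)))

    module _ {σ : State 11} {ρ′ : Fin 10 → ℕ} (at : At μ ρ′ σ) where

      low′ : Low (mem σ)
      low′ = subst Low (sym (memory at)) low

      n≡ : mem σ 0 ≡ n
      n≡ = size low′

      varV : ∀ k x {v} → ρ′ x ≡ v → Small k v → Val k σ (var x) v
      varV k x p = register (trans (registers at x) p)

      var⇓ : ∀ x {v} → ρ′ x ≡ v → σ ⊢ var x ⇓ v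
      var⇓ x p = subst (σ ⊢ var x ⇓_) (trans (registers at x) p) reg

      module _ (ρτ : ρ′ τᵣ ≡ τ) where

        digV : ∀ {e v} → σ ⊢ e ⇓ v → v ≤ n → Val 2 σ (digE e) (d v)
        digV ve v≤n = varV 2 τᵣ ρτ (Small-≤ {2} (m∸n≤m Q (1 + s)) Q-small) `/ (pw `* pw) `% number 3
          where pw = powV low′ ve v≤n

        module _ (ρg′ : ρ′ gᵣ ≡ g) {j} (j<h : j < h) (ij : regs σ zero ≡ j) where

          private
            iV : Val 1 σ iE j
            iV = register ij (n-≤-small (≤-trans (<⇒≤ j<h) h≤n))

            bitV : Val 1 σ (bitE iE) (bit g j)
            bitV = varV 1 gᵣ ρg′ (Small-≤ {1} (<⇒≤ g<) (pow-small h≤n)) `/ powV low′ (evals iV)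
                (≤-trans (<⇒≤ j<h) h≤n) `% number 2

          hiV : Val 4 σ (hiE) (hi g j)
          hiV = number 2 `* iV `+ bitV

          loV : Val 4 σ (loE) (lo g j)
          loV = number 2 `* iV `+ (number 1 `- bitV)

          digHi : Val 2 σ (digE hiE) (d (hi g j))
          digHi = digV (evals hiV) (hi≤n g j<h)

          digLo : Val 2 σ (digE loE) (d (lo g j))
          digLo = digV (evals loV) (lo≤n g j<h)

          violV : Val 1 σ violE (lt (d (hi g j)) (d (lo g j)))
          violV = `less (evals digHi) (evals digLo)

          cube₁ : Val 3 σ (cubeE iE) (2 ^ j * 2 ^ j * 2 ^ j)
          cube₁ = cubeV low′ (evals iV) (≤-trans (<⇒≤ j<h) h≤n)

          oldV : Val 8 σ oldE (2 ^ j * 2 ^ j * 2 ^ j * pair g (past d) j)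
          oldV = cube₁ `* (number 2 `* (digHi `- number 1) `+ (digLo `- number 1))

          newV : Val 8 σ newE (2 ^ j * 2 ^ j * 2 ^ j * pair g (next d) j)
          newV = cube₁ `* (number 2 `* (digHi `- (digHi `/ number 2)) `+
              (digLo `- (digLo `/ number 2)))

        module _ {j} (j<n : j < n) (ij : regs σ zero ≡ j) where

          digI : Val 2 σ (digE iE) (d j)
          digI = digV (subst (σ ⊢ iE ⇓_) ij reg) (<⇒≤ j<n)

        longV : ∀ {j} → j < n * n → regs σ zero ≡ j → σ ⊢ longE ⇓ lt (row j) (col j) * mat j * eq
            (d (row j) * d (col j)) 3
        longV {j} j<nn ij = evals (
          `less (evals rowV) (evals colV)
          `* cell {l = 1} (number 2 `+ iV)
              (≤-<-trans (≤-trans (+-monoʳ-≤ 2 (<⇒≤ j<nn)) (m≤m+n powerBase _)) tableBase<space)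
              (matrix low′ j<nn)
               (Small-bit {σ = σ} (mat≤1 j<nn))
          `* `equal (evals (digV (evals rowV) (<⇒≤ (row< j<nn)) `* digV (evals colV)
              (<⇒≤ (col< j<nn)))) (evals (number 2 {3})))
          where
          iV : Val 2 σ iE j
          iV = register ij (Small-≤ {2} (<⇒≤ j<nn) nn-small)
          rowV : Val 2 σ rowE (row j)
          rowV = iV `/ nV n≡
          colV : Val 2 σ colE (col j)
          colV = iV `% nV n≡

      valV : ρ′ restᵣ ≡ rest → ρ′ newᵣ ≡ new → σ ⊢ valE ⇓ val
      valV p q = evals (`equal (var⇓ restᵣ p) (evals (number 1 {0})) `+
        (`less (evals (number 1 {0})) (var⇓ restᵣ p) `*
         exact 3 (readV n≡ (<⇒≤ new<M) z≤n (var⇓ newᵣ q) (evals (number 1))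
             (cong-app (memory at) _)) (V-small (<⇒≤ new<M))))

    module _ {σ : State 11} (at : At μ ρ₈ σ) where

      oldV⇓ : σ ⊢ valueE (var oldᵣ) ⇓ V μ old
      oldV⇓ = readV (n≡ at) (<⇒≤ old<M) z≤n (var⇓ at oldᵣ refl) (evals (number 1))
          (cong-app (memory at) _)

      candV : Val 6 σ (var valᵣ ⟨ add ⟩ var longᵣ) (val + cst)
      candV = varV at 5 valᵣ refl val-small `+ varV at 2 longᵣ refl cst-small

      cE⇓ : σ ⊢ cE ⇓ c
      cE⇓ = subst (σ ⊢ cE ⇓_) (limit (low′ at))
          (read (evals (number 1)) (<-trans (s≤s (s≤s z≤n)) tableBase<space))

      testV : σ ⊢ testE ⇓ test
      testV = evals (
        `equal (var⇓ at violᵣ refl) (evals (number 1 {0}))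
        `* (number 1 `- `less cE⇓ (var⇓ at onesᵣ refl))
        `* `less (evals (number 1 {0}))
            (evals (varV at 1 onesᵣ refl ones-small `+ `equal (var⇓ at restᵣ refl)
            (evals (number 1 {0}))))
        `* `less (evals (number 1 {0})) (var⇓ at valᵣ refl)
        `* `less (evals (number 1 {0})) (evals (`equal oldV⇓ (evals (number 1 {0})) `+ `less
            (evals candV) oldV⇓)))

    Done : State 11 → Set
    Done σ = regs σ (suc gᵣ) ≡ g × regs σ (suc sᵣ) ≡ s × Low (mem σ) × Inv g (suc s) (V (mem σ))
        (blocks (mem σ))

    module _ (valid : Valid) {σ : State 11} (at : At μ ρ₈ σ) where

      private
        open Accept valid
        open Update

        A X : ℕ → ℕ
        A j = place old (suc j)
        X j = eq (d j) 0 * blocks μ new j + eq (d j) 0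

        μ₁ : Memory
        μ₁ = mem σ [ place old 0 ↦ val + cst ]

        old≤M : old ≤ M
        old≤M = <⇒≤ old<M

        untouched : ∀ {j μ₂ b} → Filled A X j μ₁ μ₂ → b ≢ place old 0 → (∀ {i} → i < j → b ≢ A i) →
            μ₂ b ≡ μ b
        untouched fl p q = trans (others fl q) (trans (↦-miss (mem σ) p) (cong-app (memory at) _))

        low-kept : ∀ {j μ₂} → Filled A X j μ₁ μ₂ → Low μ₂
        low-kept fl = Low-resp (λ b<T → untouched fl
            (λ p → <⇒≱ b<T (subst (tableBase ≤_) (sym p) (place≥tableBase old 0)))
          (λ {i} _ p → <⇒≱ b<T (subst (tableBase ≤_) (sym p) (place≥tableBase old (suc i))))) low

        finish : ∀ {μ₂} → Filled A X n μ₁ μ₂ → Inv g (suc s) (V μ₂) (blocks μ₂)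
        finish {μ₂} fl = accept V-old V-other B-old B-other
          where
          V-old : V μ₂ old ≡ val + cst
          V-old = trans (others fl λ i<n p → 0≢1+n
              (proj₂ (place-injective {old} {0} {old} z≤n i<n p))) (↦-hit (mem σ))

          V-other : ∀ {a} → a ≢ old → V μ₂ a ≡ V μ a
          V-other ne = untouched fl (λ p → ne (proj₁ (place-injective z≤n z≤n p)))
            (λ i<n p → ne (proj₁ (place-injective z≤n i<n p)))

          B-old : ∀ {v} → v < n → blocks μ₂ old v ≡ X v
          B-old = filled fl

          B-other : ∀ {a v} → a ≢ old → v < n → blocks μ₂ a v ≡ blocks μ a v
          B-other ne v<n = untouched fl (λ p → ne (proj₁ (place-injective v<n z≤n p)))
            (λ i<n p → ne (proj₁ (place-injective v<n i<n p)))

      run-update : Runs σ update updateTime Done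
      run-update =
        run-write {Q = λ σ′ → σ′ ≈ ρ₈ × mem σ′ ≡ μ₁}
          (evals (placeV (n≡ at) old≤M z≤n (var⇓ at oldᵣ refl) (evals (number 1))))
          (place< {old} old≤M z≤n) (evals (candV at)) (registers at , refl) >>
        λ { (r , refl) → run-map
          (run-fill {ρ = ρ₈} nE (placeE (var oldᵣ) sucE) blockE A X {n} {1} _ _ n-small
            (λ i<n j<n p → suc-injective (proj₂ (place-injective {old} {_} {old} i<n j<n p)))
            (λ _ _ fl → evals (nV (size (low-kept fl))))
            next-cell r)
          λ { (r′ , fl) → trans (r′ gᵣ) ρg , trans (r′ sᵣ) ρs , low-kept fl , finish fl } }
        where
        next-cell : ∀ {σ′ j} → j < n → σ′ ≈ ρ₈ → regs σ′ zero ≡ j → Filled A X j μ₁ (mem σ′) →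
                    (σ′ ⊢ placeE (var oldᵣ) sucE ⇓ A j) × A j < space n × (σ′ ⊢ blockE ⇓ X j)
        next-cell {σ′} {j} j<n r ij fl =
          evals (placeV (size lowσ′) old≤M j<n (subst (σ′ ⊢ var oldᵣ ⇓_) (r oldᵣ) reg) sucj) ,
          place< {old} old≤M j<n ,
          -- Only the product is known to be small, since the word read may be arbitrary where the
          -- digit is not 0.
          evals (exact 2 (op mul (evals isZero) tailV (word {2} {eq (d j) 0 * blocks μ new j}
              (s≤s (s≤s z≤n)) small-block)) small-block `+ isZero)
          where
          lowσ′ : Low (mem σ′)
          lowσ′ = low-kept fl

          sucj : σ′ ⊢ sucE ⇓ suc j
          sucj = evals (sucV j<n ij)

          τV : Val 2 σ′ (var τᵣ) τ
          τV = register (r τᵣ) (Small-≤ {2} (m∸n≤m Q (1 + s)) Q-small)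

          isZero : Val 1 σ′ (digE iE ⟨ equal ⟩ lit 0) (eq (d j) 0)
          isZero = `equal (evals (τV `/ (pw `* pw) `% number 3)) (evals (number 1 {0}))
            where pw = powV lowσ′ (subst (σ′ ⊢ iE ⇓_) ij reg) (<⇒≤ j<n)

          tailV : σ′ ⊢ ⟦ placeE (var newᵣ) sucE ⟧ ⇓ blocks μ new j
          tailV = readV (size lowσ′) (<⇒≤ new<M) j<n (subst (σ′ ⊢ var newᵣ ⇓_) (r newᵣ) reg) sucj
            -- The rows `old` and `new` can coincide, for instance if all digits are 3; even then
            -- index `j` is read before it is overwritten.
            (untouched fl (λ p → 0≢1+n (sym (proj₂ (place-injective {new} {suc j} {old} {0} j<n z≤n
                p))))
              (λ i<j p → <⇒≢ i<j (sym (suc-injective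
                  (proj₂ (place-injective {new} {suc j} {old} j<n (<-trans i<j j<n) p))))))

          small-block : Small 2 (eq (d j) 0 * blocks μ new j)
          small-block = Small-≤ {2} (≤-trans (block≤s j<n) (<⇒≤ s<Q)) Q-small

    run-relax : ∀ {σ} → At μ ρ σ → Runs σ relax relaxTime Done
    run-relax at =
      run-set at (evals (QV (low′ at) `- (number 1 `+ varV at 2 sᵣ ρs
          (Small-≤ {2} (<⇒≤ s<Q) Q-small)))) >> λ at₁ →
      run-sum onesᵣ nE onesE (λ i → eq (d i) 1) {k = 1} {1} _ _ _ n-small ones-small
        (λ at′ → evals (nV (n≡ at′)))
        (λ j<n at′ ij → evals (`equal (evals (digI at′ refl j<n ij)) (evals (number 1 {1})))) at₁ >>
            λ at₂ →
      run-sum restᵣ nE restE (λ i → eq (d i) 0) {k = 1} {1} _ _ _ n-small rest-small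
        (λ at′ → evals (nV (n≡ at′)))
        (λ j<n at′ ij → evals (`equal (evals (digI at′ refl j<n ij)) (evals (number 1 {0})))) at₂ >>
            λ at₃ →
      run-sum violᵣ hE violE (λ i → lt (d (hi g i)) (d (lo g i))) {k = 1} {1} _ _ _ h-small
          viol-small
        (λ at′ → evals (hV (n≡ at′)))
        (λ j<h at′ ij → evals (violV at′ refl ρg j<h ij)) at₃ >> λ at₄ →
      run-sum oldᵣ hE oldE (λ i → 2 ^ i * 2 ^ i * 2 ^ i * pair g (past d) i) {k = 1} {3} _ _ _
          h-small old-small
        (λ at′ → evals (hV (n≡ at′)))
        (λ j<h at′ ij → evals (oldV at′ refl ρg j<h ij)) at₄ >> λ at₅ →
      run-sum newᵣ hE newE (λ i → 2 ^ i * 2 ^ i * 2 ^ i * pair g (next d) i) {k = 1} {3} _ _ _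
          h-small new-small
        (λ at′ → evals (hV (n≡ at′)))
        (λ j<h at′ ij → evals (newV at′ refl ρg j<h ij)) at₅ >> λ at₆ →
      run-sum longᵣ (nE ⟨ mul ⟩ nE) longE (λ j → lt (row j) (col j) * mat j * eq
          (d (row j) * d (col j)) 3)
        {k = 2} {2} _ _ _ nn-small cst-small
        (λ at′ → evals (nV (n≡ at′) `* nV (n≡ at′)))
        (λ j<nn at′ ij → longV at′ refl j<nn ij) at₆ >> λ at₇ →
      run-set at₇ (valV at₇ refl refl) >> λ at₈ →
      run-cond (testV at₈)
        (λ ne → run-update (test⇒Valid ne) at₈)
        (λ z → run-≤ (s≤s z≤n) (run-skip (trans (registers at₈ gᵣ) ρg , trans (registers at₈ sᵣ) ρs
            , low′ at₈ ,
          subst (λ μ′ → Inv g (suc s) (V μ′) (blocks μ′)) (sym (memory at₈))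
            (reject λ valid → 0≢1+n (trans (sym z) (Valid⇒test valid))))))

  here : ∀ (σ : State 11) → At {10} (mem σ) (λ y → regs σ (suc y)) σ
  here σ = refl , λ _ → refl

  run-guess : ∀ {g σ} → g < 2 ^ h → regs σ (suc gᵣ) ≡ g →
              Low (mem σ) → StartEntry (V (mem σ)) (blocks (mem σ)) → Searched g (V (mem σ)) →
              Runs σ guess guessTime (λ σ′ → regs σ′ (suc gᵣ) ≡ g × Low (mem σ′) ×
                StartEntry (V (mem σ′)) (blocks (mem σ′)) × Searched (suc g) (V (mem σ′)))
  run-guess {g} {σ} g< gr low st se =
    run-fill {ρ = λ y → regs σ (suc y)} (cubeE hE) (placeE sucE (lit 0)) (lit 0) A (const 0) {M} {3}
        _ _ M-small
      (λ _ _ p → suc-injective (proj₁ (place-injective z≤n z≤n p)))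
      (λ _ _ fl → evals (cubeV (low-kept fl) (evals (hV (size (low-kept fl)))) h≤n))
      clear-cell (λ _ → refl) >>
    λ { (r , fl) → run-map
          (run-for (suc sᵣ) (powE nE ⟨ mul ⟩ powE nE) relax I {Q} {relaxTime} {2} _ _ Q-small
            (λ _ (_ , low , _) → evals (QV low)) round
            (trans (r gᵣ) gr , low-kept fl , cleared fl))
          λ { (gr′ , low′ , inv) → gr′ , low′ , start inv , Inv-final inv } }
    where
    A : ℕ → ℕ
    A j = place (suc j) 0

    low-kept : ∀ {j μ′} → Filled A (const 0) j (mem σ) μ′ → Low μ′
    low-kept fl = Low-resp (λ b<T → others fl λ {i} _ p → <⇒≱ b<T (subst (tableBase ≤_) (sym p)
        (place≥tableBase (suc i) 0))) low

    clear-cell : ∀ {σ′ j} → j < M → σ′ ≈ (λ y → regs σ (suc y)) → regs σ′ zero ≡ j →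
                 Filled A (const 0) j (mem σ) (mem σ′) →
                 (σ′ ⊢ placeE sucE (lit 0) ⇓ A j) × A j < space n × (σ′ ⊢ lit 0 ⇓ 0)
    clear-cell {σ′} {j} j<M _ ij fl =
      evals (placeV (size (low-kept fl)) j<M z≤n
        (evals (number 1 `+ register {k = 3} ij (Small-≤ {3} (<⇒≤ j<M) M-small)))
            (evals (number 1))) ,
      place< {suc j} j<M z≤n , evals (number 1)

    cleared : ∀ {μ′} → Filled A (const 0) M (mem σ) μ′ → Inv g 0 (V μ′) (blocks μ′)
    cleared {μ′} fl = Inv-init (start′ st)
      (λ p φ good s ord → subst (λ x → Within x (longs φ)) (sym V0) (se p φ good s ord))
      λ { {suc a} _ a<M → filled fl a<M }
      where
      V0 : V μ′ 0 ≡ V (mem σ) 0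
      V0 = others fl λ {i} _ p → 0≢1+n (proj₁ (place-injective {0} {0} {suc i} z≤n z≤n p))

      start′ : StartEntry (V (mem σ)) (blocks (mem σ)) → StartEntry (V μ′) (blocks μ′)
      start′ (inj₁ p) = inj₁ (trans V0 p)
      start′ (inj₂ (φ , e , s)) = inj₂ (φ , record
        { good = good e ; value = trans V0 (value e) ; bound = bound e
        ; index = λ {v} v<n → trans (others fl λ {i} _ p → 0≢1+n
            (proj₁ (place-injective {0} {suc v} {suc i} v<n z≤n p))) (index e v<n) } , s)

    I : ℕ → State 11 → Set
    I s σ = regs σ (suc gᵣ) ≡ g × Low (mem σ) × Inv g s (V (mem σ)) (blocks (mem σ))

    round : ∀ {σ s} → s < Q → regs σ (suc sᵣ) ≡ s → I s σ →
            Runs σ relax relaxTime (λ σ′ → regs σ′ (suc sᵣ) ≡ s × I (suc s)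
                (setReg σ′ (suc sᵣ) (suc s)))
    round {σ} s<Q sr (gr′ , low , inv) = run-map
      (Relaxing.run-relax {ρ = λ y → regs σ (suc y)} low inv g< s<Q gr′ sr (here σ))
      λ { (gr″ , sr″ , low″ , inv″) → sr″ , gr″ , low″ , inv″ }

  run-initialise : ∀ {σ} → mem σ 0 ≡ n → mem σ 1 ≡ c → (∀ {j} → j < n * n → mem σ (2 + j) ≡ mat j) →
                   Runs σ initialise initTime (λ σ′ → Low (mem σ′) × V (mem σ′) 0 ≡ 0)
  run-initialise {σ} size₀ limit₀ matrix₀ =
    run-write {Q = λ σ′ → mem σ′ ≡ μ₁} (evals (baseV size₀)) (≤-<-trans (m≤m+n powerBase _)
        tableBase<space) (evals (number 1)) refl >>
    λ { {σ₁} refl → run-fill {ρ = λ y → regs σ₁ (suc y)} nE (baseE ⟨ add ⟩ sucE)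
        (lit 2 ⟨ mul ⟩ powE iE) A X {n} {1} _ _ n-small
      (λ _ _ p → suc-injective (+-cancelˡ-≡ powerBase _ _ p))
      (λ _ _ fl → evals (nV (size-kept fl)))
      (power-cell {σ₁}) (λ _ → refl) >>
    λ { {σ₂} (_ , fl) → run-write (evals (placeV (size-kept fl) z≤n z≤n (evals (number 1))
        (evals (number 1))))
          (place< {0} z≤n z≤n) (evals (number 1))
          (Low-resp (λ b<T → ↦-miss (mem σ₂) λ p → <⇒≱ b<T (subst (tableBase ≤_) (sym p)
              (place≥tableBase 0 0))) (low fl) , ↦-hit (mem σ₂)) } }
    where
    A X : ℕ → ℕ
    A j = powerBase + suc j
    X j = 2 ^ suc j

    μ₁ : Memory
    μ₁ = mem σ [ powerBase ↦ 1 ]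

    input-kept : ∀ {j μ′ b} → Filled A X j μ₁ μ′ → b < powerBase → μ′ b ≡ mem σ b
    input-kept fl b<B = trans (others fl λ _ p → <⇒≱ b<B (subst (powerBase ≤_) (sym p)
        (m≤m+n powerBase _))) (↦-miss (mem σ) (<⇒≢ b<B))

    size-kept : ∀ {j μ′} → Filled A X j μ₁ μ′ → μ′ 0 ≡ n
    size-kept fl = trans (input-kept fl z<s) size₀

    power : ∀ {j μ′} → Filled A X j μ₁ μ′ → ∀ {v} → v ≤ j → μ′ (powerBase + v) ≡ 2 ^ v
    power {μ′ = μ′} fl {zero} _ = trans (cong μ′ (+-identityʳ powerBase))
      (trans (others fl λ {i} _ p → 0≢1+n (+-cancelˡ-≡ powerBase 0 (suc i)
          (trans (+-identityʳ powerBase) p))) (↦-hit (mem σ)))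
    power fl {suc v} v<j = filled fl v<j

    low : ∀ {μ′} → Filled A X n μ₁ μ′ → Low μ′
    low fl = record
      { size = size-kept fl
      ; limit = trans (input-kept fl (s≤s z<s)) limit₀
      ; matrix = λ j<nn → trans (input-kept fl (s≤s (s≤s j<nn))) (matrix₀ j<nn)
      ; powers = power fl }

    power-cell : ∀ {σ₁ σ′ : State 11} {j} → j < n → σ′ ≈ (λ y → regs σ₁ (suc y)) → regs σ′ zero ≡ j
        →
                 Filled A X j μ₁ (mem σ′) →
                 (σ′ ⊢ baseE ⟨ add ⟩ sucE ⇓ A j) × A j < space n × (σ′ ⊢ lit 2 ⟨ mul ⟩ powE iE ⇓ X
                     j)
    power-cell {σ′ = σ′} {j} j<n _ ij fl =
      evals (baseV (size-kept fl) `+ sucV j<n ij) , <-trans (power<tableBase j<n) tableBase<space ,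
      -- The power being doubled was written in the preceding round, or before the loop if `j` is 0.
      evals (number 2 `* cell {l = 1} (baseV (size-kept fl) `+ iV)
          (<-trans (power<tableBase (<⇒≤ j<n)) tableBase<space) (power fl ≤-refl)
          (pow-small (<⇒≤ j<n)))
      where
      iV : Val 1 σ′ iE j
      iV = register ij (n-≤-small (<⇒≤ j<n))

  Written : (ℕ → ℕ) → Memory → Set
  Written f μ = μ 0 ≡ top n f × (∀ {v} → v < n → μ (suc v) ≡ f v)

  run-output : ∀ {σ} → Low (mem σ) → (∀ {v} → v < n → blocks (mem σ) 0 v ≤ Q) →
               Runs σ output outputTime (λ σ′ → Written (blocks (mem σ) 0) (mem σ′))
  run-output {σ} low f≤Q =
    run-accumulate {ρ = λ y → regs σ (suc y)} valᵣ nE topE (λ j → top j f) refl {n} {1} _ _ n-small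
      (λ at → evals (nV (size (low′ at)))) next-top (here σ) >>
    λ { {σ₁} at → run-fill {ρ = λ y → regs σ₁ (suc y)} nE sucE ⟦ placeE (lit 0) sucE ⟧ suc f {n} {1}
        _ _ n-small
      (λ _ _ → suc-injective)
      (λ _ _ fl → evals (nV (trans (others fl λ _ ()) (size (low′ at)))))
      (λ {σ′} {j} j<n _ ij fl → evals (sucV j<n ij) ,
        ≤-<-trans (≤-trans j<n (≤-trans (m≤n+m n _) (≤-reflexive (cong (powerBase +_) refl))))
            (powerBase+n<space) ,
        readV (trans (others fl λ _ ()) (size (low′ at))) z≤n j<n (evals (number 1))
            (evals (sucV j<n ij))
          -- The output cells lie below the table, so the row being copied is intact.
          (trans (others fl λ {i} i<j p → <⇒≱ (≤-trans (s≤s (<-trans i<j j<n)) n<tableBase)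
              (≤-trans (place≥tableBase 0 (suc j)) (≤-reflexive p)))
                 (cong-app (memory at) _)))
      (λ _ → refl) >>
    λ { {σ₂} (r , fl) → run-write (evals (number 1)) (<-trans z<s tableBase<space)
      (subst (σ₂ ⊢ var valᵣ ⇓_) (trans (r valᵣ) (trans (registers at valᵣ) refl)) reg)
      (↦-hit (mem σ₂) {0} , λ {v} v<n → trans (↦-miss (mem σ₂) {0} {top n f} {suc v} (λ ()))
          (filled fl v<n)) } }
    where
    f : ℕ → ℕ
    f = blocks (mem σ) 0

    low′ : ∀ {ρ σ′} → At (mem σ) ρ σ′ → Low (mem σ′)
    low′ at = subst Low (sym (memory at)) low

    powerBase+n<space : powerBase + n < space n
    powerBase+n<space = <-trans (power<tableBase ≤-refl) tableBase<space

    n<tableBase : suc n ≤ tableBase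
    n<tableBase = ≤-trans (≤-reflexive (+-comm 1 n)) (m≤n+m (n + 1) powerBase)

    f-small : ∀ {j} → j < n → Small 2 (f j)
    f-small j<n = Small-≤ {2} (f≤Q j<n) Q-small

    top-small : ∀ {j} → j ≤ n → Small 4 (top j f)
    top-small {j} j≤n = Small-≤ {4} (top-≤ j (suc Q) λ i<j → s≤s (f≤Q (<-≤-trans i<j j≤n)))
      (Small-+ {1} {3} 1-small (Small-mono {2} {3} (n≤1+n 2) Q-small))

    next-top : ∀ {σ′ j} → j < n → At (mem σ) ((λ y → regs σ (suc y)) ⟪ valᵣ ≔ top j f ⟫) σ′ → regs
        σ′ zero ≡ j →
               σ′ ⊢ topE ⇓ top (suc j) f
    next-top {σ′} {j} j<n at ij = evals (tV `+ (exact 2 fV (f-small j<n) `+ number 1 `- tV))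
      where
      tV : Val 4 σ′ (var valᵣ) (top j f)
      tV = register (registers at valᵣ) (top-small (<⇒≤ j<n))

      fV : σ′ ⊢ ⟦ placeE (lit 0) sucE ⟧ ⇓ f j
      fV = readV (size (low′ at)) z≤n j<n (evals (number 1)) (evals (sucV j<n ij))
          (cong-app (memory at) _)

  Outcome : Memory → Set
  Outcome μ = (∀ φ → Good φ → ¬ Start φ) ⊎
    ∃[ φ ] Good φ × Start φ × (∀ ψ → Good ψ → Start ψ → longs φ ≤ longs ψ) × Written (λ v → φ v ∸ 2)
        μ

  run-program : ∀ {σ} → mem σ 0 ≡ n → mem σ 1 ≡ c → (∀ {j} → j < n * n → mem σ (2 + j) ≡ mat j) →
                Runs σ program time (λ σ′ → Outcome (mem σ′))
  run-program size₀ limit₀ matrix₀ =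
    run-initialise size₀ limit₀ matrix₀ >> λ { (low , V0) →
    run-for (suc gᵣ) (powE hE) guess I {2 ^ h} {guessTime} {1} _ _ (pow-small h≤n)
      (λ _ (low , _) → evals (powV low (evals (hV (size low))) h≤n))
      (λ g< gr (low , st , se) → run-guess g< gr low st se)
      (low , inj₁ V0 , λ ()) >> λ { {σ} (low , st , se) →
    run-cond (readV (size low) z≤n z≤n (evals (number 1)) (evals (number 1)) refl)
      (λ ne → found low se ne st)
      (λ z → run-≤ (s≤s z≤n) (run-skip (inj₁ (none {σ} se z)))) } }
    where
    I : ℕ → State 11 → Set
    I g σ = Low (mem σ) × StartEntry (V (mem σ)) (blocks (mem σ)) × Searched g (V (mem σ))

    -- Any such `φ` obeys some guess, and the search under that guess would have made the value at
    -- address 0 positive.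
    none : ∀ {σ} → Searched (2 ^ h) (V (mem σ)) → V (mem σ) 0 ≡ 0 → ∀ φ → Good φ → ¬ Start φ
    none {σ} se z φ good start = let (g , g< , ord) = Ordered-guess φ in
      >0⇒≢0 (proj₁ (se g< φ good start ord)) z

    found : ∀ {σ} → Low (mem σ) → Searched (2 ^ h) (V (mem σ)) → V (mem σ) 0 ≢ 0 →
            StartEntry (V (mem σ)) (blocks (mem σ)) → Runs σ output outputTime
                (λ σ′ → Outcome (mem σ′))
    found _ _ ne (inj₁ z) = ⊥-elim (ne z)
    found {σ} low se ne (inj₂ (φ , e , start)) =
      run-map (run-output low λ v<n → subst (_≤ Q) (sym (index e v<n)) (∸-monoˡ-≤ 2 (bound e v<n)))
          (λ {σ′} → outcome {mem σ′})
      where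
      best : ∀ ψ → Good ψ → Start ψ → longs φ ≤ longs ψ
      best ψ good′ start′ = let (g , g< , ord) = Ordered-guess ψ in
        s≤s⁻¹ (subst (_≤ suc (longs ψ)) (value e) (proj₂ (se g< ψ good′ start′ ord)))

      outcome : ∀ {μ} → Written (blocks (mem σ) 0) μ → Outcome μ
      outcome (w₀ , w₊) = inj₂ (φ , good e , start , best ,
        trans w₀ (top-cong n (index e)) , λ v<n → trans (w₊ v<n) (index e v<n))

-- Graphs and bucket arrangements

indicator : ∀ {p} {P : Set p} → Dec P → ℕ
indicator d = if does d then 1 else 0

indicator-yes : ∀ {p} {P : Set p} (d : Dec P) → P → indicator d ≡ 1
indicator-yes (yes _) _ = refl
indicator-yes (no ¬p) p = ⊥-elim (¬p p)

indicator-no : ∀ {p} {P : Set p} (d : Dec P) → ¬ P → indicator d ≡ 0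
indicator-no (yes p) ¬p = ⊥-elim (¬p p)
indicator-no (no _)  _  = refl

total : ∀ {A : Set} → (A → ℕ) → List A → ℕ
total f xs = ListAction.sum (List.map f xs)

-- `longEdges` counts by nested filters, the program by adding products of bits.
length-filters : ∀ {A : Set} {P Q : Pred A 0ℓ} (P? : Decidable P) (Q? : Decidable Q) xs →
                 length (filter P? (filter Q? xs)) ≡ total (λ x → indicator (Q? x) * indicator
                     (P? x)) xs
length-filters P? Q? [] = refl
length-filters P? Q? (x ∷ xs) with does (Q? x)
... | false = length-filters P? Q? xs
... | true with does (P? x)
...   | false = length-filters P? Q? xs
...   | true  = cong suc (length-filters P? Q? xs)

total-++ : ∀ {A : Set} (f : A → ℕ) xs ys → total f (xs List.++ ys) ≡ total f xs + total f ys
total-++ f []       ys = refl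
total-++ f (x ∷ xs) ys = trans (cong (f x +_) (total-++ f xs ys)) (sym (+-assoc (f x) _ _))

total-product : ∀ {A B : Set} (f : A × B → ℕ) xs ys →
                total f (cartesianProduct xs ys) ≡ total (λ x → total (λ y → f (x , y)) ys) xs
total-product f []       ys = refl
total-product f (x ∷ xs) ys = trans (total-++ f (List.map (x ,_) ys) (cartesianProduct xs ys))
  (cong₂ _+_ (cong ListAction.sum (sym (List.map-∘ ys))) (total-product f xs ys))

total-allFin : ∀ n {f : Fin n → ℕ} {g : ℕ → ℕ} → (∀ u → f u ≡ g (toℕ u)) → total f (allFin n) ≡ sum
    n g
total-allFin n eqs = aux n id eqs
  where
  aux : ∀ {A : Set} n (h : Fin n → A) {f : A → ℕ} {g : ℕ → ℕ} → (∀ u → f (h u) ≡ g (toℕ u)) →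
        total f (List.tabulate h) ≡ sum n g
  aux zero    h eqs = refl
  aux (suc n) h {g = g} eqs = trans (cong₂ _+_ (eqs zero) (aux n (h ∘ suc) (eqs ∘ suc)))
      (sym (sum-suc n g))

card-tabulate : ∀ n {b : Fin n → Bool} {g : ℕ → ℕ} → (∀ u → (if b u then 1 else 0) ≡ g (toℕ u)) →
                card (tabulate b) ≡ sum n g
card-tabulate zero    eqs = refl
card-tabulate (suc n) {b} {g} eqs with b zero | eqs zero
... | true  | p = trans (cong₂ _+_ p (card-tabulate n (eqs ∘ suc))) (sym (sum-suc n g))
... | false | p = trans (cong₂ _+_ p (card-tabulate n (eqs ∘ suc))) (sym (sum-suc n g))

max-≤ : ∀ k {f : Fin k → ℕ} {c} → (∀ i → f i ≤ c) → foldr _⊔_ 0 f ≤ c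
max-≤ zero    le = z≤n
max-≤ (suc k) le = ⊔-lub (le zero) (max-≤ k (le ∘ suc))

≤-max : ∀ k (f : Fin k → ℕ) i → f i ≤ foldr _⊔_ 0 f
≤-max (suc k) f zero    = m≤m⊔n (f zero) _
≤-max (suc k) f (suc i) = ≤-trans (≤-max k (f ∘ suc) i) (m≤n⊔m (f zero) _)

module Arrangements {n : ℕ} (G : Graph n) (c : ℕ) (mat : ℕ → ℕ)
  (matrix : ∀ u v → mat (toℕ u * n + toℕ v) ≡ (if adj G u v then 1 else 0)) where

  open Levels n c mat

  mat-01 : ∀ {j} → j < n * n → mat j ≤ 1
  mat-01 {j} j<nn = subst (_≤ 1) (trans (sym (matrix u v)) (cong mat position)) bool
    where
    u v : Fin n
    u = fromℕ< (row< j<nn)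
    v = fromℕ< (col< j<nn)

    divmod : ∀ m → m ≢ 0 → apply quot j m * m + apply rem j m ≡ j
    divmod zero    ne = ⊥-elim (ne refl)
    divmod m@(suc _) _ = trans (+-comm (j / m * m) (j % m)) (sym (m≡m%n+[m/n]*n j m))

    position : toℕ u * n + toℕ v ≡ j
    position = trans (cong₂ (λ x y → x * n + y) (toℕ-fromℕ< (row< j<nn)) (toℕ-fromℕ< (col< j<nn)))
                  (divmod n (>0⇒≢0 (≤-<-trans z≤n (row< j<nn))))

    bool : (if adj G u v then 1 else 0) ≤ 1
    bool with adj G u v
    ... | true  = ≤-refl
    ... | false = z≤n

  longs-rows : ∀ φ → longs φ ≡ sum n (λ u → sum n (λ v → lt u v * mat (u * n + v) * long (φ u)
      (φ v)))
  longs-rows φ = trans (sum-cong (n * n) λ {j} j<nn →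
      cong (λ x → lt (row j) (col j) * mat x * long (φ (row j)) (φ (col j)))
          (sym (divmod n j j<nn)))
    (sum-rows n n (λ u v → lt u v * mat (u * n + v) * long (φ u) (φ v)))
    where
    divmod : ∀ m j → j < m * m → apply quot j m * m + apply rem j m ≡ j
    divmod m@(suc _) j _ = trans (+-comm (j / m * m) (j % m)) (sym (m≡m%n+[m/n]*n j m))

  module _ (A : BucketArrangement n) {φ : ℕ → ℕ} (φ≡ : ∀ u → φ (toℕ u) ≡ 2 + toℕ (index A u)) where

    -- The offset 2 says that no bucket has been filled yet; it cancels in the differences that
    -- decide whether an edge is long.
    longEdges≡longs : longEdges G A ≡ longs φ
    longEdges≡longs = trans (length-filters (long? A) edge? (cartesianProduct (allFin n)
        (allFin n)))
      (trans (total-product _ (allFin n) (allFin n))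
        (trans (total-allFin n λ u → total-allFin n λ v → pointwise u v) (sym (longs-rows φ))))
      where
      edge? : ∀ (e : Fin n × Fin n) → Dec (proj₁ e Fin.< proj₂ e × T (adj G (proj₁ e) (proj₂ e)))
      edge? (u , v) = (u Fin.<? v) ×-dec T? (adj G u v)

      long≡ : ∀ u v → indicator (long? A (u , v)) ≡ long (φ (toℕ u)) (φ (toℕ v))
      long≡ u v rewrite φ≡ u | φ≡ v with ∣ toℕ (index A u) - toℕ (index A v) ∣ <? 2
      ... | yes p = trans (indicator-no (long? A (u , v)) (λ q → q p)) (sym (lt-no (≤⇒≯ (s≤s⁻¹ p))))
      ... | no  p = trans (indicator-yes (long? A (u , v)) p) (sym (lt-yes (≮⇒≥ p)))

      pointwise : ∀ u v → indicator (edge? (u , v)) * indicator (long? A (u , v)) ≡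
                          lt (toℕ u) (toℕ v) * mat (toℕ u * n + toℕ v) * long (φ (toℕ u))
                              (φ (toℕ v))
      pointwise u v = cong₂ _*_ (aux (toℕ u <? toℕ v) (adj G u v) refl) (long≡ u v)
        where
        aux : Dec (toℕ u < toℕ v) → ∀ b → adj G u v ≡ b → indicator (edge? (u , v)) ≡ lt (toℕ u)
            (toℕ v) * mat (toℕ u * n + toℕ v)
        aux (no p) b _ = trans (indicator-no (edge? (u , v)) (p ∘ proj₁))
            (cong (_* mat (toℕ u * n + toℕ v)) (sym (lt-no p)))
        aux (yes p) true q = trans (indicator-yes (edge? (u , v)) (p , subst T (sym q) tt))
          (sym (cong₂ _*_ (lt-yes p) (trans (matrix u v) (cong (λ b → if b then 1 else 0) q))))
        aux (yes p) false q = trans (indicator-no (edge? (u , v)) (λ r → subst T q (proj₂ r)))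
          (sym (cong₂ _*_ (lt-yes p) (trans (matrix u v) (cong (λ b → if b then 1 else 0) q))))

    card-bucket : ∀ i → card (bucket A i) ≡ count φ (2 + toℕ i)
    card-bucket i = card-tabulate n pointwise
      where
      pointwise : ∀ u → (if ⌊ index A u Fin.≟ i ⌋ then 1 else 0) ≡ eq (φ (toℕ u)) (2 + toℕ i)
      pointwise u rewrite φ≡ u with index A u Fin.≟ i
      ... | yes p = sym (eq-yes (cong toℕ p))
      ... | no  p = sym (eq-no (p ∘ toℕ-injective))

    vertex : ∀ {v} → (v<n : v < n) → φ v ≡ 2 + toℕ (index A (fromℕ< v<n))
    vertex v<n = trans (cong φ (sym (toℕ-fromℕ< v<n))) (φ≡ (fromℕ< v<n))

    arrangement-good : width A ≤ c → Good φ
    arrangement-good wd = record { cap = cap′ ; down = down′ }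
      where
      cap′ : ∀ j → count φ (2 + j) ≤ c
      cap′ j with j <? k A
      ... | yes p = subst (λ x → count φ (2 + x) ≤ c) (toℕ-fromℕ< p)
              (subst (_≤ c) (card-bucket (fromℕ< p)) (≤-trans (≤-max (k A) _ (fromℕ< p)) wd))
      ... | no  p = subst (_≤ c) (sym (sum-zero n λ v<n → eq-no λ q →
              p (subst (_< k A) (suc-injective (suc-injective (trans (sym (vertex v<n)) q)))
                  (toℕ<n _)))) z≤n

      down′ : ∀ {v j} → v < n → φ v ≡ 3 + j → ∃[ u ] u < n × φ u ≡ 2 + j
      down′ {v} {j} v<n p with onto A (fromℕ< j<k)
        where
        j<k : j < k A
        j<k = subst (_≤ k A) (suc-injective (suc-injective (trans (sym (vertex v<n)) p)))
            (<⇒≤ (toℕ<n _))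
      ... | u , q = toℕ u , toℕ<n u , trans (φ≡ u)
          (cong (2 +_) (trans (cong toℕ (q refl)) (toℕ-fromℕ< _)))

    arrangement-start : Start φ
    arrangement-start v<n = subst (2 ≤_) (sym (vertex v<n)) (s≤s (s≤s z≤n))

    good-width : Good φ → width A ≤ c
    good-width good = max-≤ (k A) λ i → subst (_≤ c) (sym (card-bucket i)) (cap good (toℕ i))

  module _ (A : BucketArrangement n) where

    levelsOf : ℕ → ℕ
    levelsOf v with v <? n
    ... | yes p = 2 + toℕ (index A (fromℕ< p))
    ... | no  _ = 0

    levelsOf≡ : ∀ u → levelsOf (toℕ u) ≡ 2 + toℕ (index A u)
    levelsOf≡ u with toℕ u <? n
    ... | yes p = cong (λ x → 2 + toℕ (index A x)) (fromℕ<-toℕ u p)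
    ... | no  p = ⊥-elim (p (toℕ<n u))

  module _ {φ : ℕ → ℕ} (good : Good φ) (start : Start φ) where

    private
      f : ℕ → ℕ
      f v = φ v ∸ 2

      φ≡2+f : ∀ {v} → v < n → φ v ≡ 2 + f v
      φ≡2+f v<n = sym (m+[n∸m]≡n (start v<n))

    arrange : BucketArrangement n
    arrange = record
      -- One more than the largest index; by `lowest` all smaller indices occur as well.
      { k     = top n f
      ; index = λ u → fromℕ< (top-> n f (toℕ<n u))
      ; onto  = onto′ }
      where
      onto′ : ∀ (y : Fin (top n f)) → ∃[ u ] ∀ {z} → z ≡ u → fromℕ< (top-> n f (toℕ<n z)) ≡ y
      onto′ y with top-attained n f (≤-<-trans z≤n (toℕ<n y))
      ... | j , j<n , p with lowest good (f j) j<n (φ≡2+f j<n)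
          (s≤s⁻¹ (subst (toℕ y <_) (sym p) (toℕ<n y)))
      ...   | u , u<n , q = fromℕ< u<n , λ { refl → toℕ-injective (trans (toℕ-fromℕ< _)
                (trans (cong f (toℕ-fromℕ< u<n)) (cong (_∸ 2) q))) }

    arrange≡ : ∀ u → φ (toℕ u) ≡ 2 + toℕ (index arrange u)
    arrange≡ u = trans (φ≡2+f (toℕ<n u)) (cong (2 +_) (sym (toℕ-fromℕ< (top-> n f (toℕ<n u)))))

    arrange-optimal : (∀ ψ → Good ψ → Start ψ → longs φ ≤ longs ψ) → Optimal G c arrange
    arrange-optimal best = good-width arrange {φ} arrange≡ good , λ A′ wd →
      subst₂ _≤_ (sym (longEdges≡longs arrange {φ} arrange≡))
          (sym (longEdges≡longs A′ {levelsOf A′} (levelsOf≡ A′)))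
        (best (levelsOf A′) (arrangement-good A′ {levelsOf A′} (levelsOf≡ A′) wd)
            (arrangement-start A′ {levelsOf A′} (levelsOf≡ A′)))

    arrange-output : ∀ {μ} → μ 0 ≡ top n f → (∀ {v} → v < n → μ (suc v) ≡ f v) → Output arrange μ
    arrange-output p q = record
      { buckets = p
      ; indices = λ u → trans (q (toℕ<n u)) (sym (toℕ-fromℕ< (top-> n f (toℕ<n u)))) }

program-solves : Solves program 20 Times.time space
program-solves n G c w μ aL≤w inp =
  ≤-trans (m≤m+n (2 + n * n) (n + 1)) (m≤m+n _ _) , finish (run-program {σ = σ₀} (order inp)
      (capacity inp) (λ _ → refl))
  where
  open Input
  open Machine w (space n)

  σ₀ : State 11
  σ₀ = ⟨ const 0 , μ ⟩

  -- Read off the memory itself: the first `n * n` values are the adjacency matrix, and the others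
  -- are arbitrary.
  mat : ℕ → ℕ
  mat j = μ (2 + j)

  open Arrangements G c mat (matrix inp)
  open Run n c w mat aL≤w mat-01
  open Levels n c mat

  finish : Logic.Runs w (space n) 20 n aL≤w σ₀ program (Times.time n) (λ σ′ → Outcome (mem σ′)) →
           ∃[ t ] ∃[ σ ] (⟨ const 0 , μ ⟩ ⊢ program ⇓[ t ] σ) × t ≤ Times.time n ×
             ((∃[ A ] width {n} A ≤ c) → ∃[ A ] Optimal G c A × Output A (mem σ))
  finish (t , σ , d , t≤ , out) = t , σ , d , t≤ , λ (A , wd) → solution A wd out
    where
    solution : ∀ A → width {n} A ≤ c → Outcome (mem σ) → ∃[ A ] Optimal G c A × Output A (mem σ)
    solution A wd (inj₁ none) = ⊥-elim (none (levelsOf A) (arrangement-good A {levelsOf A}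
        (levelsOf≡ A) wd) (arrangement-start A {levelsOf A} (levelsOf≡ A)))
    solution A wd (inj₂ (φ , good , start , best , w₀ , w₊)) =
      arrange good start , arrange-optimal good start best , arrange-output good start w₀ w₊

-- Growth rates

-- (1 + 1/p)ᵐ ≥ 1 + m/p with denominators cleared.
bernoulli : ∀ p m → (p + m) * p ^ m ≤ p * suc p ^ m
bernoulli p zero    = ≤-reflexive (cong (_* 1) (+-identityʳ p))
bernoulli p (suc m) = begin
  (p + suc m) * (p * p ^ m)             ≤⟨ m≤m+n _ (m * p ^ m) ⟩
  (p + suc m) * (p * p ^ m) + m * p ^ m ≡⟨ solve 3 (λ p m x → (p :+ (κ 1 :+ m)) :* (p :* x) :+ m :*
      x :=
                                              (κ 1 :+ p) :* ((p :+ m) :* x)) refl p m (p ^ m) ⟩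
  suc p * ((p + m) * p ^ m)             ≤⟨ *-monoʳ-≤ (suc p) (bernoulli p m) ⟩
  suc p * (p * suc p ^ m)               ≡⟨ solve 3 (λ s p x → s :* (p :* x) := p :* (s :* x)) refl
      (suc p) p (suc p ^ m) ⟩
  p * (suc p * suc p ^ m)               ∎
  where open ≤-Reasoning

-- By `bernoulli`, used twice, `(1 + m/p)²` is at most the `m`-th power of `(1 + 1/p)²`, and by
-- hypothesis `E` exceeds `D` by at least the latter factor. Multiplying by `p ^ m * p ^ m` avoids
-- fractions.
quadratic-growth : ∀ p D E .{{_ : NonZero p}} → suc p * suc p * D ≤ p * p * E →
                   ∀ m → (p + m) * (p + m) * D ^ m ≤ p * p * E ^ m
quadratic-growth p D E crit m = *-cancelʳ-≤ _ _ (p ^ m * p ^ m)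
    {{m*n≢0 (p ^ m) (p ^ m) {{m^n≢0 p m}} {{m^n≢0 p m}}}} (begin
  (p + m) * (p + m) * D ^ m * (p ^ m * p ^ m)
    ≡⟨ solve 3 (λ a x d → a :* a :* d :* (x :* x) := a :* x :* (a :* x) :* d) refl (p + m) (p ^ m)
        (D ^ m) ⟩
  (p + m) * p ^ m * ((p + m) * p ^ m) * D ^ m
    ≤⟨ *-monoˡ-≤ (D ^ m) (*-mono-≤ (bernoulli p m) (bernoulli p m)) ⟩
  p * suc p ^ m * (p * suc p ^ m) * D ^ m
    ≡⟨ solve 3 (λ p y d → p :* y :* (p :* y) :* d := p :* p :* (y :* y :* d)) refl p (suc p ^ m)
        (D ^ m) ⟩
  p * p * (suc p ^ m * suc p ^ m * D ^ m)
    ≡⟨ cong (λ z → p * p * z) (trans (^-distribʳ-* m (suc p * suc p) D)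
        (cong (_* D ^ m) (^-distribʳ-* m (suc p) (suc p)))) ⟨
  p * p * (suc p * suc p * D) ^ m
    ≤⟨ *-monoʳ-≤ (p * p) (^-monoˡ-≤ m crit) ⟩
  p * p * (p * p * E) ^ m
    ≡⟨ cong (λ z → p * p * z) (trans (^-distribʳ-* m (p * p) E)
        (cong (_* E ^ m) (^-distribʳ-* m p p))) ⟩
  p * p * (p ^ m * p ^ m * E ^ m)
    ≡⟨ solve 3 (λ p x e → p :* p :* (x :* x :* e) := p :* p :* e :* (x :* x)) refl p (p ^ m) (E ^ m)
        ⟩
  p * p * E ^ m * (p ^ m * p ^ m) ∎)
  where open ≤-Reasoning

open Times using (half; fourⁿ; eightʰ)

square : ℕ → ℕ
square n = suc n * suc n

-- With `m = n / 2` both sides become `m`-th powers, of `D` and of `b * b`. Rounding costs a factor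
-- `y * (x * d)`, and the polynomial is at most 4 times the square of `p + m`.
exponential : ∀ x y d b p .{{_ : NonZero y}} .{{_ : NonZero (x * d)}} .{{_ : NonZero b}}
    .{{_ : NonZero p}} →
              suc p * suc p * (y * (x * d * (x * d))) ≤ p * p * (b * b) →
              (λ n → square n * (x ^ n * y ^ half n)) ∈O[ b / d ]
exponential x y d b p crit = 4 * (y * (x * d)) * (p * p) , 0 , λ n _ → bound n
  where
  open ≤-Reasoning
  D = y * (x * d * (x * d))

  bound : ∀ n → square n * (x ^ n * y ^ half n) * d ^ n ≤ 4 * (y * (x * d)) * (p * p) * b ^ n
  bound n = begin
    square n * (x ^ n * y ^ half n) * d ^ n
      ≡⟨ solve 4 (λ s a c e → s :* (a :* c) :* e := s :* (a :* e :* c)) refl (square n) (x ^ n)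
          (y ^ half n) (d ^ n) ⟩
    square n * (x ^ n * d ^ n * y ^ half n)
      ≡⟨ cong (λ z → square n * (z * y ^ half n)) (^-distribʳ-* n x d) ⟨
    square n * ((x * d) ^ n * y ^ half n)
      ≤⟨ *-mono-≤ square≤ (*-mono-≤ power≤ (^-monoʳ-≤ y half≤)) ⟩
    4 * ((p + m) * (p + m)) * (x * d * (x * d * (x * d)) ^ m * (y * y ^ m))
      ≡⟨ solve 5 (λ s e f g y → κ 4 :* s :* (e :* f :* (y :* g)) := κ 4 :* (y :* e) :*
          (s :* (g :* f))) refl
           ((p + m) * (p + m)) (x * d) ((x * d * (x * d)) ^ m) (y ^ m) y ⟩
    4 * (y * (x * d)) * ((p + m) * (p + m) * (y ^ m * (x * d * (x * d)) ^ m))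
      ≡⟨ cong (λ z → 4 * (y * (x * d)) * ((p + m) * (p + m) * z))
          (^-distribʳ-* m y (x * d * (x * d))) ⟨
    4 * (y * (x * d)) * ((p + m) * (p + m) * D ^ m)
      ≤⟨ *-monoʳ-≤ (4 * (y * (x * d))) (quadratic-growth p D (b * b) crit m) ⟩
    4 * (y * (x * d)) * (p * p * (b * b) ^ m)
      ≤⟨ *-monoʳ-≤ (4 * (y * (x * d))) (*-monoʳ-≤ (p * p) bⁿ≥) ⟩
    4 * (y * (x * d)) * (p * p * b ^ n)
      ≡⟨ *-assoc (4 * (y * (x * d))) (p * p) (b ^ n) ⟨
    4 * (y * (x * d)) * (p * p) * b ^ n ∎
    where
    m = n / 2

    n≡ : n ≡ n % 2 + (m + m)
    n≡ = trans (m≡m%n+[m/n]*n n 2) (cong (n % 2 +_)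
        (trans (*-comm m 2) (cong (m +_) (+-identityʳ m))))

    n≤ : n ≤ 1 + (m + m)
    n≤ = subst (_≤ 1 + (m + m)) (sym n≡) (+-monoˡ-≤ (m + m) (s≤s⁻¹ (m%n<n n 2)))

    half≤ : half n ≤ suc m
    half≤ = subst (half n ≤_) (trans (cong (_/ 2) (+-comm n 2))
        (+-distrib-/-∣ˡ n {2} (divides-refl 1)))
      (/-monoˡ-≤ 2 (+-monoʳ-≤ n (n≤1+n 1)))

    square≤ : square n ≤ 4 * ((p + m) * (p + m))
    square≤ = ≤-trans (*-mono-≤ 1+n≤ 1+n≤)
      (≤-reflexive (solve 1 (λ z → κ 2 :* z :* (κ 2 :* z) := κ 4 :* (z :* z)) refl (p + m)))
      where
      1+n≤ : suc n ≤ 2 * (p + m)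
      1+n≤ = ≤-trans (s≤s n≤) (≤-trans
          (≤-reflexive (solve 1 (λ m → κ 2 :+ (m :+ m) := κ 2 :* (κ 1 :+ m)) refl m))
        (*-monoʳ-≤ 2 (+-monoˡ-≤ m (>-nonZero⁻¹ p))))

    double : ∀ z → z ^ (m + m) ≡ (z * z) ^ m
    double z = trans (^-distribˡ-+-* z m m) (sym (^-distribʳ-* m z z))

    power≤ : (x * d) ^ n ≤ x * d * (x * d * (x * d)) ^ m
    power≤ = ≤-trans (^-monoʳ-≤ (x * d) n≤) (≤-reflexive (cong (x * d *_) (double (x * d))))

    bⁿ≥ : (b * b) ^ m ≤ b ^ n
    bⁿ≥ = subst (_≤ b ^ n) (double b)
        (^-monoʳ-≤ b (subst (m + m ≤_) (sym n≡) (m≤n+m (m + m) (n % 2))))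

-- Bounds up to constant factors

infix 4 _≲_

record _≲_ (f P : ℕ → ℕ) : Set where
  constructor _,_
  field
    factor : ℕ
    bound  : ∀ n → f n ≤ P n * factor

≲-∈O : ∀ {f P b d} → f ≲ P → P ∈O[ b / d ] → f ∈O[ b / d ]
≲-∈O {f} {P} {b} {d} (k , f≤) (C , n₀ , P≤) = C * k , n₀ , λ n n₀≤n → begin
  f n * d ^ n       ≤⟨ *-monoˡ-≤ (d ^ n) (f≤ n) ⟩
  P n * k * d ^ n   ≡⟨ swap (P n) k (d ^ n) ⟩
  P n * d ^ n * k   ≤⟨ *-monoˡ-≤ k (P≤ n n₀≤n) ⟩
  C * b ^ n * k     ≡⟨ swap C (b ^ n) k ⟩
  C * k * b ^ n     ∎
  where
  open ≤-Reasoning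
  swap : ∀ x y z → x * y * z ≡ x * z * y
  swap = solve 3 (λ x y z → x :* y :* z := x :* z :* y) refl

≲-+ : ∀ {f g P} → f ≲ P → g ≲ P → (λ n → f n + g n) ≲ P
≲-+ {P = P} (k , f≤) (l , g≤) = k + l , λ n →
  ≤-trans (+-mono-≤ (f≤ n) (g≤ n)) (≤-reflexive (sym (*-distribˡ-+ (P n) k l)))

≲-const : ∀ {P} k → (∀ n → 1 ≤ P n) → const k ≲ P
≲-const {P} k 1≤P = k , λ n → subst (_≤ P n * k) (+-identityʳ k) (*-monoˡ-≤ k (1≤P n))

≲-mono : ∀ {f P R} → (∀ n → P n ≤ R n) → f ≲ P → f ≲ R
≲-mono P≤R (k , f≤) = k , λ n → ≤-trans (f≤ n) (*-monoˡ-≤ k (P≤R n))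

≲-* : ∀ {f g P R} → f ≲ P → g ≲ R → (λ n → f n * g n) ≲ (λ n → P n * R n)
≲-* {P = P} {R} (k , f≤) (l , g≤) = k * l , λ n → ≤-trans (*-mono-≤ (f≤ n) (g≤ n))
  (≤-reflexive (solve 4 (λ a k b l → a :* k :* (b :* l) := a :* b :* (k :* l)) refl (P n) k (R n)
      l))

-- Charging the final test as a full round gives a product, to which `≲-*` applies.
forTime-≤ : ∀ N tb cl → forTime N tb cl ≤ suc N * (7 + cl + tb)
forTime-≤ N tb cl = begin
  2 + (N * (3 + cl + (tb + 4)) + (3 + cl))
    ≤⟨ m≤m+n _ (2 + tb) ⟩
  2 + (N * (3 + cl + (tb + 4)) + (3 + cl)) + (2 + tb)
    ≡⟨ solve 3 (λ N tb cl → κ 2 :+ (N :* (κ 3 :+ cl :+ (tb :+ κ 4)) :+ (κ 3 :+ cl)) :+ (κ 2 :+ tb)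
        :=
                  (κ 1 :+ N) :* (κ 7 :+ cl :+ tb)) refl N tb cl ⟩
  suc N * (7 + cl + tb) ∎
  where open ≤-Reasoning

≲-for : ∀ {N tb P R : ℕ → ℕ} {cl} → (λ n → suc (N n)) ≲ R → (∀ n → 1 ≤ P n) → tb ≲ P →
        (λ n → forTime (N n) (tb n) cl) ≲ (λ n → R n * P n)
≲-for {N} {tb} {P} {R} {cl} N≲ 1≤P tb≲
  with ≲-* {λ n → suc (N n)} {λ n → 7 + cl + tb n} {R} {P} N≲ (≲-+ (≲-const (7 + cl) 1≤P) tb≲)
... | k , le = k , λ n → ≤-trans (forTime-≤ (N n) (tb n) cl) (le n)

1≤square : ∀ n → 1 ≤ square n
1≤square n = s≤s z≤n

1≤fourⁿ : ∀ n → 1 ≤ fourⁿ n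
1≤fourⁿ n = *-mono-≤ (m^n>0 2 n) (m^n>0 2 n)

half≤n : ∀ n → half n ≤ n
half≤n n = subst (half n ≤_) (m*n/n≡m n 2) (aux n)
  where
  aux : ∀ n → (n + 1) / 2 ≤ n * 2 / 2
  aux zero    = z≤n
  aux (suc n) = /-monoˡ-≤ 2 (subst (_≤ suc n * 2) (+-comm 1 (suc n)) (s≤s (s≤s (m≤m*n n 2))))

*1 : ∀ {x y} → x ≤ y → x ≤ y * 1
*1 {x} {y} = subst (x ≤_) (sym (*-identityʳ y))

n-≲ : (λ n → suc n) ≲ square
n-≲ = 1 , λ n → *1 (m≤m*n (suc n) (suc n))

half-≲ : (λ n → suc (half n)) ≲ square
half-≲ = 1 , λ n → *1 (≤-trans (s≤s (half≤n n)) (m≤m*n (suc n) (suc n)))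

nn-≲ : (λ n → suc (n * n)) ≲ square
nn-≲ = 1 , λ n → *1 (s≤s (≤-trans (*-monoʳ-≤ n (n≤1+n n)) (m≤n+m (n * suc n) n)))

loop-≲ : ∀ {N : ℕ → ℕ} tb cl → (λ n → suc (N n)) ≲ square → (λ n → forTime (N n) tb cl) ≲ square
loop-≲ {N} tb cl N≲ = ≲-mono {P = λ n → square n * 1} (λ n → ≤-reflexive (*-identityʳ (square n)))
  (≲-for {N} {const tb} {const 1} {square} {cl} N≲ (λ _ → ≤-refl) (≲-const tb (λ _ → ≤-refl)))

sum-≲ : ∀ {N : ℕ → ℕ} e lim → (λ n → suc (N n)) ≲ square → (λ n → sumTime (N n) e lim) ≲ square
sum-≲ {N} e lim N≲ = ≲-+ (≲-const 2 1≤square) (loop-≲ {N} (3 + cost e) (cost lim) N≲)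

fill-≲ : ∀ {N : ℕ → ℕ} ae ve lim → (λ n → suc (N n)) ≲ square → (λ n → fillTime (N n) ae ve lim) ≲
    square
fill-≲ {N} ae ve lim = loop-≲ {N} (suc (cost ae + cost ve)) (cost lim)

c-≲ : ∀ k → const k ≲ square
c-≲ k = ≲-const k 1≤square

update-≲ : Times.updateTime ≲ square
update-≲ = ≲-+ (c-≲ (suc (cost (placeE (var oldᵣ) (lit 0)) + cost (var valᵣ ⟨ add ⟩ var longᵣ))))
    (fill-≲ {id} (placeE (var oldᵣ) sucE) blockE nE n-≲)

relax-≲ : Times.relaxTime ≲ square
relax-≲ = ≲-+ (c-≲ (suc (cost τE))) (≲-+ (sum-≲ {id} onesE nE n-≲) (≲-+ (sum-≲ {id} restE nE n-≲)
    (≲-+ (sum-≲ {half} violE hE half-≲)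
  (≲-+ (sum-≲ {half} oldE hE half-≲) (≲-+ (sum-≲ {half} newE hE half-≲)
      (≲-+ (sum-≲ {λ n → n * n} longE (nE ⟨ mul ⟩ nE) nn-≲)
  (≲-+ (c-≲ (suc (cost valE))) (≲-+ (c-≲ (suc (cost testE))) update-≲))))))))

-- Shows that clearing the table is dominated by the pass through the codes.
eightʰ≤ : ∀ n → eightʰ n ≤ 2 * fourⁿ n
eightʰ≤ n = begin
  2 ^ half n * 2 ^ half n * 2 ^ half n ≡⟨ cong (_* 2 ^ half n) (^-distribˡ-+-* 2 (half n) (half n))
      ⟨
  2 ^ (half n + half n) * 2 ^ half n   ≤⟨ *-mono-≤ (^-monoʳ-≤ 2 half+half) (^-monoʳ-≤ 2 (half≤n n))
      ⟩
  2 ^ suc n * 2 ^ n                    ≡⟨ *-assoc 2 (2 ^ n) (2 ^ n) ⟩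
  2 * fourⁿ n                          ∎
  where
  open ≤-Reasoning
  half+half : half n + half n ≤ suc n
  half+half = begin
    half n + half n  ≡⟨ cong (half n +_) (+-identityʳ (half n)) ⟨
    2 * half n       ≡⟨ *-comm 2 (half n) ⟩
    half n * 2       ≤⟨ m/n*n≤m (n + 1) 2 ⟩
    n + 1            ≡⟨ +-comm n 1 ⟩
    suc n            ∎

guess-≲ : Times.guessTime ≲ (λ n → fourⁿ n * square n)
guess-≲ = ≲-+
  (≲-for {eightʰ} {const (suc (cost (placeE sucE (lit 0)) + 1))} {square} {fourⁿ} {cost (cubeE hE)}
    (3 , λ n → ≤-trans (+-mono-≤ (1≤fourⁿ n) (eightʰ≤ n)) (≤-reflexive (*-comm 3 (fourⁿ n))))
        1≤square (c-≲ (suc (cost (placeE sucE (lit 0)) + 1))))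
  (≲-for {fourⁿ} {Times.relaxTime} {square} {fourⁿ} {cost (powE nE ⟨ mul ⟩ powE nE)}
    (2 , λ n → ≤-trans (+-monoˡ-≤ (fourⁿ n) (1≤fourⁿ n))
        (≤-reflexive (trans (cong (fourⁿ n +_) (sym (+-identityʳ _))) (*-comm 2 (fourⁿ n)))))
        1≤square relax-≲)

work : ℕ → ℕ
work n = 2 ^ half n * (fourⁿ n * square n)

square≤work : ∀ n → square n ≤ work n
square≤work n = ≤-trans (≤-trans (≤-reflexive (sym (+-identityʳ _)))
    (*-monoˡ-≤ (square n) (1≤fourⁿ n)))
  (≤-trans (≤-reflexive (sym (+-identityʳ _))) (*-monoˡ-≤ (fourⁿ n * square n) (m^n>0 2 (half n))))

time-≲ : Times.time ≲ work
time-≲ = ≲-+ (≲-mono square≤work (≲-+ (c-≲ (suc (cost baseE + 1)))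
    (≲-+ (fill-≲ {id} (baseE ⟨ add ⟩ sucE) (lit 2 ⟨ mul ⟩ powE iE) nE n-≲)
    (c-≲ (suc (cost (placeE (lit 0) (lit 0)) + 1))))))
  (≲-+ (≲-for {λ n → 2 ^ half n} {Times.guessTime} {λ n → fourⁿ n * square n} {λ n → 2 ^ half n}
      {cost (powE hE)}
      (2 , λ n → ≤-trans (+-monoˡ-≤ _ (m^n>0 2 (half n)))
          (≤-reflexive (trans (cong (2 ^ half n +_) (sym (+-identityʳ _)))
          (*-comm 2 (2 ^ half n)))))
      (λ n → *-mono-≤ (1≤fourⁿ n) (1≤square n)) guess-≲)
    (≲-mono square≤work (≲-+ (c-≲ (suc (cost (valueE (lit 0)))))
      (≲-+ (≲-+ (c-≲ 2) (loop-≲ {id} (suc (cost topE)) (cost nE) n-≲))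
          (≲-+ (fill-≲ {id} sucE ⟦ placeE (lit 0) sucE ⟧ nE n-≲) (c-≲ 3))))))

-- 130000, and 40000 below, are chosen so that (1 + 1/130000)² ≤ 56569² / (32 · 10⁸)
-- and (1 + 1/40000)² ≤ 28285² / (8 · 10⁸).
time-∈O : Times.time ∈O[ 56569 / 10000 ]
time-∈O = ≲-∈O {P = λ n → square n * (4 ^ n * 2 ^ half n)} {d = 10000}
    (≲-mono (λ n → ≤-reflexive (work≡ n)) time-≲)
  (exponential 4 2 10000 56569 130000 (≤ᵇ⇒≤ _ _ tt))
  where
  work≡ : ∀ n → work n ≡ square n * (4 ^ n * 2 ^ half n)
  work≡ n = trans (solve 3 (λ a b c → a :* (b :* c) := c :* (b :* a)) refl (2 ^ half n) (fourⁿ n)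
      (square n))
    (cong (λ z → square n * (z * 2 ^ half n)) (sym (^-distribʳ-* n 2 2)))

space-∈O : space ∈O[ 28285 / 10000 ]
space-∈O = ≲-∈O {P = λ n → square n * (1 ^ n * 8 ^ half n)} {d = 10000} (7 , space≤)
    (exponential 1 8 10000 28285 40000 (≤ᵇ⇒≤ _ _ tt))
  where
  open ≤-Reasoning

  eight : ∀ n → eightʰ n ≡ 8 ^ half n
  eight n = trans (cong (_* 2 ^ half n) (sym (^-distribʳ-* (half n) 2 2)))
      (sym (^-distribʳ-* (half n) 4 2))

  poly : ∀ n → 2 + n * n + (n + 1) + 2 * (n + 1) ≤ square n * 5
  -- The added term is the exact difference of the two sides.
  poly n = ≤-trans (m≤m+n _ (4 * (n * n) + 7 * n)) (≤-reflexive
    (solve 1 (λ n → κ 2 :+ n :* n :+ (n :+ κ 1) :+ κ 2 :* (n :+ κ 1) :+ (κ 4 :* (n :* n) :+ κ 7 :*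
        n) :=
      (κ 1 :+ n) :* (κ 1 :+ n) :* κ 5) refl n))

  space≤ : ∀ n → space n ≤ square n * (1 ^ n * 8 ^ half n) * 7
  space≤ n = begin
    2 + n * n + (n + 1) + suc (eightʰ n) * (n + 1)
      ≡⟨ cong (λ z → 2 + n * n + (n + 1) + suc z * (n + 1)) (eight n) ⟩
    2 + n * n + (n + 1) + suc e * (n + 1)
      ≤⟨ +-mono-≤ (≤-trans (m≤m+n (2 + n * n + (n + 1)) (2 * (n + 1))) (poly n))
          (*-mono-≤ (+-monoˡ-≤ e 1≤e) (≤-trans (≤-reflexive (+-comm n 1)) (m≤m*n (suc n) (suc n))))
          ⟩
    square n * 5 + (e + e) * square n
      ≤⟨ +-monoˡ-≤ _ (m≤m*n (square n * 5) e {{>-nonZero 1≤e}}) ⟩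
    square n * 5 * e + (e + e) * square n
      ≡⟨ solve 2 (λ s e → s :* κ 5 :* e :+ (e :+ e) :* s := s :* (κ 1 :* e) :* κ 7) refl (square n)
          e ⟩
    square n * (1 * e) * 7
      ≡⟨ cong (λ z → square n * (z * e) * 7) (^-zeroˡ n) ⟨
    square n * (1 ^ n * e) * 7 ∎
    where
    e = 8 ^ half n
    1≤e : 1 ≤ e
    1≤e = m^n>0 8 (half n)

theorem3 : ∃[ r ] Σ[ p ∈ Cmd r ] ∃[ a ] Σ[ T ∈ (ℕ → ℕ) ] Σ[ S ∈ (ℕ → ℕ) ]
    (T ∈O[ 56569 / 10000 ] × S ∈O[ 28285 / 10000 ] × Solves p a T S)
theorem3 = 11 , program , 20 , Times.time , space , time-∈O , space-∈O , program-solves
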